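{- Let $\mathbb{M}$ be the set of all matroids (up to isomorphism) of rank at least three of the form $[AG(r-1,2)+e]\backslash X$, where $X\subseteq E(AG(r-1,2))$ is such that $AG(r-1,2)\backslash X$ is hyperplane-complementary of rank $r$. A binary matroid $M$ is an excluded series minor for the class of circuit-difference matroids if and only if $M^*\in\mathbb{M}$.
   Context: All matroids are finite. A matroid $M$ is circuit-difference if the symmetric difference $C_1\triangle C_2$ is a circuit of $M$ whenever $C_1$ and $C_2$ are distinct circuits of $M$ with $C_1\cap C_2\neq\emptyset$. A series contraction of a matroid is the contraction of an element $e$ for which there is an element $f\neq e$ such that $\{e,f\}$ is a cocircuit. A series minor of $M$ is a matroid obtained from $M$ by a (possibly empty) sequence of single-element deletions and series contractions. An excluded series minor for a class of matroids is a matroid that is not in the class but all of whose proper series minors are in the class. A matroid is hyperplane-complementary if the complement (in the ground set) of every hyperplane is a hyperplane. $AG(r-1,2)$ is the rank-$r$ binary affine geometry, obtained from the binary projective geometry $PG(r-1,2)$ by deleting all the elements of a hyperplane. $AG(r-1,2)+e$ denotes the unique (up to isomorphism) simple binary rank-$r$ single-element extension of $AG(r-1,2)$, where $e$ is the added element; equivalently, it is obtained from $PG(r-1,2)$ by deleting all elements of a hyperplane except for one element $e$ of that hyperplane. -}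

module Defs where

open import Algebra.Bundles using (CommutativeRing)
open import Data.Bool.Base using (Bool; true; false; _∧_; _xor_)
open import Data.Bool.Properties using (xor-∧-commutativeRing; ∧-distribˡ-xor; ∧-zeroʳ)
  renaming (_≟_ to _≟ᵇ_)
open import Data.Fin.Base using (Fin; zero; finToFun; funToFin)
open import Data.Fin.Properties using (2↔Bool; any?; all?)
open import Data.Fin.Subset
open import Data.Fin.Subset.Properties
open import Data.List.Base using (List; []; _∷_; _++_; map; filter)
open import Data.List.Extrema.Nat using (max)
open import Data.Nat.Base using (ℕ; zero; suc; _+_; _≤_; _<_; s≤s⁻¹; _^_)
import Data.Nat.Properties as ℕ
open import Data.Product.Base using (Σ-syntax; ∃; ∃-syntax; _×_; _,_; proj₁; proj₂)
open import Data.Sum.Base using (_⊎_; inj₁; inj₂; [_,_]′)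
open import Data.Vec.Base using ([]; _∷_; lookup; zipWith; there)
open import Data.Vec.Properties
  using ([]=⇒lookup; lookup⇒[]=; lookup-zipWith; lookup-replicate; ≡-dec)
open import Function.Base using (_∘_)
open import Function.Bundles using (_⇔_; _↔_; Inverse)
open import Level using (0ℓ)
open import Relation.Binary.Construct.Closure.ReflexiveTransitive using (Star)
open import Relation.Binary.PropositionalEquality
open import Relation.Nullary.Decidable
  using (Dec; yes; no; ¬?; _×-dec_; map′; decidable-stable)
open import Relation.Nullary.Negation using (¬_; contradiction)
open import Relation.Unary using (Pred; Decidable)

open import Algebra.Properties.CommutativeMonoid.Sum
  (CommutativeRing.+-commutativeMonoid xor-∧-commutativeRing)
  using (sum; ∑-distrib-+; sum-cong-≗; sum-replicate-zero)

private
  variable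
    m n k : ℕ

-- The ground set is an arbitrary subset of Fin n rather than Fin n itself, so
-- that minors keep the names of their elements.
record Matroid (n : ℕ) : Set₁ where
  field
    ground         : Subset n
    Indep          : Pred (Subset n) 0ℓ
    indep?         : Decidable Indep
    indep⊆ground   : ∀ {I} → Indep I → I ⊆ ground
    indep-⊥        : Indep ⊥
    indep-⊆        : ∀ {I J} → I ⊆ J → Indep J → Indep I
    indep-exchange : ∀ {I J} → Indep I → Indep J → ∣ I ∣ < ∣ J ∣ →
                     ∃[ e ] e ∈ J × e ∉ I × Indep (I ∪ ⁅ e ⁆)

open Matroid public

infixr 6 _△_

_△_ : Subset n → Subset n → Subset n
_△_ = zipWith _xor_

Circuit : Matroid n → Subset n → Set
Circuit M C = C ⊆ ground M × ¬ Indep M C × (∀ {D} → D ⊂ C → Indep M D)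

Basis : Matroid n → Subset n → Set
Basis M B = Indep M B × (∀ {I} → Indep M I → B ⊄ I)

subsets : ∀ n → List (Subset n)
subsets zero    = [] ∷ []
subsets (suc n) = map (outside ∷_) (subsets n) ++ map (inside ∷_) (subsets n)

rank : Matroid n → Subset n → ℕ
rank {n} M X =
  max 0 (map ∣_∣ (filter (λ I → indep? M I ×-dec (I ⊆? X)) (subsets n)))

rk : Matroid n → ℕ
rk M = rank M (ground M)

Flat : Matroid n → Subset n → Set
Flat M F = F ⊆ ground M ×
  (∀ {e} → e ∈ ground M → rank M (F ∪ ⁅ e ⁆) ≡ rank M F → e ∈ F)

Hyperplane : Matroid n → Subset n → Set
Hyperplane M H = Flat M H × suc (rank M H) ≡ rk M

infix 4 _≅_

-- The hypothesis relating I and J says that J is the image of I under φ.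
_≅_ : Matroid m → Matroid n → Set
M ≅ N = Σ[ φ ∈ (∃ (_∈ ground M) ↔ ∃ (_∈ ground N)) ]
  (∀ {I J} → I ⊆ ground M → J ⊆ ground N →
   (∀ x → proj₁ x ∈ I ⇔ proj₁ (Inverse.to φ x) ∈ J) →
   Indep M I ⇔ Indep N J)

∣p─q∣+∣p∩q∣≡∣p∣ : (p q : Subset n) → ∣ p ─ q ∣ + ∣ p ∩ q ∣ ≡ ∣ p ∣
∣p─q∣+∣p∩q∣≡∣p∣ []            []            = refl
∣p─q∣+∣p∩q∣≡∣p∣ (inside ∷ p)  (inside ∷ q)  =
  trans (ℕ.+-suc _ _) (cong suc (∣p─q∣+∣p∩q∣≡∣p∣ p q))
∣p─q∣+∣p∩q∣≡∣p∣ (inside ∷ p)  (outside ∷ q) = cong suc (∣p─q∣+∣p∩q∣≡∣p∣ p q)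
∣p─q∣+∣p∩q∣≡∣p∣ (outside ∷ p) (inside ∷ q)  = ∣p─q∣+∣p∩q∣≡∣p∣ p q
∣p─q∣+∣p∩q∣≡∣p∣ (outside ∷ p) (outside ∷ q) = ∣p─q∣+∣p∩q∣≡∣p∣ p q

∣p∪q∣≡∣p∣+∣q─p∣ : (p q : Subset n) → ∣ p ∪ q ∣ ≡ ∣ p ∣ + ∣ q ─ p ∣
∣p∪q∣≡∣p∣+∣q─p∣ []            []            = refl
∣p∪q∣≡∣p∣+∣q─p∣ (inside ∷ p)  (inside ∷ q)  = cong suc (∣p∪q∣≡∣p∣+∣q─p∣ p q)
∣p∪q∣≡∣p∣+∣q─p∣ (inside ∷ p)  (outside ∷ q) = cong suc (∣p∪q∣≡∣p∣+∣q─p∣ p q)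
∣p∪q∣≡∣p∣+∣q─p∣ (outside ∷ p) (inside ∷ q)  =
  trans (cong suc (∣p∪q∣≡∣p∣+∣q─p∣ p q)) (sym (ℕ.+-suc _ _))
∣p∪q∣≡∣p∣+∣q─p∣ (outside ∷ p) (outside ∷ q) = ∣p∪q∣≡∣p∣+∣q─p∣ p q

x∈p─q⇒x∉q : ∀ {x} (p q : Subset n) → x ∈ p ─ q → x ∉ q
x∈p─q⇒x∉q (_ ∷ _) (inside ∷ _)  (there x∈) (there x∈q) = x∈p─q⇒x∉q _ _ x∈ x∈q
x∈p─q⇒x∉q (_ ∷ _) (outside ∷ _) (there x∈) (there x∈q) = x∈p─q⇒x∉q _ _ x∈ x∈q

∪-lub : ∀ {p q s : Subset n} → p ⊆ s → q ⊆ s → p ∪ q ⊆ s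
∪-lub p⊆s q⊆s = [ p⊆s , q⊆s ]′ ∘ x∈p∪q⁻ _ _

x∈p⇒⁅x⁆⊆p : ∀ {x} {p : Subset n} → x ∈ p → ⁅ x ⁆ ⊆ p
x∈p⇒⁅x⁆⊆p {p = p} x∈p y∈ = subst (_∈ p) (sym (x∈⁅y⁆⇒x≡y _ y∈)) x∈p

∣p∪⁅x⁆∣≡1+∣p∣ : ∀ {x} (p : Subset n) → x ∉ p → ∣ p ∪ ⁅ x ⁆ ∣ ≡ suc ∣ p ∣
∣p∪⁅x⁆∣≡1+∣p∣ {x = x} p x∉p = begin
  ∣ p ∪ ⁅ x ⁆ ∣          ≡⟨ ∣p∪q∣≡∣p∣+∣q─p∣ p ⁅ x ⁆ ⟩
  ∣ p ∣ + ∣ ⁅ x ⁆ ─ p ∣  ≡⟨ cong (λ q → ∣ p ∣ + ∣ q ∣) (⊆-antisym (p─q⊆p _ _) ⊆′) ⟩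
  ∣ p ∣ + ∣ ⁅ x ⁆ ∣      ≡⟨ cong (∣ p ∣ +_) (∣⁅x⁆∣≡1 x) ⟩
  ∣ p ∣ + 1              ≡⟨ ℕ.+-comm _ 1 ⟩
  suc ∣ p ∣              ∎
  where
  open ≡-Reasoning
  ⊆′ : ⁅ x ⁆ ⊆ ⁅ x ⁆ ─ p
  ⊆′ = x∈p⇒⁅x⁆⊆p (x∈p∧x∉q⇒x∈p─q (x∈⁅x⁆ x) x∉p)

∣p∣≤1+∣p-x∣ : ∀ (p : Subset n) x → ∣ p ∣ ≤ suc ∣ p - x ∣
∣p∣≤1+∣p-x∣ p x = begin
  ∣ p ∣                          ≡⟨ ∣p─q∣+∣p∩q∣≡∣p∣ p ⁅ x ⁆ ⟨
  ∣ p - x ∣ + ∣ p ∩ ⁅ x ⁆ ∣      ≤⟨ ℕ.+-monoʳ-≤ ∣ p - x ∣ (∣p∩q∣≤∣q∣ p ⁅ x ⁆) ⟩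
  ∣ p - x ∣ + ∣ ⁅ x ⁆ ∣          ≡⟨ cong (∣ p - x ∣ +_) (∣⁅x⁆∣≡1 x) ⟩
  ∣ p - x ∣ + 1                  ≡⟨ ℕ.+-comm _ 1 ⟩
  suc ∣ p - x ∣                  ∎
  where open ℕ.≤-Reasoning

⊈⇒∃ : ∀ (p q : Subset n) → p ⊈ q → ∃[ x ] x ∈ p × x ∉ q
⊈⇒∃ p q p⊈q with any? (λ x → (x ∈? p) ×-dec ¬? (x ∈? q))
... | yes h = h
... | no ¬h = contradiction
  (λ {x} x∈p → decidable-stable (x ∈? q) λ x∉q → ¬h (x , x∈p , x∉q)) p⊈q

∣p∣<∣q∣⇒∃ : ∀ (p q : Subset n) → ∣ p ∣ < ∣ q ∣ → ∃[ x ] x ∈ q × x ∉ p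
∣p∣<∣q∣⇒∃ p q p<q = ⊈⇒∃ q p λ q⊆p → ℕ.<⇒≱ p<q (p⊆q⇒∣p∣≤∣q∣ q⊆p)

module _ (M : Matroid n) where

  extendable? : ∀ B → Dec (∃[ I ] Indep M I × B ⊂ I)
  extendable? B = anySubset? λ I → indep? M I ×-dec (B ⊂? I)

  basis? : Decidable (Basis M)
  basis? B = indep? M B ×-dec
    map′ (λ ¬h {I} i b → ¬h (I , i , b)) (λ h (_ , i , b) → h i b)
      (¬? (extendable? B))

  indep≤basis : ∀ {I B} → Indep M I → Basis M B → ∣ I ∣ ≤ ∣ B ∣
  indep≤basis {I} {B} iI (iB , B-max) = ℕ.≮⇒≥ λ B<I →
    let e , _ , e∉B , iB∪e = indep-exchange M iB iI B<I
    in B-max iB∪e (p⊆p∪q _ , e , q⊆p∪q B ⁅ e ⁆ (x∈⁅x⁆ e) , e∉B)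

  basis-if-large : ∀ {I B} → Indep M I → Basis M B → ∣ B ∣ ≤ ∣ I ∣ → Basis M I
  basis-if-large iI bB B≤I = iI , λ iK I⊂K →
    ℕ.<⇒≱ (p⊂q⇒∣p∣<∣q∣ I⊂K) (ℕ.≤-trans (indep≤basis iK bB) B≤I)

  extend-within : ∀ {I B} → Indep M I → Basis M B →
                  ∃[ B′ ] Basis M B′ × I ⊆ B′ × B′ ⊆ I ∪ B
  extend-within {I} {B} iI bB = go ∣ B ∣ iI (ℕ.m≤n+m ∣ B ∣ ∣ I ∣) ⊆-refl (p⊆p∪q B)
    where
    go : ∀ d {K} → Indep M K → ∣ B ∣ ≤ ∣ K ∣ + d → I ⊆ K → K ⊆ I ∪ B →
         ∃[ B′ ] Basis M B′ × I ⊆ B′ × B′ ⊆ I ∪ B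
    go zero    {K} iK B≤ I⊆K K⊆ =
      K , basis-if-large iK bB (ℕ.≤-trans B≤ (ℕ.≤-reflexive (ℕ.+-identityʳ _))) , I⊆K , K⊆
    go (suc d) {K} iK B≤ I⊆K K⊆ with ∣ K ∣ ℕ.<? ∣ B ∣
    ... | no K≮B = K , basis-if-large iK bB (ℕ.≮⇒≥ K≮B) , I⊆K , K⊆
    ... | yes K<B =
      let e , e∈B , e∉K , iK∪e = indep-exchange M iK (proj₁ bB) K<B
      in go d iK∪e
           (subst (λ c → ∣ B ∣ ≤ c + d) (sym (∣p∪⁅x⁆∣≡1+∣p∣ K e∉K))
             (subst (∣ B ∣ ≤_) (ℕ.+-suc _ _) B≤))
           (p⊆p∪q _ ∘ I⊆K)
           (∪-lub K⊆ (x∈p⇒⁅x⁆⊆p (q⊆p∪q I B e∈B)))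

  basis-exists : ∃ (Basis M)
  basis-exists = go n (indep-⊥ M) (ℕ.m≤n+m n _)
    where
    go : ∀ d {K} → Indep M K → n ≤ ∣ K ∣ + d → ∃ (Basis M)
    go d {K} iK n≤ with extendable? K
    go d       {K} iK n≤ | no ¬h = K , iK , λ iI K⊂I → ¬h (_ , iI , K⊂I)
    go zero    {K} iK n≤ | yes (I , iI , K⊂I) = contradiction
      (ℕ.≤-trans (∣p∣≤n I) (ℕ.≤-trans n≤ (ℕ.≤-reflexive (ℕ.+-identityʳ _))))
      (ℕ.<⇒≱ (p⊂q⇒∣p∣<∣q∣ K⊂I))
    go (suc d) {K} iK n≤ | yes (I , iI , K⊂I) = go d iI
      (ℕ.≤-trans n≤ (ℕ.≤-trans (ℕ.≤-reflexive (ℕ.+-suc _ _))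
        (ℕ.+-monoˡ-≤ d (p⊂q⇒∣p∣<∣q∣ K⊂I))))

CoIndep : Matroid n → Pred (Subset n) 0ℓ
CoIndep M I = ∃[ B ] Basis M B × I ⊆ ground M ─ B

coindep-exchange : (M : Matroid n) → ∀ {I J} → CoIndep M I → CoIndep M J →
                   ∣ I ∣ < ∣ J ∣ → ∃[ e ] e ∈ J × e ∉ I × CoIndep M (I ∪ ⁅ e ⁆)
coindep-exchange M {I} {J} (B₁ , bB₁ , I⊆) (B₂ , bB₂ , J⊆) I<J
  with extend-within M (indep-⊆ M (p─q⊆p B₂ I) (proj₁ bB₂)) bB₁
... | B , bB , ⊆B , B⊆ with any? (λ e → (e ∈? J) ×-dec ¬? (e ∈? I) ×-dec ¬? (e ∈? B))
...   | yes (e , e∈J , e∉I , e∉B) = e , e∈J , e∉I , B , bB ,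
        ∪-lub (λ x∈I → x∈p∧x∉q⇒x∈p─q (p─q⊆p _ _ (I⊆ x∈I)) (I∩B x∈I))
              (x∈p⇒⁅x⁆⊆p (x∈p∧x∉q⇒x∈p─q (p─q⊆p _ _ (J⊆ e∈J)) e∉B))
  where
  I∩B : ∀ {x} → x ∈ I → x ∉ B
  I∩B x∈I x∈B with x∈p∪q⁻ _ _ (B⊆ x∈B)
  ... | inj₁ x∈B₂─I = x∈p─q⇒x∉q B₂ I x∈B₂─I x∈I
  ... | inj₂ x∈B₁   = x∈p─q⇒x∉q _ B₁ (I⊆ x∈I) x∈B₁
...   | no ¬h = contradiction (indep≤basis M (proj₁ bB) bB₂) (ℕ.<⇒≱ B₂<B)
  where
  open ℕ.≤-Reasoning

  J─I⊆B : J ─ I ⊆ B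
  J─I⊆B {x} x∈ = decidable-stable (x ∈? B) λ x∉B →
    ¬h (x , p─q⊆p J I x∈ , x∈p─q⇒x∉q J I x∈ , x∉B)

  I─J<J─I : ∣ I ─ J ∣ < ∣ J ─ I ∣
  I─J<J─I = ℕ.+-cancelʳ-< ∣ I ∩ J ∣ _ _ (begin-strict
    ∣ I ─ J ∣ + ∣ I ∩ J ∣  ≡⟨ ∣p─q∣+∣p∩q∣≡∣p∣ I J ⟩
    ∣ I ∣                  <⟨ I<J ⟩
    ∣ J ∣                  ≡⟨ ∣p─q∣+∣p∩q∣≡∣p∣ J I ⟨
    ∣ J ─ I ∣ + ∣ J ∩ I ∣  ≡⟨ cong (λ p → ∣ J ─ I ∣ + ∣ p ∣) (∩-comm J I) ⟩
    ∣ J ─ I ∣ + ∣ I ∩ J ∣  ∎)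

  B₂∩I⊆I─J : B₂ ∩ I ⊆ I ─ J
  B₂∩I⊆I─J x∈ with x∈p∩q⁻ B₂ I x∈
  ... | x∈B₂ , x∈I = x∈p∧x∉q⇒x∈p─q x∈I λ x∈J → x∈p─q⇒x∉q _ B₂ (J⊆ x∈J) x∈B₂

  J─I⊆′ : J ─ I ⊆ (J ─ I) ─ (B₂ ─ I)
  J─I⊆′ x∈ = x∈p∧x∉q⇒x∈p─q x∈ λ x∈B₂─I →
    x∈p─q⇒x∉q _ B₂ (J⊆ (p─q⊆p J I x∈)) (p─q⊆p B₂ I x∈B₂─I)

  B₂<B : ∣ B₂ ∣ < ∣ B ∣
  B₂<B = begin-strict
    ∣ B₂ ∣                                   ≡⟨ ∣p─q∣+∣p∩q∣≡∣p∣ B₂ I ⟨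
    ∣ B₂ ─ I ∣ + ∣ B₂ ∩ I ∣                  ≤⟨ ℕ.+-monoʳ-≤ ∣ B₂ ─ I ∣ (p⊆q⇒∣p∣≤∣q∣ B₂∩I⊆I─J) ⟩
    ∣ B₂ ─ I ∣ + ∣ I ─ J ∣                   <⟨ ℕ.+-monoʳ-< ∣ B₂ ─ I ∣ I─J<J─I ⟩
    ∣ B₂ ─ I ∣ + ∣ J ─ I ∣                   ≤⟨ ℕ.+-monoʳ-≤ ∣ B₂ ─ I ∣ (p⊆q⇒∣p∣≤∣q∣ J─I⊆′) ⟩
    ∣ B₂ ─ I ∣ + ∣ (J ─ I) ─ (B₂ ─ I) ∣      ≡⟨ ∣p∪q∣≡∣p∣+∣q─p∣ (B₂ ─ I) (J ─ I) ⟨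
    ∣ (B₂ ─ I) ∪ (J ─ I) ∣                   ≤⟨ p⊆q⇒∣p∣≤∣q∣ (∪-lub ⊆B J─I⊆B) ⟩
    ∣ B ∣                                    ∎

infix  10 _*
infixl 9 _∖_ _/_

_* : Matroid n → Matroid n
M * = record
  { ground         = ground M
  ; Indep          = CoIndep M
  ; indep?         = λ I → anySubset? λ B → basis? M B ×-dec (I ⊆? ground M ─ B)
  ; indep⊆ground   = λ (_ , _ , I⊆) → p─q⊆p _ _ ∘ I⊆
  ; indep-⊥        = proj₁ (basis-exists M) , proj₂ (basis-exists M) , ⊥⊆
  ; indep-⊆        = λ I⊆J (B , bB , J⊆) → B , bB , J⊆ ∘ I⊆J
  ; indep-exchange = coindep-exchange M
  }

_∖_ : Matroid n → Subset n → Matroid n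
M ∖ X = record
  { ground         = ground M ─ X
  ; Indep          = λ I → Indep M I × I ⊆ ground M ─ X
  ; indep?         = λ I → indep? M I ×-dec (I ⊆? ground M ─ X)
  ; indep⊆ground   = proj₂
  ; indep-⊥        = indep-⊥ M , ⊥⊆
  ; indep-⊆        = λ I⊆J (iJ , J⊆) → indep-⊆ M I⊆J iJ , J⊆ ∘ I⊆J
  ; indep-exchange = λ (iI , I⊆) (iJ , J⊆) I<J →
      let e , e∈J , e∉I , i = indep-exchange M iI iJ I<J
      in e , e∈J , e∉I , i , ∪-lub I⊆ (x∈p⇒⁅x⁆⊆p (J⊆ e∈J))
  }

_/_ : Matroid n → Subset n → Matroid n
M / X = (M * ∖ X) *

Cocircuit : Matroid n → Subset n → Set
Cocircuit M = Circuit (M *)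

data SeriesStep (M : Matroid n) : Matroid n → Set₁ where
  deletion          : ∀ {e} → e ∈ ground M → SeriesStep M (M ∖ ⁅ e ⁆)
  seriesContraction : ∀ {e f} → e ≢ f → Cocircuit M (⁅ e ⁆ ∪ ⁅ f ⁆) →
                      SeriesStep M (M / ⁅ e ⁆)

SeriesMinor : Matroid n → Matroid n → Set₁
SeriesMinor = Star SeriesStep

ProperSeriesMinor : Matroid n → Matroid n → Set₁
ProperSeriesMinor M N = SeriesMinor M N × ground N ≢ ground M

ExcludedSeriesMinor : (∀ {n} → Matroid n → Set) → Matroid n → Set₁
ExcludedSeriesMinor 𝒞 M = ¬ 𝒞 M × (∀ N → ProperSeriesMinor M N → 𝒞 N)

CircuitDifference : Matroid n → Set
CircuitDifference M = ∀ {C₁ C₂} → Circuit M C₁ → Circuit M C₂ →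
  C₁ ≢ C₂ → Nonempty (C₁ ∩ C₂) → Circuit M (C₁ △ C₂)

HyperplaneComplementary : Matroid n → Set
HyperplaneComplementary M = ∀ {H} → Hyperplane M H → Hyperplane M (ground M ─ H)

-- The field GF(2) is Bool, with addition _xor_ and multiplication _∧_.
Matrix : ℕ → ℕ → Set
Matrix k n = Fin k → Fin n → Bool

-- A subset of Fin n is also a vector of n coefficients from GF(2); Null A c
-- says that A c = 0.
Null : Matrix k n → Subset n → Set
Null A c = ∀ i → sum (λ j → A i j ∧ lookup c j) ≡ false

LinIndep : Matrix k n → Pred (Subset n) 0ℓ
LinIndep A I = ∀ {c} → c ⊆ I → Null A c → c ≡ ⊥

-- The columns of A at indices outside the ground set are irrelevant.
Binary : Matroid n → Set
Binary {n} M = ∃[ k ] Σ[ A ∈ Matrix k n ]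
  (∀ {I} → I ⊆ ground M → Indep M I ⇔ LinIndep A I)

x∈p△q⁻ : ∀ {x} (p q : Subset n) → x ∈ p △ q → (x ∈ p × x ∉ q) ⊎ (x ∉ p × x ∈ q)
x∈p△q⁻ {x = x} p q x∈ with x ∈? p | x ∈? q
... | yes x∈p | no x∉q  = inj₁ (x∈p , x∉q)
... | no x∉p  | yes x∈q = inj₂ (x∉p , x∈q)
... | yes x∈p | yes x∈q = contradiction
  (trans (sym ([]=⇒lookup x∈)) (trans (lookup-zipWith _xor_ x p q)
    (cong₂ _xor_ ([]=⇒lookup x∈p) ([]=⇒lookup x∈q)))) λ ()
... | no x∉p  | no x∉q  with lookup p x in p≡ | lookup q x in q≡
...   | true  | _     = contradiction (lookup⇒[]= x p p≡) x∉p
...   | false | true  = contradiction (lookup⇒[]= x q q≡) x∉q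
...   | false | false = contradiction
  (trans (sym ([]=⇒lookup x∈)) (trans (lookup-zipWith _xor_ x p q)
    (cong₂ _xor_ p≡ q≡))) λ ()

x∈p△q⁺ : ∀ {x} (p q : Subset n) → x ∉ p → x ∈ q → x ∈ p △ q
x∈p△q⁺ {x = x} p q x∉p x∈q with lookup p x in p≡
... | true  = contradiction (lookup⇒[]= x p p≡) x∉p
... | false = lookup⇒[]= x (p △ q)
  (trans (lookup-zipWith _xor_ x p q) (cong₂ _xor_ p≡ ([]=⇒lookup x∈q)))

module _ (A : Matrix k n) where

  null-⊥ : Null A ⊥
  null-⊥ i = trans
    (sum-cong-≗ λ j → trans (cong (A i j ∧_) (lookup-replicate j false)) (∧-zeroʳ _))
    (sum-replicate-zero n)

  null-△ : ∀ {c d} → Null A c → Null A d → Null A (c △ d)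
  null-△ {c} {d} c0 d0 i = begin
    sum (λ j → A i j ∧ lookup (c △ d) j)
      ≡⟨ sum-cong-≗ (λ j → trans (cong (A i j ∧_) (lookup-zipWith _xor_ j c d))
                                 (∧-distribˡ-xor (A i j) _ _)) ⟩
    sum (λ j → (A i j ∧ lookup c j) xor (A i j ∧ lookup d j))
      ≡⟨ ∑-distrib-+ (λ j → A i j ∧ lookup c j) (λ j → A i j ∧ lookup d j) ⟩
    sum (λ j → A i j ∧ lookup c j) xor sum (λ j → A i j ∧ lookup d j)
      ≡⟨ cong₂ _xor_ (c0 i) (d0 i) ⟩
    false ∎
    where open ≡-Reasoning

  dependency? : ∀ I → Dec (∃[ c ] c ⊆ I × Null A c × c ≢ ⊥)
  dependency? I = anySubset? λ c →
    (c ⊆? I) ×-dec all? (λ i → _ ≟ᵇ false) ×-dec ¬? (≡-dec _≟ᵇ_ c ⊥)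

  no-dependency⇒linIndep : ∀ {I} → ¬ (∃[ c ] c ⊆ I × Null A c × c ≢ ⊥) → LinIndep A I
  no-dependency⇒linIndep ¬h {c} c⊆I c0 =
    decidable-stable (≡-dec _≟ᵇ_ c ⊥) λ c≢⊥ → ¬h (c , c⊆I , c0 , c≢⊥)

  linIndep? : Decidable (LinIndep A)
  linIndep? I = map′ no-dependency⇒linIndep
    (λ li (_ , c⊆I , c0 , c≢⊥) → c≢⊥ (li c⊆I c0)) (¬? (dependency? I))

  linIndep-⊆ : ∀ {I J} → I ⊆ J → LinIndep A J → LinIndep A I
  linIndep-⊆ I⊆J li c⊆I = li (I⊆J ∘ c⊆I)

  swap-linIndep : ∀ {J c x y} → LinIndep A J → c ⊆ J ∪ ⁅ x ⁆ → Null A c →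
                  x ∈ c → y ∈ c → y ≢ x → LinIndep A ((J ∪ ⁅ x ⁆) - y)
  swap-linIndep {J} {c} {x} {y} liJ c⊆ c0 x∈c y∈c y≢x {d} d⊆ d0 with x ∈? d
  ... | no x∉d = liJ d⊆J d0
    where
    d⊆J : d ⊆ J
    d⊆J z∈d with x∈p∪q⁻ J ⁅ x ⁆ (p─q⊆p _ _ (d⊆ z∈d))
    ... | inj₁ z∈J = z∈J
    ... | inj₂ z∈x = contradiction (subst (_∈ d) (x∈⁅y⁆⇒x≡y x z∈x) z∈d) x∉d
  ... | yes x∈d = contradiction (subst (y ∈_) (liJ d△c⊆J (null-△ {d} {c} d0 c0)) y∈) ∉⊥
    where
    y∉d : y ∉ d
    y∉d y∈d = x∈p─q⇒x∉q (J ∪ ⁅ x ⁆) ⁅ y ⁆ (d⊆ y∈d) (x∈⁅x⁆ y)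

    y∈ : y ∈ d △ c
    y∈ = x∈p△q⁺ d c y∉d y∈c

    drop-x : ∀ {z} → z ∈ J ∪ ⁅ x ⁆ → z ≢ x → z ∈ J
    drop-x z∈ z≢x with x∈p∪q⁻ J ⁅ x ⁆ z∈
    ... | inj₁ z∈J = z∈J
    ... | inj₂ z∈x = contradiction (x∈⁅y⁆⇒x≡y x z∈x) z≢x

    d△c⊆J : d △ c ⊆ J
    d△c⊆J z∈ with x∈p△q⁻ d c z∈
    ... | inj₁ (z∈d , z∉c) = drop-x (p─q⊆p _ _ (d⊆ z∈d)) λ { refl → z∉c x∈c }
    ... | inj₂ (z∉d , z∈c) = drop-x (c⊆ z∈c) λ { refl → z∉d x∈d }

  linIndep-exchange : ∀ {I J} → LinIndep A I → LinIndep A J → ∣ I ∣ < ∣ J ∣ →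
                      ∃[ e ] e ∈ J × e ∉ I × LinIndep A (I ∪ ⁅ e ⁆)
  linIndep-exchange {I} liI = λ liJ → go ∣ I ∣ liJ (∣p─q∣≤∣p∣ I _)
    where
    go : ∀ d {J} → LinIndep A J → ∣ I ─ J ∣ ≤ d → ∣ I ∣ < ∣ J ∣ →
         ∃[ e ] e ∈ J × e ∉ I × LinIndep A (I ∪ ⁅ e ⁆)

    step : ∀ d {J J′ x} → LinIndep A J′ → ∣ I ─ J ∣ ≤ d → ∣ I ∣ < ∣ J′ ∣ →
           x ∈ I → x ∉ J → x ∈ J′ → J′ ⊆ J ∪ ⁅ x ⁆ → (∀ {z} → z ∈ I → z ∈ J → z ∈ J′) →
           ∃[ e ] e ∈ J × e ∉ I × LinIndep A (I ∪ ⁅ e ⁆)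

    go d {J} liJ ≤d I<J with I ⊆? J
    ... | yes I⊆J =
      let e , e∈J , e∉I = ∣p∣<∣q∣⇒∃ I J I<J
      in e , e∈J , e∉I , linIndep-⊆ (∪-lub I⊆J (x∈p⇒⁅x⁆⊆p e∈J)) liJ
    ... | no I⊈J with ⊈⇒∃ I J I⊈J
    ...   | x , x∈I , x∉J with dependency? (J ∪ ⁅ x ⁆)
    ...     | no ¬h = step d (no-dependency⇒linIndep ¬h) ≤d
                (ℕ.<-trans I<J (ℕ.≤-reflexive (sym (∣p∪⁅x⁆∣≡1+∣p∣ J x∉J))))
                x∈I x∉J (q⊆p∪q J _ (x∈⁅x⁆ x)) ⊆-refl (λ _ → p⊆p∪q _)
    ...     | yes (c , c⊆ , c0 , c≢⊥) with ⊈⇒∃ c I (λ c⊆I → c≢⊥ (liI c⊆I c0))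
    ...       | y , y∈c , y∉I = step d
                (swap-linIndep liJ c⊆ c0 x∈c y∈c y≢x) ≤d
                (ℕ.≤-trans I<J (s≤s⁻¹ (ℕ.≤-trans
                  (ℕ.≤-reflexive (sym (∣p∪⁅x⁆∣≡1+∣p∣ J x∉J)))
                  (∣p∣≤1+∣p-x∣ (J ∪ ⁅ x ⁆) y))))
                x∈I x∉J (x∈p∧x≢y⇒x∈p-y (q⊆p∪q J _ (x∈⁅x⁆ x)) (y≢x ∘ sym)) (p─q⊆p _ _)
                (λ z∈I z∈J → x∈p∧x≢y⇒x∈p-y (p⊆p∪q _ z∈J) λ { refl → y∉I z∈I })
      where
      y≢x : y ≢ x
      y≢x refl = y∉I x∈I

      x∈c : x ∈ c
      x∈c = decidable-stable (x ∈? c) λ x∉c → c≢⊥ (liJ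
        (λ z∈c → [ (λ z∈J → z∈J)
                 , (λ z∈x → contradiction (subst (_∈ c) (x∈⁅y⁆⇒x≡y x z∈x) z∈c) x∉c)
                 ]′ (x∈p∪q⁻ J ⁅ x ⁆ (c⊆ z∈c))) c0)

    step d {J} {J′} {x} liJ′ ≤d I<J′ x∈I x∉J x∈J′ J′⊆ keep = helper d ≤d
      where
      shrink : ∣ I ─ J′ ∣ < ∣ I ─ J ∣
      shrink = p⊂q⇒∣p∣<∣q∣
        ( (λ z∈ → x∈p∧x∉q⇒x∈p─q (p─q⊆p I J′ z∈)
                    λ z∈J → x∈p─q⇒x∉q I J′ z∈ (keep (p─q⊆p I J′ z∈) z∈J))
        , x , x∈p∧x∉q⇒x∈p─q x∈I x∉J , λ x∈ → x∈p─q⇒x∉q I J′ x∈ x∈J′ )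

      helper : ∀ d → ∣ I ─ J ∣ ≤ d → ∃[ e ] e ∈ J × e ∉ I × LinIndep A (I ∪ ⁅ e ⁆)
      helper zero    ≤0 = contradiction (ℕ.<-≤-trans shrink ≤0) λ ()
      helper (suc d) ≤d with go d liJ′ (s≤s⁻¹ (ℕ.≤-trans shrink ≤d)) I<J′
      ... | e , e∈J′ , e∉I , li with x∈p∪q⁻ J ⁅ x ⁆ (J′⊆ e∈J′)
      ...   | inj₁ e∈J = e , e∈J , e∉I , li
      ...   | inj₂ e∈x = contradiction (subst (_∈ I) (sym (x∈⁅y⁆⇒x≡y x e∈x)) x∈I) e∉I

  M[_] : Matroid n
  M[_] = record
    { ground         = ⊤
    ; Indep          = LinIndep A
    ; indep?         = linIndep?
    ; indep⊆ground   = λ _ → ⊆⊤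
    ; indep-⊥        = λ c⊆⊥ _ → ⊆-antisym c⊆⊥ ⊥⊆
    ; indep-⊆        = linIndep-⊆
    ; indep-exchange = linIndep-exchange
    }

-- Binary projective and affine geometries, indexed by rank: PG r, AG r H and
-- AG+ r H e are PG(r-1,2), AG(r-1,2) and AG(r-1,2)+e. The hyperplane H of PG r
-- that is removed, and the element e of H that is put back, are arguments.

-- The columns of this matrix are all the vectors of GF(2)^r, each occurring once.
allVectors : ∀ r → Matrix r (2 ^ r)
allVectors r i j = Inverse.to 2↔Bool (finToFun j i)

zeroVector : ∀ r → Fin (2 ^ r)
zeroVector r = funToFin {r} (λ _ → zero)

PG : ∀ r → Matroid (2 ^ r)
PG r = M[ allVectors r ] ∖ ⁅ zeroVector r ⁆

AG : ∀ r → Subset (2 ^ r) → Matroid (2 ^ r)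
AG r H = PG r ∖ H

AG+ : ∀ r → Subset (2 ^ r) → Fin (2 ^ r) → Matroid (2 ^ r)
AG+ r H e = PG r ∖ (H - e)

𝕄 : Matroid n → Set
𝕄 N = ∃[ r ] ∃[ H ] ∃[ e ] ∃[ X ]
  Hyperplane (PG r) H × e ∈ H × X ⊆ ground (AG r H) ×
  HyperplaneComplementary (AG r H ∖ X) × rk (AG r H ∖ X) ≡ r ×
  3 ≤ rk (AG+ r H e ∖ X) × N ≅ (AG+ r H e ∖ X)

-- Let Z be the cycle space of M, which is the row space of the dual of M, and
-- whose minimal nonempty members are the circuits. Series contractions do not
-- change Z up to isomorphism and deletions restrict it, so M is an excluded
-- series minor when its elements are distinct nonzero functionals on Z, some
-- circuits C₁ and C₂ that meet have a difference P that is not a circuit, and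
-- this happens only if C₁ and C₂ cover the ground set E. It follows that a
-- circuit D ⊆ P gives circuits C₁ △ D, C₂ △ D and P △ D, then that C₁ ∩ C₂ is a
-- single element e, that circuits through e meet circuits avoiding e, and
-- finally that the members of Z other than ∅ and P = E - e form an antichain
-- even after the removal of e. Conversely, such an antichain makes every member
-- of Z other than ∅ and P a circuit. As a functional, P puts E - e into an affine
-- geometry, whose hyperplanes are the complements of the minimal rows, so that
-- the antichain condition is hyperplane-complementarity.

module Submission where

open import Defs
open import Data.Bool.Base using (Bool; true; false; _∧_; _xor_)
open import Algebra.Bundles using (CommutativeRing)
open import Data.Bool.Properties
  using (xor-comm; xor-assoc; xor-same; xor-identityˡ; xor-∧-commutativeRing; ∧-zeroʳ; ∧-identityʳ;
         ∧-comm; ∧-assoc; ∧-distribˡ-xor; ∧-distribʳ-xor; ¬-not; not-¬; ⇔→≡)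
  renaming (_≟_ to _≟ᵇ_)
open import Data.Empty using (⊥-elim)
open import Data.Fin.Base using (Fin; zero; suc; combine; finToFun; funToFin)
open import Data.Fin.Properties using (any?; all?; 2↔Bool; suc-injective; finToFun-funToFin; funToFin-finToFin) renaming (_≟_ to _≟ᶠ_)
open import Data.Fin.Subset
open import Data.Fin.Subset.Properties
open import Data.List.Extrema.Nat using (max≤v⁺; v≤max⁺)
open import Data.List.Membership.Propositional using () renaming (_∈_ to _∈ˡ_; lose to loseˡ)
open import Data.List.Membership.Propositional.Properties
  using (∈-map⁺; ∈-++⁺ˡ; ∈-++⁺ʳ; ∈-filter⁺; ∈-filter⁻; ∈-map⁻)
open import Data.List.Relation.Unary.All using () renaming (tabulate to All-tabulate)
open import Data.List.Relation.Unary.Any using () renaming (here to hereˡ)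
open import Data.Nat.Base using (ℕ; zero; suc; _≤_; _<_; z≤n; s≤s; s≤s⁻¹; _^_)
import Data.Nat.Properties as ℕ
open import Data.Product.Base using (Σ-syntax; ∃; ∃-syntax; _×_; _,_; proj₁; proj₂)
open import Data.Sum.Base using (_⊎_; inj₁; inj₂; [_,_]′)
open import Data.Vec.Base using ([]; _∷_; lookup; tabulate; here; there)
open import Data.Vec.Properties
  using ([]=⇒lookup; lookup⇒[]=; lookup∘tabulate; lookup-replicate; lookup-zipWith; ≡-dec; zipWith-comm; zipWith-assoc; zipWith-identityˡ)
open import Data.Vec.Properties.WithK using ([]=-irrelevant)
open import Function.Base using (_∘_; id)
open import Function.Bundles using (_⇔_; mk⇔; Equivalence; mk↔ₛ′; Inverse)
open import Level using (0ℓ)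
open import Relation.Binary.Construct.Closure.ReflexiveTransitive using (ε; _◅_)
open import Relation.Binary.PropositionalEquality
open import Relation.Nullary.Decidable
  using (Dec; yes; no; ¬?; _×-dec_; _⊎-dec_; decidable-stable; does; dec-true; dec-false)
open import Relation.Nullary.Negation using (¬_; contradiction)
open import Relation.Unary using (Pred; Decidable)

open import Algebra.Properties.CommutativeMonoid.Sum
  (CommutativeRing.+-commutativeMonoid xor-∧-commutativeRing)
  using (sum; ∑-distrib-+; sum-cong-≗; sum-replicate-zero; ∑-comm)

private
  variable
    n k : ℕ

-- In an excluded series minor the one available rule is that two distinct circuits that meet and
-- miss a common element of E have a circuit as their difference. Each use of it therefore asks for
-- a point of meeting and a point missed by both, and most of the combinatorial work lies in
-- producing such points. Circuits inside P are the source: they meet both `C₁ ─ C₂` and `C₂ ─ C₁`.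
-- The two rank conditions in `𝕄` have different origins. Rank at least three means that Z has a
-- member avoiding e other than ∅ and P; since P is not a circuit, any circuit inside P is such a
-- member. That the affine part alone has rank r means that e is not a loop of M, and this follows
-- from the antichain condition.

_≟ˢ_ : (p q : Subset n) → Dec (p ≡ q)
_≟ˢ_ = ≡-dec _≟ᵇ_

≢⊥⇒Nonempty : {p : Subset n} → p ≢ ⊥ → Nonempty p
≢⊥⇒Nonempty {p = p} p≢⊥ = decidable-stable (nonempty? p) (p≢⊥ ∘ Empty-unique)

Nonempty⇒≢⊥ : {p : Subset n} → Nonempty p → p ≢ ⊥
Nonempty⇒≢⊥ (_ , x∈p) refl = ∉⊥ x∈p

-- Symmetric differences and one-element extensions of subsets

△-comm : (p q : Subset n) → p △ q ≡ q △ p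
△-comm = zipWith-comm xor-comm

△-assoc : (p q r : Subset n) → (p △ q) △ r ≡ p △ (q △ r)
△-assoc = zipWith-assoc xor-assoc

△-identityˡ : (p : Subset n) → ⊥ △ p ≡ p
△-identityˡ = zipWith-identityˡ xor-identityˡ

△-same : (p : Subset n) → p △ p ≡ ⊥
△-same []      = refl
△-same (x ∷ p) = cong₂ _∷_ (xor-same x) (△-same p)

△-cancelˡ : (p q : Subset n) → p △ (p △ q) ≡ q
△-cancelˡ p q = trans (sym (△-assoc p p q)) (trans (cong (_△ q) (△-same p)) (△-identityˡ q))

△-cancelʳ : (p q : Subset n) → (p △ q) △ q ≡ p
△-cancelʳ p q = trans (△-comm (p △ q) q) (trans (cong (q △_) (△-comm p q)) (△-cancelˡ q p))

△-swapʳ : (p q r : Subset n) → (p △ q) △ r ≡ (p △ r) △ q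
△-swapʳ p q r = trans (△-assoc p q r) (trans (cong (p △_) (△-comm q r)) (sym (△-assoc p r q)))

△≡⊥⇒≡ : {p q : Subset n} → p △ q ≡ ⊥ → p ≡ q
△≡⊥⇒≡ {p = p} {q} eq = trans (sym (△-cancelʳ p q)) (trans (cong (_△ q) eq) (△-identityˡ q))

module _ {p q : Subset n} {x : Fin n} where

  ∈△ʳ : x ∉ p → x ∈ q → x ∈ p △ q
  ∈△ʳ = x∈p△q⁺ p q

  ∈△ˡ : x ∈ p → x ∉ q → x ∈ p △ q
  ∈△ˡ x∈p x∉q = subst (x ∈_) (△-comm q p) (x∈p△q⁺ q p x∉q x∈p)

  ∉△-both : x ∈ p → x ∈ q → x ∉ p △ q
  ∉△-both x∈p x∈q x∈ with x∈p△q⁻ p q x∈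
  ... | inj₁ (_ , x∉q) = x∉q x∈q
  ... | inj₂ (x∉p , _) = x∉p x∈p

  ∉△-neither : x ∉ p → x ∉ q → x ∉ p △ q
  ∉△-neither x∉p x∉q x∈ with x∈p△q⁻ p q x∈
  ... | inj₁ (x∈p , _) = x∉p x∈p
  ... | inj₂ (_ , x∈q) = x∉q x∈q

  ∈△∧∈ˡ⇒∉ʳ : x ∈ p △ q → x ∈ p → x ∉ q
  ∈△∧∈ˡ⇒∉ʳ x∈ x∈p x∈q = ∉△-both x∈p x∈q x∈

  ∈△∧∉ˡ⇒∈ʳ : x ∈ p △ q → x ∉ p → x ∈ q
  ∈△∧∉ˡ⇒∈ʳ x∈ x∉p with x∈p△q⁻ p q x∈
  ... | inj₁ (x∈p , _) = contradiction x∈p x∉p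
  ... | inj₂ (_ , x∈q) = x∈q

  ∈△∧∉ʳ⇒∈ˡ : x ∈ p △ q → x ∉ q → x ∈ p
  ∈△∧∉ʳ⇒∈ˡ x∈ x∉q with x∈p△q⁻ p q x∈
  ... | inj₁ (x∈p , _) = x∈p
  ... | inj₂ (_ , x∈q) = contradiction x∈q x∉q

  ∉△∧∈ˡ⇒∈ʳ : x ∉ p △ q → x ∈ p → x ∈ q
  ∉△∧∈ˡ⇒∈ʳ x∉ x∈p = decidable-stable (x ∈? q) (x∉ ∘ ∈△ˡ x∈p)

⊆⇒△≡─ : {p q : Subset n} → q ⊆ p → p △ q ≡ p ─ q
⊆⇒△≡─ {p = p} {q} q⊆p = ⊆-antisym
  (λ x∈ → [ (λ (x∈p , x∉q) → x∈p∧x∉q⇒x∈p─q x∈p x∉q)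
          , (λ (x∉p , x∈q) → contradiction (q⊆p x∈q) x∉p) ]′ (x∈p△q⁻ p q x∈))
  (λ x∈ → ∈△ˡ (p─q⊆p p q x∈) (x∈p─q⇒x∉q p q x∈))

△-⊆ : {p q r : Subset n} → p ⊆ r → q ⊆ r → p △ q ⊆ r
△-⊆ {p = p} {q} p⊆r q⊆r x∈ = [ p⊆r ∘ proj₁ , q⊆r ∘ proj₂ ]′ (x∈p△q⁻ p q x∈)

∈∪⁅⁆⁻ : {p : Subset n} {x y : Fin n} → y ∈ p ∪ ⁅ x ⁆ → y ∈ p ⊎ y ≡ x
∈∪⁅⁆⁻ {p = p} {x} y∈ = [ inj₁ , inj₂ ∘ x∈⁅y⁆⇒x≡y x ]′ (x∈p∪q⁻ p ⁅ x ⁆ y∈)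

x∈p∪⁅x⁆ : (p : Subset n) {x : Fin n} → x ∈ p ∪ ⁅ x ⁆
x∈p∪⁅x⁆ p {x} = q⊆p∪q p ⁅ x ⁆ (x∈⁅x⁆ x)

p⊂p∪⁅x⁆ : {p : Subset n} {x : Fin n} → x ∉ p → p ⊂ p ∪ ⁅ x ⁆
p⊂p∪⁅x⁆ {p = p} {x} x∉p = p⊆p∪q ⁅ x ⁆ , x , x∈p∪⁅x⁆ p , x∉p

-- Binary spaces of subsets

record Space (n : ℕ) : Set₁ where
  field
    Member   : Pred (Subset n) 0ℓ
    member?  : Decidable Member
    ⊥-member : Member ⊥
    △-member : ∀ {p q} → Member p → Member q → Member (p △ q)

open Space public

Min : Space n → Subset n → Set
Min Z C = Member Z C × Nonempty C × (∀ {D} → Member Z D → Nonempty D → D ⊆ C → C ⊆ D)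

module _ (Z : Space n) where

  smaller? : ∀ z → Dec (∃[ D ] Member Z D × Nonempty D × D ⊂ z)
  smaller? z = anySubset? λ D → member? Z D ×-dec nonempty? D ×-dec (D ⊂? z)

  no-smaller⇒min : ∀ {z} → Member Z z → Nonempty z →
                   ¬ (∃[ D ] Member Z D × Nonempty D × D ⊂ z) → Min Z z
  no-smaller⇒min {z} mz ne ¬h = mz , ne , λ {D} mD neD D⊆z {x} x∈z →
    decidable-stable (x ∈? D) λ x∉D → ¬h (D , mD , neD , D⊆z , x , x∈z , x∉D)

  min? : Decidable (Min Z)
  min? z with member? Z z | nonempty? z | smaller? z
  ... | no ¬m | _     | _    = no (¬m ∘ proj₁)
  ... | yes _ | no ¬e | _    = no (¬e ∘ proj₁ ∘ proj₂)
  ... | yes _ | yes _ | yes (D , mD , neD , D⊆z , x , x∈z , x∉D) =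
    no λ (_ , _ , f) → x∉D (f mD neD D⊆z x∈z)
  ... | yes m | yes e | no ¬h = yes (no-smaller⇒min m e ¬h)

  -- A smaller member `D` splits `z` into `D` and `z △ D`; the descent enters whichever of the two
  -- contains `x`.
  min-through : ∀ {z x} → Member Z z → x ∈ z → ∃[ C ] Min Z C × C ⊆ z × x ∈ C
  min-through {z} {x} mz x∈z = go ∣ z ∣ mz x∈z ℕ.≤-refl
    where
    go : ∀ d {z} → Member Z z → x ∈ z → ∣ z ∣ ≤ d → ∃[ C ] Min Z C × C ⊆ z × x ∈ C
    go d {z} mz x∈z ≤d with smaller? z
    ... | no ¬h = z , no-smaller⇒min mz (x , x∈z) ¬h , ⊆-refl , x∈z
    go zero    {z} mz x∈z ≤d | yes (D , mD , neD , D⊂z) =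
      contradiction (ℕ.<-≤-trans (p⊂q⇒∣p∣<∣q∣ D⊂z) ≤d) λ ()
    go (suc d) {z} mz x∈z ≤d | yes (D , mD , (y , y∈D) , D⊂z@(D⊆z , _)) with x ∈? D
    ... | yes x∈D =
      let C , mC , C⊆D , x∈C = go d mD x∈D (s≤s⁻¹ (ℕ.≤-trans (p⊂q⇒∣p∣<∣q∣ D⊂z) ≤d))
      in C , mC , D⊆z ∘ C⊆D , x∈C
    ... | no x∉D =
      let C , mC , C⊆ , x∈C = go d (△-member Z mz mD) (∈△ˡ x∈z x∉D)
                                (s≤s⁻¹ (ℕ.≤-trans (p⊂q⇒∣p∣<∣q∣ z△D⊂z) ≤d))
      in C , mC , △-⊆ ⊆-refl D⊆z ∘ C⊆ , x∈C
      where
      z△D⊂z : z △ D ⊂ z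
      z△D⊂z = △-⊆ ⊆-refl D⊆z , y , D⊆z y∈D , ∉△-both (D⊆z y∈D) y∈D

min-⊆⇒≡ : {Z : Space n} {C D : Subset n} → Min Z C → Member Z D → Nonempty D → D ⊆ C → D ≡ C
min-⊆⇒≡ (_ , _ , f) mD neD D⊆C = ⊆-antisym D⊆C (f mD neD D⊆C)

-- If Z is the row space of a matrix, this says that the columns in I are
-- linearly independent, a dual basis being given by members of Z.
Free : Space n → Subset n → Set
Free Z I = ∀ {i} → i ∈ I → ∃[ z ] Member Z z × i ∈ z × (∀ {j} → j ∈ I → j ∈ z → j ≡ i)

-- Triangular elimination: `w` is zero on `B`, so adding it to a witness clears `x` and changes
-- nothing on `B`.
free-extend : (Z : Space n) {B w : Subset n} {x : Fin n} → Free Z B → Member Z w → x ∈ w →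
              (∀ {j} → j ∈ B → j ∉ w) → Free Z (B ∪ ⁅ x ⁆)
free-extend Z {B} {w} {x} free mw x∈w B∩w {i} i∈ with ∈∪⁅⁆⁻ i∈
... | inj₂ refl = w , mw , x∈w , λ j∈ j∈w →
  [ (λ j∈B → contradiction j∈w (B∩w j∈B)) , id ]′ (∈∪⁅⁆⁻ j∈)
... | inj₁ i∈B with free i∈B
...   | z , mz , i∈z , z∩B with x ∈? z
...     | no x∉z = z , mz , i∈z , λ j∈ j∈z →
  [ (λ j∈B → z∩B j∈B j∈z) , (λ { refl → contradiction j∈z x∉z }) ]′ (∈∪⁅⁆⁻ j∈)
...     | yes x∈z = z △ w , △-member Z mz mw , ∈△ˡ i∈z (B∩w i∈B) , λ j∈ j∈z△w →
  [ (λ j∈B → z∩B j∈B (∈△∧∉ʳ⇒∈ˡ j∈z△w (B∩w j∈B)))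
  , (λ { refl → contradiction j∈z△w (∉△-both x∈z x∈w) }) ]′ (∈∪⁅⁆⁻ j∈)

-- This record and `CycleSpace` tie a matroid to a space instead of a matrix, so that minors can be
-- followed on the space alone. Duality exchanges the two.
record RowSpace (M : Matroid n) (W : Space n) : Set where
  field
    ⊆ground : ∀ {w} → Member W w → w ⊆ ground M
    indep⇒  : ∀ {I} → Indep M I → Free W I
    free⇒   : ∀ {I} → I ⊆ ground M → Free W I → Indep M I

record CycleSpace (M : Matroid n) (Z : Space n) : Set where
  field
    ⊆ground : ∀ {z} → Member Z z → z ⊆ ground M
    indep⇒  : ∀ {I} → Indep M I → ∀ {z} → Member Z z → z ⊆ I → z ≡ ⊥
    ⇒indep  : ∀ {I} → I ⊆ ground M → (∀ {z} → Member Z z → z ⊆ I → z ≡ ⊥) → Indep M I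

-- Maximal independent subsets and rank

record MaxIn (M : Matroid n) (X B : Subset n) : Set where
  field
    indep : Indep M B
    ⊆X    : B ⊆ X
    maximal : ∀ {x} → x ∈ X → Indep M (B ∪ ⁅ x ⁆) → x ∈ B

module _ (M : Matroid n) where

  maxIn-exists : ∀ {X} → X ⊆ ground M → ∃ (MaxIn M X)
  -- Deleting the complement of `X` is restriction to `X`.
  maxIn-exists {X} X⊆ with basis-exists (M ∖ ∁ X)
  ... | B , (iB , B⊆) , B-max = B , record
    { indep = iB
    ; ⊆X    = B⊆X
    ; maximal = λ {x} x∈X iB∪x → decidable-stable (x ∈? B) λ x∉B → B-max
        (iB∪x , ∪-lub B⊆ (x∈p⇒⁅x⁆⊆p (x∈p∧x∉q⇒x∈p─q (X⊆ x∈X) (x∈p⇒x∉∁p x∈X))))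
        (p⊂p∪⁅x⁆ x∉B)
    }
    where
    B⊆X : B ⊆ X
    B⊆X x∈B = x∉∁p⇒x∈p (x∈p─q⇒x∉q (ground M) (∁ X) (B⊆ x∈B))

  maxIn⇒basis : ∀ {B} → MaxIn M (ground M) B → Basis M B
  maxIn⇒basis mB = indep , λ iI (B⊆I , x , x∈I , x∉B) →
    x∉B (maximal (indep⊆ground M iI x∈I) (indep-⊆ M (∪-lub B⊆I (x∈p⇒⁅x⁆⊆p x∈I)) iI))
    where open MaxIn mB

  basis⇒maxIn : ∀ {B} → Basis M B → MaxIn M (ground M) B
  basis⇒maxIn {B} (iB , B-max) = record
    { indep = iB
    ; ⊆X    = indep⊆ground M iB
    ; maximal = λ {x} _ iB∪x → decidable-stable (x ∈? B) λ x∉B → B-max iB∪x (p⊂p∪⁅x⁆ x∉B)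
    }

  indep≤maxIn : ∀ {X B I} → MaxIn M X B → Indep M I → I ⊆ X → ∣ I ∣ ≤ ∣ B ∣
  indep≤maxIn mB iI I⊆X = ℕ.≮⇒≥ λ B<I →
    let e , e∈I , e∉B , iB∪e = indep-exchange M (MaxIn.indep mB) iI B<I
    in e∉B (MaxIn.maximal mB (I⊆X e∈I) iB∪e)

  ∈-subsets : ∀ {n} (p : Subset n) → p ∈ˡ subsets n
  ∈-subsets []            = hereˡ refl
  ∈-subsets (outside ∷ p) = ∈-++⁺ˡ (∈-map⁺ _ (∈-subsets p))
  ∈-subsets (inside ∷ p)  = ∈-++⁺ʳ _ (∈-map⁺ _ (∈-subsets p))

  indep≤rank : ∀ {X I} → Indep M I → I ⊆ X → ∣ I ∣ ≤ rank M X
  indep≤rank {X} {I} iI I⊆X = v≤max⁺ 0 _ (inj₂ (loseˡ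
    (∈-map⁺ ∣_∣ (∈-filter⁺ (λ I → indep? M I ×-dec (I ⊆? X)) (∈-subsets I) (iI , I⊆X)))
    ℕ.≤-refl))

  rank≤ : ∀ {X d} → (∀ {I} → Indep M I → I ⊆ X → ∣ I ∣ ≤ d) → rank M X ≤ d
  rank≤ {X} {d} h = max≤v⁺ z≤n (All-tabulate λ m∈ →
    let I , I∈ , m≡ = ∈-map⁻ ∣_∣ m∈
        _ , iI , I⊆X = ∈-filter⁻ (λ I → indep? M I ×-dec (I ⊆? X)) {xs = subsets _} I∈
    in subst (_≤ d) (sym m≡) (h iI I⊆X))

  rank≡∣maxIn∣ : ∀ {X B} → MaxIn M X B → rank M X ≡ ∣ B ∣
  rank≡∣maxIn∣ mB = ℕ.≤-antisym (rank≤ (indep≤maxIn mB)) (indep≤rank indep ⊆X)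
    where open MaxIn mB

  extend-below-rank : ∀ {I} → Indep M I → ∣ I ∣ < rk M →
                      ∃[ x ] x ∈ ground M × x ∉ I × Indep M (I ∪ ⁅ x ⁆)
  extend-below-rank {I} iI I<rk =
    let B , mB = maxIn-exists ⊆-refl
        x , x∈B , x∉I , iI∪x = indep-exchange M iI (MaxIn.indep mB) (subst (∣ I ∣ <_) (rank≡∣maxIn∣ mB) I<rk)
    in x , MaxIn.⊆X mB x∈B , x∉I , iI∪x

-- Duality

─-involutive : {E p : Subset n} → p ⊆ E → E ─ (E ─ p) ≡ p
─-involutive {E = E} {p} p⊆E = ⊆-antisym
  (λ {x} x∈ → decidable-stable (x ∈? p) λ x∉p →
    x∈p─q⇒x∉q E (E ─ p) x∈ (x∈p∧x∉q⇒x∈p─q (p─q⊆p E (E ─ p) x∈) x∉p))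
  (λ x∈p → x∈p∧x∉q⇒x∈p─q (p⊆E x∈p) λ x∈ → x∈p─q⇒x∉q E p x∈ x∈p)

module _ (M : Matroid n) where

  dual-basis : ∀ {B} → Basis M B → Basis (M *) (ground M ─ B)
  dual-basis {B} bB@(iB , _) = (B , bB , ⊆-refl) , λ {J} (B′ , bB′ , J⊆) (E─B⊆J , x , x∈J , x∉E─B) →
    let x∈E : x ∈ ground M
        x∈E = p─q⊆p (ground M) B′ (J⊆ x∈J)
        x∈B : x ∈ B
        x∈B = decidable-stable (x ∈? B) (x∉E─B ∘ x∈p∧x∉q⇒x∈p─q x∈E)
        B′⊆B : B′ ⊆ B
        B′⊆B {y} y∈B′ = decidable-stable (y ∈? B) λ y∉B →
          x∈p─q⇒x∉q (ground M) B′ (J⊆ (E─B⊆J (x∈p∧x∉q⇒x∈p─q (indep⊆ground M (proj₁ bB′) y∈B′) y∉B))) y∈B′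
    in proj₂ bB′ iB (B′⊆B , x , x∈B , x∈p─q⇒x∉q (ground M) B′ (J⊆ x∈J))

  indep⇒dual-dual : ∀ {I} → Indep M I → Indep (M * *) I
  indep⇒dual-dual {I} iI =
    let _ , bB₀ = basis-exists M
        B , bB , I⊆B , _ = extend-within M iI bB₀
    in ground M ─ B , dual-basis bB , λ x∈I →
         x∈p∧x∉q⇒x∈p─q (indep⊆ground M iI x∈I) λ x∈ → x∈p─q⇒x∉q (ground M) B x∈ (I⊆B x∈I)

  dual-dual⇒indep : ∀ {I} → Indep (M * *) I → Indep M I
  dual-dual⇒indep {I} (B* , ((B , bB , B*⊆) , B*-max) , I⊆) = indep-⊆ M I⊆B (proj₁ bB)
    where
    E─B⊆B* : ground M ─ B ⊆ B*
    E─B⊆B* {x} x∈ = decidable-stable (x ∈? B*) λ x∉B* →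
      B*-max (B , bB , ⊆-refl) (B*⊆ , x , x∈ , x∉B*)
    I⊆B : I ⊆ B
    I⊆B {x} x∈I = decidable-stable (x ∈? B) λ x∉B →
      x∈p─q⇒x∉q (ground M) B* (I⊆ x∈I) (E─B⊆B* (x∈p∧x∉q⇒x∈p─q (p─q⊆p (ground M) B* (I⊆ x∈I)) x∉B))

module _ {M : Matroid n} {W : Space n} (rs : RowSpace M W) where

  open RowSpace rs

  -- A row containing some `j ∈ X` but no element of `B` would make `B ∪ ⁅ j ⁆` free, against the
  -- maximality of `B` in `X`.
  vanish : ∀ {X B w} → X ⊆ ground M → MaxIn M X B → Member W w →
           (∀ {j} → j ∈ B → j ∉ w) → ∀ {j} → j ∈ X → j ∉ w
  vanish {X} {B} X⊆ mB mw B∩w {j} j∈X j∈w = B∩w j∈B j∈w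
    where
    open MaxIn mB
    j∈B : j ∈ B
    j∈B = maximal j∈X (free⇒ (∪-lub (X⊆ ∘ ⊆X) (x∈p⇒⁅x⁆⊆p (X⊆ j∈X)))
      (free-extend W (indep⇒ indep) mw j∈w B∩w))

  -- A set is coindependent when its complement spans, that is, when no nonzero row vanishes on the
  -- complement.
  rowSpace⇒dual-cycleSpace : CycleSpace (M *) W
  rowSpace⇒dual-cycleSpace = record
    { ⊆ground = ⊆ground
    ; indep⇒  = λ (B , bB , I⊆) {z} mz z⊆I → Empty-unique λ (x , x∈z) →
        vanish ⊆-refl (basis⇒maxIn M bB) mz
          (λ j∈B j∈z → x∈p─q⇒x∉q (ground M) B (I⊆ (z⊆I j∈z)) j∈B) (⊆ground mz x∈z) x∈z
    ; ⇒indep  = coindep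
    }
    where
    coindep : ∀ {I} → I ⊆ ground M → (∀ {z} → Member W z → z ⊆ I → z ≡ ⊥) → CoIndep M I
    coindep {I} I⊆ no-row with maxIn-exists M (p─q⊆p (ground M) I)
    ... | B , mB = B , maxIn⇒basis M mB′ , λ x∈I → x∈p∧x∉q⇒x∈p─q (I⊆ x∈I) λ x∈B →
                     x∈p─q⇒x∉q (ground M) I (⊆X x∈B) x∈I
      where
      open MaxIn mB
      mB′ : MaxIn M (ground M) B
      mB′ = record
        { indep = indep
        ; ⊆X    = p─q⊆p _ _ ∘ ⊆X
        ; maximal = λ {x} x∈E iB∪x → decidable-stable (x ∈? B) λ x∉B →
            -- If `B` were not a basis, the row dual to `x` would vanish on `B`, hence on all of
            -- `ground M ─ I`, and so lie in `I`.
            let w , mw , x∈w , w∩ = indep⇒ iB∪x (x∈p∪⁅x⁆ B)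
                w⊆I : w ⊆ I
                w⊆I {j} j∈w = decidable-stable (j ∈? I) λ j∉I →
                  vanish (p─q⊆p _ _) mB mw
                    (λ i∈B i∈w → x∉B (subst (_∈ B) (w∩ (p⊆p∪q ⁅ x ⁆ i∈B) i∈w) i∈B))
                    (x∈p∧x∉q⇒x∈p─q (⊆ground mw j∈w) j∉I) j∈w
            in Nonempty⇒≢⊥ (x , x∈w) (no-row mw w⊆I)
        }

module _ {M : Matroid n} {Z : Space n} (cs : CycleSpace M Z) where

  open CycleSpace cs

  dependent⇒cycle : ∀ {I} → I ⊆ ground M → ¬ Indep M I → ∃[ z ] Member Z z × z ⊆ I × Nonempty z
  dependent⇒cycle {I} I⊆ ¬iI with anySubset? (λ z → member? Z z ×-dec (z ⊆? I) ×-dec nonempty? z)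
  ... | yes h = h
  ... | no ¬h = contradiction
    (⇒indep I⊆ λ {z} mz z⊆I → decidable-stable (z ≟ˢ ⊥) λ z≢⊥ →
      ¬h (z , mz , z⊆I , ≢⊥⇒Nonempty z≢⊥)) ¬iI

  fundamental-cycle : ∀ {B x} → Indep M B → x ∈ ground M → ¬ Indep M (B ∪ ⁅ x ⁆) →
                      ∃[ z ] Member Z z × z ⊆ B ∪ ⁅ x ⁆ × x ∈ z
  fundamental-cycle {B} {x} iB x∈E ¬i
    with dependent⇒cycle (∪-lub (indep⊆ground M iB) (x∈p⇒⁅x⁆⊆p x∈E)) ¬i
  ... | z , mz , z⊆ , ne = z , mz , z⊆ , decidable-stable (x ∈? z) λ x∉z →
    Nonempty⇒≢⊥ ne (indep⇒ iB mz λ y∈z →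
      [ id , (λ { refl → contradiction y∈z x∉z }) ]′ (∈∪⁅⁆⁻ (z⊆ y∈z)))

  -- For a set avoiding a basis, the fundamental cycles of its elements are the dual witnesses.
  -- Conversely, the complement of a free set spans: a witness for `x` could otherwise be moved into
  -- an independent set.
  cycleSpace⇒dual-rowSpace : RowSpace (M *) Z
  cycleSpace⇒dual-rowSpace = record
    { ⊆ground = ⊆ground
    ; indep⇒  = λ { {I} (B , bB , I⊆) {i} i∈I →
        let z , mz , z⊆ , i∈z = fundamental-cycle (proj₁ bB) (p─q⊆p _ _ (I⊆ i∈I))
              (λ iB∪i → proj₂ bB iB∪i (p⊂p∪⁅x⁆ (x∈p─q⇒x∉q _ B (I⊆ i∈I))))
        in z , mz , i∈z , λ j∈I j∈z →
             [ (λ j∈B → contradiction j∈B (x∈p─q⇒x∉q _ B (I⊆ j∈I))) , id ]′ (∈∪⁅⁆⁻ (z⊆ j∈z)) }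
    ; free⇒   = coindep
    }
    where
    coindep : ∀ {I} → I ⊆ ground M → Free Z I → CoIndep M I
    coindep {I} I⊆ free with maxIn-exists M (p─q⊆p (ground M) I)
    ... | B , mB = B , maxIn⇒basis M mB′ , λ x∈I → x∈p∧x∉q⇒x∈p─q (I⊆ x∈I) λ x∈B →
                     x∈p─q⇒x∉q (ground M) I (⊆X x∈B) x∈I
      where
      open MaxIn mB
      -- Adding fundamental cycles moves z into B ∪ ⁅ x ⁆ without losing x.
      reduce : ∀ d {z x} → x ∉ B → Member Z z → x ∈ z → (∀ {j} → j ∈ z → j ∈ I → j ≡ x) →
               ∣ z ─ (B ∪ ⁅ x ⁆) ∣ ≤ d →
               ∃[ z′ ] Member Z z′ × x ∈ z′ × z′ ⊆ B ∪ ⁅ x ⁆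
      reduce d {z} {x} x∉B mz x∈z z∩I ≤d with z ⊆? (B ∪ ⁅ x ⁆)
      ... | yes z⊆ = z , mz , x∈z , z⊆
      ... | no z⊈ with ⊈⇒∃ z _ z⊈
      ...   | j , j∈z , j∉ with fundamental-cycle indep (⊆ground mz j∈z)
                                  (λ iB∪j → j∉ (p⊆p∪q _ (maximal
                                     (x∈p∧x∉q⇒x∈p─q (⊆ground mz j∈z) λ j∈I →
                                       j∉ (subst (_∈ B ∪ ⁅ x ⁆) (sym (z∩I j∈z j∈I)) (x∈p∪⁅x⁆ B)))
                                     iB∪j)))
      ...     | c , mc , c⊆ , j∈c = next d ≤d
        where
        c∩I : ∀ {i} → i ∈ c → i ∈ I → i ≡ x
        c∩I i∈c i∈I with ∈∪⁅⁆⁻ (c⊆ i∈c)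
        ... | inj₁ i∈B  = contradiction i∈I (x∈p─q⇒x∉q _ I (⊆X i∈B))
        ... | inj₂ refl = z∩I j∈z i∈I
        x∉c : x ∉ c
        x∉c x∈c with ∈∪⁅⁆⁻ (c⊆ x∈c)
        ... | inj₁ x∈B  = x∉B x∈B
        ... | inj₂ refl = j∉ (x∈p∪⁅x⁆ B)
        shrink : (z △ c) ─ (B ∪ ⁅ x ⁆) ⊂ z ─ (B ∪ ⁅ x ⁆)
        shrink = (λ {i} i∈ → let i∈z△c = p─q⊆p (z △ c) _ i∈
                                 i∉ = x∈p─q⇒x∉q (z △ c) _ i∈
                             in x∈p∧x∉q⇒x∈p─q
                   ([ proj₁ , (λ (_ , i∈c) → [ (λ i∈B → contradiction (p⊆p∪q _ i∈B) i∉) , (λ { refl → j∈z }) ]′ (∈∪⁅⁆⁻ (c⊆ i∈c))) ]′ (x∈p△q⁻ z c i∈z△c)) i∉)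
               , j , x∈p∧x∉q⇒x∈p─q j∈z j∉ , λ j∈ → ∉△-both j∈z j∈c (p─q⊆p _ _ j∈)
        next : ∀ d → ∣ z ─ (B ∪ ⁅ x ⁆) ∣ ≤ d → ∃[ z′ ] Member Z z′ × x ∈ z′ × z′ ⊆ B ∪ ⁅ x ⁆
        next zero    ≤0 = contradiction (ℕ.<-≤-trans (p⊂q⇒∣p∣<∣q∣ shrink) ≤0) λ ()
        next (suc d) ≤d = reduce d x∉B (△-member Z mz mc) (∈△ˡ x∈z x∉c)
          (λ i∈ i∈I → [ (λ (i∈z , _) → z∩I i∈z i∈I) , (λ (_ , i∈c) → c∩I i∈c i∈I) ]′ (x∈p△q⁻ z c i∈))
          (s≤s⁻¹ (ℕ.≤-trans (p⊂q⇒∣p∣<∣q∣ shrink) ≤d))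
      mB′ : MaxIn M (ground M) B
      mB′ = record
        { indep = indep
        ; ⊆X    = p─q⊆p _ _ ∘ ⊆X
        ; maximal = λ {x} x∈E iB∪x → decidable-stable (x ∈? B) λ x∉B →
            let x∈I : x ∈ I
                x∈I = decidable-stable (x ∈? I) λ x∉I → x∉B (maximal (x∈p∧x∉q⇒x∈p─q x∈E x∉I) iB∪x)
                z , mz , x∈z , z∩I = free x∈I
                z′ , mz′ , x∈z′ , z′⊆ = reduce _ x∉B mz x∈z (λ j∈z j∈I → z∩I j∈I j∈z) ℕ.≤-refl
            in Nonempty⇒≢⊥ (x , x∈z′) (indep⇒ iB∪x mz′ z′⊆)
        }

  circuit⇒min : ∀ {C} → Circuit M C → Min Z C
  circuit⇒min {C} (C⊆ , ¬iC , min) with dependent⇒cycle C⊆ ¬iC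
  ... | z , mz , z⊆C , ne = subst (Member Z) z≡C mz , subst Nonempty z≡C ne , λ {D} mD neD D⊆C {x} x∈C →
    decidable-stable (x ∈? D) λ x∉D → Nonempty⇒≢⊥ neD (indep⇒ (min (D⊆C , x , x∈C , x∉D)) mD ⊆-refl)
    where
    z≡C : z ≡ C
    z≡C = ⊆-antisym z⊆C λ {x} x∈C → decidable-stable (x ∈? z) λ x∉z →
      Nonempty⇒≢⊥ ne (indep⇒ (min (z⊆C , x , x∈C , x∉z)) mz ⊆-refl)

  min⇒circuit : ∀ {C} → Min Z C → Circuit M C
  min⇒circuit {C} (mC , ne , min) =
    ⊆ground mC , (λ iC → Nonempty⇒≢⊥ ne (indep⇒ iC mC ⊆-refl)) ,
    λ (D⊆C , x , x∈C , x∉D) → ⇒indep (⊆ground mC ∘ D⊆C) λ {z} mz z⊆D →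
      decidable-stable (z ≟ˢ ⊥) λ z≢⊥ → x∉D (z⊆D (min mz (≢⊥⇒Nonempty z≢⊥) (D⊆C ∘ z⊆D) x∈C))

-- Difference-closed and exceptional spaces

∈∉⇒≢ : {p q : Subset n} {x : Fin n} → x ∈ p → x ∉ q → p ≢ q
∈∉⇒≢ x∈p x∉q p≡q = x∉q (subst (_ ∈_) p≡q x∈p)

DifferenceClosed : Space n → Set
DifferenceClosed Z = ∀ {C D} → Min Z C → Min Z D → C ≢ D → Nonempty (C ∩ D) → Min Z (C △ D)

-- For e the element added to the affine geometry, and Z the row space of the
-- dual: rest is the affine functional, antichain is hyperplane-complementarity,
-- and through and separating say that no element is zero and no two are parallel.
record Exceptional (E : Subset n) (Z : Space n) (e : Fin n) : Set where
  field
    e∈E         : e ∈ E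
    rest        : Member Z (E - e)
    antichain   : ∀ {z z′} → Member Z z → Member Z z′ → z ≢ ⊥ → z′ ≢ E - e → z - e ⊆ z′ → z ≡ z′
    through     : ∃[ z ] Member Z z × e ∈ z
    avoiding    : ∃[ z ] Member Z z × z ≢ ⊥ × z ≢ E - e × e ∉ z
    separating  : ∀ {x y} → x ∈ E → y ∈ E → x ≢ y →
                  ∃[ z ] Member Z z × ((x ∈ z × y ∉ z) ⊎ (x ∉ z × y ∈ z))

-- This is what the single-element deletions of an excluded minor provide: both circuits survive the
-- deletion of `x`.
DifferenceClosed-away : Subset n → Space n → Set
DifferenceClosed-away E Z = ∀ {C D x} → Min Z C → Min Z D → C ≢ D → Nonempty (C ∩ D) →
  x ∈ E → x ∉ C → x ∉ D → Min Z (C △ D)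

-- Bad pairs and the circuits inside their difference

record BadPair (Z : Space n) (C₁ C₂ : Subset n) : Set where
  field
    min₁     : Min Z C₁
    min₂     : Min Z C₂
    distinct : C₁ ≢ C₂
    meet     : Nonempty (C₁ ∩ C₂)
    ¬min     : ¬ Min Z (C₁ △ C₂)

bad-sym : {Z : Space n} {C₁ C₂ : Subset n} → BadPair Z C₁ C₂ → BadPair Z C₂ C₁
bad-sym {Z = Z} {C₁} {C₂} bad = record
  { min₁ = min₂ ; min₂ = min₁ ; distinct = distinct ∘ sym
  ; meet = subst Nonempty (∩-comm C₁ C₂) meet
  ; ¬min = ¬min ∘ subst (Min Z) (△-comm C₂ C₁) }
  where open BadPair bad

bad-exists : {Z : Space n} → ¬ DifferenceClosed Z → ∃[ C₁ ] ∃[ C₂ ] BadPair Z C₁ C₂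
bad-exists {Z = Z} ¬dc
  with anySubset? (λ C → anySubset? λ D → min? Z C ×-dec min? Z D ×-dec ¬? (C ≟ˢ D) ×-dec
         nonempty? (C ∩ D) ×-dec ¬? (min? Z (C △ D)))
... | yes (C , D , mC , mD , C≢D , ne , ¬m) =
  C , D , record { min₁ = mC ; min₂ = mD ; distinct = C≢D ; meet = ne ; ¬min = ¬m }
... | no ¬h = contradiction
  (λ {C} {D} mC mD C≢D ne → decidable-stable (min? Z (C △ D)) λ ¬m → ¬h (C , D , mC , mD , C≢D , ne , ¬m))
  ¬dc

module _ {E : Subset n} {Z : Space n} (Z⊆E : ∀ {z} → Member Z z → z ⊆ E)
         (away : DifferenceClosed-away E Z) where

  △-min : ∀ {C D s x} → Min Z C → Min Z D → C ≢ D → s ∈ C → s ∈ D → x ∈ E → x ∉ C → x ∉ D → Min Z (C △ D)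
  △-min mC mD C≢D s∈C s∈D = away mC mD C≢D (_ , x∈p∩q⁺ (s∈C , s∈D))

  module _ {C₁ C₂ : Subset n} (bad : BadPair Z C₁ C₂) where

    open BadPair bad

    bad-cover : ∀ {x} → x ∈ E → x ∉ C₁ → x ∈ C₂
    bad-cover {x} x∈E x∉C₁ = decidable-stable (x ∈? C₂) λ x∉C₂ →
      ¬min (away min₁ min₂ distinct meet x∈E x∉C₁ x∉C₂)

    -- A circuit `D` that missed `C₁` would lie in `C₂`, hence equal it and contain the common
    -- points of the pair, which the difference omits.
    meets-first : ∀ {D} → Min Z D → D ⊆ C₁ △ C₂ → ∃[ x ] x ∈ D × x ∈ C₁ × x ∉ C₂
    meets-first {D} mD D⊆ with nonempty? (D ∩ C₁)
    ... | yes (x , x∈) = let x∈D , x∈C₁ = x∈p∩q⁻ D C₁ x∈ in x , x∈D , x∈C₁ , ∈△∧∈ˡ⇒∉ʳ (D⊆ x∈D) x∈C₁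
    ... | no ¬meet = contradiction s∈D s∉D
      where
      s = proj₁ meet
      s∈C₁ = proj₁ (x∈p∩q⁻ C₁ C₂ (proj₂ meet))
      s∈C₂ = proj₂ (x∈p∩q⁻ C₁ C₂ (proj₂ meet))
      D⊆C₂ : D ⊆ C₂
      D⊆C₂ {x} x∈D = ∈△∧∉ˡ⇒∈ʳ (D⊆ x∈D) λ x∈C₁ → ¬meet (x , x∈p∩q⁺ (x∈D , x∈C₁))
      s∈D : s ∈ D
      s∈D = proj₂ (proj₂ min₂) (proj₁ mD) (proj₁ (proj₂ mD)) D⊆C₂ s∈C₂
      s∉D : s ∉ D
      s∉D s∈D = ∉△-both s∈C₁ s∈C₂ (D⊆ s∈D)

  module _ {C₁ C₂ : Subset n} (bad : BadPair Z C₁ C₂) where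

    open BadPair bad

    private
      P = C₁ △ C₂
      P∈Z : Member Z P
      P∈Z = △-member Z (proj₁ min₁) (proj₁ min₂)

    meets-second : ∀ {D} → Min Z D → D ⊆ P → ∃[ x ] x ∈ D × x ∉ C₁ × x ∈ C₂
    meets-second mD D⊆ =
      let x , x∈D , x∈C₂ , x∉C₁ = meets-first (bad-sym bad) mD (subst (_ ∈_) (△-comm C₁ C₂) ∘ D⊆)
      in x , x∈D , x∉C₁ , x∈C₂

    -- `P` is not a circuit, so `P △ D` is nonempty and contains a circuit; the point of that
    -- circuit in `C₂ ─ C₁` is missed by both `C₁` and `D`.
    split-first : ∀ {D} → Min Z D → D ⊆ P → ∃[ x ] x ∈ C₂ × x ∉ C₁ × x ∉ D × Min Z (C₁ △ D)
    split-first {D} mD D⊆P =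
      let s , s∈ = meet
          s∈C₁ , s∈C₂ = x∈p∩q⁻ C₁ C₂ s∈
          y , y∈ = ≢⊥⇒Nonempty {p = P △ D} λ eq → ¬min (subst (Min Z) (sym (△≡⊥⇒≡ eq)) mD)
          D′ , mD′ , D′⊆ , _ = min-through Z (△-member Z P∈Z (proj₁ mD)) y∈
          x , x∈D′ , x∉C₁ , x∈C₂ = meets-second mD′ (△-⊆ ⊆-refl D⊆P ∘ D′⊆)
          x∉D = ∈△∧∈ˡ⇒∉ʳ (D′⊆ x∈D′) (∈△ʳ x∉C₁ x∈C₂)
          u , u∈D , u∈C₁ , u∉C₂ = meets-first bad mD D⊆P
      in x , x∈C₂ , x∉C₁ , x∉D ,
         △-min min₁ mD (∈∉⇒≢ s∈C₁ (∉△-both s∈C₁ s∈C₂ ∘ D⊆P)) u∈C₁ u∈D (Z⊆E (proj₁ min₂) x∈C₂) x∉C₁ x∉D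

    -- `P △ D` is the difference of `C₁ △ D` and `C₂`. These share the common points of the pair,
    -- and both miss a point of `D` in `C₁ ─ C₂`.
    complement-min : ∀ {D} → Min Z D → D ⊆ P → Min Z (P △ D)
    complement-min {D} mD D⊆P =
      let s , s∈ = meet
          s∈C₁ , s∈C₂ = x∈p∩q⁻ C₁ C₂ s∈
          x , x∈C₂ , x∉C₁ , x∉D , mC₁△D = split-first mD D⊆P
          u , u∈D , u∈C₁ , u∉C₂ = meets-first bad mD D⊆P
      in subst (Min Z) (△-swapʳ C₁ D C₂)
           (△-min mC₁△D min₂ (∈∉⇒≢ x∈C₂ (∉△-neither x∉C₁ x∉D) ∘ sym)
             (∈△ˡ s∈C₁ (∉△-both s∈C₁ s∈C₂ ∘ D⊆P)) s∈C₂
             (Z⊆E (proj₁ min₁) u∈C₁) (∉△-both u∈C₁ u∈D) u∉C₂)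

    outside⇒common : ∀ {x} → x ∈ E → x ∉ P → x ∈ C₁ × x ∈ C₂
    outside⇒common {x} x∈E x∉P with x ∈? C₁
    ... | yes x∈C₁ = x∈C₁ , ∉△∧∈ˡ⇒∈ʳ x∉P x∈C₁
    ... | no x∉C₁  = contradiction (∈△ʳ x∉C₁ (bad-cover bad x∈E x∉C₁)) x∉P

    -- A circuit C through s but not through t can be complemented in K and in
    -- P △ K, which makes P itself a difference of two circuits missing t.
    no-split-both : ∀ {K C s t a b} → Min Z K → K ⊆ P → Min Z C → s ∈ C → t ∉ C → s ∉ P → t ∉ P → t ∈ E →
                    a ∈ C → a ∈ K → b ∈ C → b ∉ P △ K
    no-split-both {K} {C} {s} {t} mK K⊆P mC s∈C t∉C s∉P t∉P t∈E a∈C a∈K b∈C b∈L =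
      ¬min (subst (Min Z) (△-cancelˡ C P)
        (△-min mC mC△P (∈∉⇒≢ a∈C (∉△-both a∈C (K⊆P a∈K))) s∈C (∈△ˡ s∈C s∉P) t∈E t∉C (∉△-neither t∉C t∉P)))
      where
      mL : Min Z (P △ K)
      mL = complement-min mK K⊆P
      mC△K : Min Z (C △ K)
      mC△K = △-min mC mK (∈∉⇒≢ s∈C (s∉P ∘ K⊆P)) a∈C a∈K t∈E t∉C (t∉P ∘ K⊆P)
      b∉K : _ ∉ K
      b∉K b∈K = ∉△-both (K⊆P b∈K) b∈K b∈L
      mC△P : Min Z (C △ P)
      mC△P = subst (Min Z) eq
        (△-min mC△K mL (∈∉⇒≢ (∈△ˡ s∈C (s∉P ∘ K⊆P)) (∉△-neither s∉P (s∉P ∘ K⊆P)))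
          (∈△ˡ b∈C b∉K) b∈L t∈E (∉△-neither t∉C (t∉P ∘ K⊆P)) (∉△-neither t∉P (t∉P ∘ K⊆P)))
        where
        eq : (C △ K) △ (P △ K) ≡ C △ P
        eq = trans (cong ((C △ K) △_) (△-comm P K)) (trans (sym (△-assoc (C △ K) K P))
               (cong (_△ P) (△-cancelʳ C K)))

    -- Replacing `C` by `C △ C₁` exchanges the roles of `s` and `t` and creates points in both `K`
    -- and `P △ K`, which is the case already excluded.
    no-split-half : ∀ {K C s t} → Min Z K → K ⊆ P → Min Z C → s ∈ C → t ∉ C → s ∉ P → t ∉ P → s ∈ E → t ∈ E →
                    ¬ (∀ {x} → x ∈ C → x ∉ K)
    no-split-half {K} {C} {s} {t} mK K⊆P mC s∈C t∉C s∉P t∉P s∈E t∈E C∩K =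
      no-split-both mK K⊆P mQ (∈△ʳ t∉C t∈C₁) (∉△-both s∈C s∈C₁) t∉P s∉P s∈E
        (∈△ʳ (λ u∈C → C∩K u∈C u∈K) u∈C₁) u∈K (proj₁ b∈) (proj₂ b∈)
      where
      s∈C₁ = proj₁ (outside⇒common s∈E s∉P)
      t∈C₁ = proj₁ (outside⇒common t∈E t∉P)
      Q = C △ C₁
      first = meets-first bad mK K⊆P
      u∈K = proj₁ (proj₂ first)
      u∈C₁ = proj₁ (proj₂ (proj₂ first))
      mQ : Min Z Q
      mQ = let x , x∈K , x∉C₁ , x∈C₂ = meets-second mK K⊆P
           in △-min mC min₁ (∈∉⇒≢ t∈C₁ t∉C ∘ sym) s∈C s∈C₁ (Z⊆E (proj₁ min₂) x∈C₂) (λ x∈C → C∩K x∈C x∈K) x∉C₁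
      b∃ : Nonempty (Q ∩ (P △ K))
      -- A point of `C` outside `C₁` lies in `C₂` by covering, hence in `P`, hence in `P △ K`. With
      -- no such point, `C` would lie in `C₁` and equal it, although only `C₁` contains `t`.
      b∃ = decidable-stable (nonempty? (Q ∩ (P △ K))) λ ¬b →
        t∉C (proj₂ (proj₂ min₁) (proj₁ mC) (s , s∈C)
          (λ {y} y∈C → decidable-stable (y ∈? C₁) λ y∉C₁ →
            ¬b (y , x∈p∩q⁺ (∈△ˡ y∈C y∉C₁ ,
              ∈△ˡ (∈△ʳ y∉C₁ (bad-cover bad (Z⊆E (proj₁ mC) y∈C) y∉C₁)) (C∩K y∈C))))
          t∈C₁)
      b∈ = x∈p∩q⁻ Q (P △ K) (proj₂ b∃)

    -- Points outside `P` thus lie in the same circuits. A circuit `K` inside `P` and its complement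
    -- `P △ K`, also a circuit, are the two halves against which `C` is tested.
    no-split : ∀ {C s t} → Min Z C → s ∈ C → t ∉ C → s ∈ E → t ∈ E → s ∉ P → ¬ (t ∉ P)
    no-split {C} mC s∈C t∉C s∈E t∈E s∉P t∉P
      with y , y∈P ← ≢⊥⇒Nonempty (distinct ∘ △≡⊥⇒≡)
      with K , mK , K⊆P , _ ← min-through Z P∈Z y∈P
      with nonempty? (C ∩ K) | nonempty? (C ∩ (P △ K))
    ... | no ¬a | _ = no-split-half mK K⊆P mC s∈C t∉C s∉P t∉P s∈E t∈E
            λ x∈C x∈K → ¬a (_ , x∈p∩q⁺ (x∈C , x∈K))
    ... | yes _ | no ¬b = no-split-half (complement-min mK K⊆P) (△-⊆ ⊆-refl K⊆P) mC s∈C t∉C s∉P t∉P s∈E t∈E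
            λ x∈C x∈L → ¬b (_ , x∈p∩q⁺ (x∈C , x∈L))
    ... | yes (a , a∈) | yes (b , b∈) =
      let a∈C , a∈K = x∈p∩q⁻ C K a∈
          b∈C , b∈L = x∈p∩q⁻ C (P △ K) b∈
      in no-split-both mK K⊆P mC s∈C t∉C s∉P t∉P t∈E a∈C a∈K b∈C b∈L

    -- Without such a `d`, the member `C △ (P △ K)`, which contains `e`, would lie in `C₁`; but it
    -- omits the points of `K` in `C₁`, against the minimality of `C₁`.
    uncovered : ∀ {K C e} → Min Z K → K ⊆ P → Min Z C → e ∈ C → e ∉ P → (∀ {x} → x ∈ C → x ∉ K) →
                ∃[ d ] d ∈ P △ K × d ∉ C × d ∉ C₁
    uncovered {K} {C} {e} mK K⊆P mC e∈C e∉P C∩K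
      with any? (λ d → (d ∈? P △ K) ×-dec ¬? (d ∈? C) ×-dec ¬? (d ∈? C₁))
    ... | yes h = h
    ... | no ¬h = contradiction
      (proj₂ (proj₂ min₁) (△-member Z (proj₁ mC) (proj₁ mL)) (e , ∈△ˡ e∈C (∉△-neither e∉P (e∉P ∘ K⊆P))) ⊆C₁ u∈C₁)
      (∉△-neither (λ u∈C → C∩K u∈C u∈K) (∉△-both (K⊆P u∈K) u∈K))
      where
      mL = complement-min mK K⊆P
      first = meets-first bad mK K⊆P
      u∈K = proj₁ (proj₂ first)
      u∈C₁ = proj₁ (proj₂ (proj₂ first))
      ⊆C₁ : C △ (P △ K) ⊆ C₁
      ⊆C₁ {y} y∈ with x∈p△q⁻ C (P △ K) y∈
      ... | inj₁ (y∈C , y∉L) = proj₁ (outside⇒common (Z⊆E (proj₁ mC) y∈C)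
                                  λ y∈P → C∩K y∈C (∉△∧∈ˡ⇒∈ʳ y∉L y∈P))
      ... | inj₂ (y∉C , y∈L) = decidable-stable (y ∈? C₁) λ y∉C₁ → ¬h (y , y∈L , y∉C , y∉C₁)

  -- The antichain condition when the difference omits only one element

  module _ {C₁ C₂ : Subset n} (bad : BadPair Z C₁ C₂) {e : Fin n} (e∈E : e ∈ E)
           (P≡ : C₁ △ C₂ ≡ E - e) where

    open BadPair bad

    private
      P = C₁ △ C₂

      e∉P : e ∉ P
      e∉P e∈P = x∈p─q⇒x∉q E ⁅ e ⁆ (subst (e ∈_) P≡ e∈P) (x∈⁅x⁆ e)

      ∉P⇒≡e : ∀ {x} → x ∈ E → x ∉ P → x ≡ e
      ∉P⇒≡e {x} x∈E x∉P = decidable-stable (x ≟ᶠ e) λ x≢e →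
        x∉P (subst (x ∈_) (sym P≡) (x∈p∧x≢y⇒x∈p-y x∈E x≢e))

      e∈C₁ = proj₁ (outside⇒common bad e∈E e∉P)

      ⊆P : ∀ {D} → Member Z D → e ∉ D → D ⊆ P
      ⊆P {D} mD e∉D {x} x∈D = decidable-stable (x ∈? P) λ x∉P →
        e∉D (subst (_∈ D) (∉P⇒≡e (Z⊆E mD x∈D) x∉P) x∈D)

    -- If `C` and `K` were disjoint, the chain `C △ C₁`, `(C △ C₁) △ K`, `C △ K` would consist of
    -- circuits, and the last one properly contains the circuit `K`. For the last difference,
    -- `uncovered` in the two orders of the bad pair supplies the point `d` missed and the point `b`
    -- of meeting.
    circuits-meet : ∀ {K C} → Min Z K → e ∉ K → Min Z C → e ∈ C → Nonempty (C ∩ K)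
    circuits-meet {K} {C} mK e∉K mC e∈C = decidable-stable (nonempty? (C ∩ K)) λ ¬meet →
      let C∩K : ∀ {x} → x ∈ C → x ∉ K
          C∩K x∈C x∈K = ¬meet (_ , x∈p∩q⁺ (x∈C , x∈K))
          K⊆P = ⊆P (proj₁ mK) e∉K
          u , u∈K , u∈C₁ , u∉C₂ = meets-first bad mK K⊆P
          x , x∈K , x∉C₁ , x∈C₂ = meets-second bad mK K⊆P
          d , d∈L , d∉C , d∉C₁ = uncovered bad mK K⊆P mC e∈C e∉P C∩K
          P≡P′ = △-comm C₂ C₁
          b , b∈L′ , b∉C , b∉C₂ = uncovered (bad-sym bad) mK
                                    (subst (_ ∈_) (sym P≡P′) ∘ K⊆P) mC e∈C (e∉P ∘ subst (e ∈_) P≡P′) C∩K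
          b∈L = subst (λ p → b ∈ p △ K) P≡P′ b∈L′
          L∉K : ∀ {y} → y ∈ P △ K → y ∉ K
          L∉K y∈L y∈K = ∉△-both (K⊆P y∈K) y∈K y∈L
          b∈C₁ : b ∈ C₁
          b∈C₁ = ∈△∧∉ʳ⇒∈ˡ (∈△∧∉ʳ⇒∈ˡ b∈L (L∉K b∈L)) b∉C₂
          x∈E = Z⊆E (proj₁ min₂) x∈C₂
          mQ : Min Z (C △ C₁)
          mQ = △-min mC min₁ (∈∉⇒≢ u∈C₁ (λ u∈C → C∩K u∈C u∈K) ∘ sym) e∈C e∈C₁ x∈E
                 (λ x∈C → C∩K x∈C x∈K) x∉C₁
          mR : Min Z ((C △ C₁) △ K)
          mR = △-min mQ mK (∈∉⇒≢ x∈K (∉△-neither (λ x∈C → C∩K x∈C x∈K) x∉C₁) ∘ sym)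
                 (∈△ʳ (λ u∈C → C∩K u∈C u∈K) u∈C₁) u∈K e∈E (∉△-both e∈C e∈C₁) e∉K
          mC△K : Min Z (C △ K)
          mC△K = subst (Min Z) (trans (cong (_△ C₁) (△-swapʳ C C₁ K)) (△-cancelʳ (C △ K) C₁))
                   (△-min mR min₁ (∈∉⇒≢ e∈C₁ (∉△-neither (∉△-both e∈C e∈C₁) e∉K) ∘ sym)
                     (∈△ˡ (∈△ʳ b∉C b∈C₁) (L∉K b∈L)) b∈C₁ (Z⊆E (proj₁ min₂) (d∈C₂ d∈L (L∉K d∈L) d∉C₁))
                     (∉△-neither (∉△-neither d∉C d∉C₁) (L∉K d∈L)) d∉C₁)
      in e∉K (proj₂ (proj₂ mC△K) (proj₁ mK) (u , u∈K)
           (λ y∈K → ∈△ʳ (λ y∈C → C∩K y∈C y∈K) y∈K) (∈△ˡ e∈C e∉K))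
      where
      d∈C₂ : ∀ {d} → d ∈ P △ K → d ∉ K → d ∉ C₁ → d ∈ C₂
      d∈C₂ d∈L d∉K d∉C₁ = ∈△∧∉ˡ⇒∈ʳ (∈△∧∉ʳ⇒∈ˡ d∈L d∉K) d∉C₁

    disjoint⇒complementary : ∀ {K C} → Min Z K → Min Z C → (∀ {x} → x ∈ K → x ∈ C → x ≡ e) → C ≡ P △ K
    disjoint⇒complementary {K} {C} mK mC K∩C with e ∈? K | e ∈? C
    ... | no e∉K  | yes e∈C = contradiction e∈K e∉K
      where
      common = circuits-meet mK e∉K mC e∈C
      x∈C = proj₁ (x∈p∩q⁻ C K (proj₂ common))
      x∈K = proj₂ (x∈p∩q⁻ C K (proj₂ common))
      e∈K : e ∈ K
      e∈K = subst (_∈ K) (K∩C x∈K x∈C) x∈K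
    ... | yes e∈K | no e∉C = contradiction e∈C e∉C
      where
      common = circuits-meet mC e∉C mK e∈K
      x∈K = proj₁ (x∈p∩q⁻ K C (proj₂ common))
      x∈C = proj₂ (x∈p∩q⁻ K C (proj₂ common))
      e∈C : e ∈ C
      e∈C = subst (_∈ C) (K∩C x∈K x∈C) x∈C
    ... | no e∉K  | no e∉C =
      min-⊆⇒≡ {Z = Z} (complement-min bad mK (⊆P (proj₁ mK) e∉K)) (proj₁ mC) (proj₁ (proj₂ mC))
        λ x∈C → ∈△ˡ (⊆P (proj₁ mC) e∉C x∈C) λ x∈K → e∉C (subst (_∈ C) (K∩C x∈K x∈C) x∈C)
    -- A circuit in the difference of `P △ K` and `C` avoids `e`, so it meets `K`. But a point of
    -- `K` other than `e` lies neither in `P △ K` nor in `C`.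
    ... | yes e∈K | yes e∈C = decidable-stable (C ≟ˢ (P △ K)) λ C≢ →
      let D₀ = (P △ K) △ C
          y , y∈D₀ = ≢⊥⇒Nonempty {p = D₀} (C≢ ∘ sym ∘ △≡⊥⇒≡)
          D , mD , D⊆D₀ , _ = min-through Z
            (△-member Z (△-member Z (△-member Z (proj₁ min₁) (proj₁ min₂)) (proj₁ mK)) (proj₁ mC)) y∈D₀
          e∉D = ∉△-both (∈△ʳ e∉P e∈K) e∈C ∘ D⊆D₀
          x , x∈ = circuits-meet mD e∉D mK e∈K
          x∈K , x∈D = x∈p∩q⁻ K D x∈
      in ∉△-neither (∉△-both (⊆P (proj₁ mD) e∉D x∈D) x∈K)
           (λ x∈C → e∉D (subst (_∈ D) (K∩C x∈K x∈C) x∈D)) (D⊆D₀ x∈D)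

    -- A circuit `K` in `z` and a circuit `C` in `P △ z′` can share only `e`, so `C ≡ P △ K`. This
    -- forces `z` and `z′` to agree off `e`, and no nonempty member fits inside `⁅ e ⁆`, since `C₁`
    -- contains `e` properly.
    bad⇒antichain : ∀ {z z′} → Member Z z → Member Z z′ → z ≢ ⊥ → z′ ≢ P → z - e ⊆ z′ → z ≡ z′
    bad⇒antichain {z} {z′} mz mz′ z≢⊥ z′≢P z-e⊆z′ =
      △≡⊥⇒≡ (decidable-stable ((z △ z′) ≟ˢ ⊥) λ z△z′≢⊥ →
        let y , y∈P = ≢⊥⇒Nonempty (distinct ∘ △≡⊥⇒≡)
            K₀ , mK₀ , K₀⊆P , _ = min-through Z mP y∈P
            u , u∈K₀ , u∈C₁ , _ = meets-first bad mK₀ K₀⊆P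
            u∈z△z′ = proj₂ (proj₂ min₁) (△-member Z mz mz′) (≢⊥⇒Nonempty z△z′≢⊥)
                       (λ x∈ → subst (_∈ C₁) (sym (⊆e x∈)) e∈C₁) u∈C₁
        in e∉P (subst (_∈ P) (⊆e u∈z△z′) (K₀⊆P u∈K₀)))
      where
      mP = △-member Z (proj₁ min₁) (proj₁ min₂)
      w = P △ z′
      inz = ≢⊥⇒Nonempty z≢⊥
      inw = ≢⊥⇒Nonempty {p = w} (z′≢P ∘ sym ∘ △≡⊥⇒≡)
      throughz = min-through Z mz (proj₂ inz)
      throughw = min-through Z (△-member Z mP mz′) (proj₂ inw)
      K = proj₁ throughz
      C = proj₁ throughw
      K⊆z : K ⊆ z
      K⊆z = proj₁ (proj₂ (proj₂ throughz))
      C⊆w : C ⊆ w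
      C⊆w = proj₁ (proj₂ (proj₂ throughw))
      z⇒z′ : ∀ {x} → x ∈ z → x ∉ z′ → x ≡ e
      z⇒z′ {x} x∈z x∉z′ = decidable-stable (x ≟ᶠ e) λ x≢e → x∉z′ (z-e⊆z′ (x∈p∧x≢y⇒x∈p-y x∈z x≢e))
      K∩C : ∀ {x} → x ∈ K → x ∈ C → x ≡ e
      K∩C {x} x∈K x∈C with x ∈? z′
      ... | no x∉z′  = z⇒z′ (K⊆z x∈K) x∉z′
      ... | yes x∈z′ = ∉P⇒≡e (Z⊆E mz (K⊆z x∈K)) λ x∈P → ∉△-both x∈P x∈z′ (C⊆w x∈C)
      C≡ : C ≡ P △ K
      C≡ = disjoint⇒complementary (proj₁ (proj₂ throughz)) (proj₁ (proj₂ throughw)) K∩C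
      ⊆e : ∀ {x} → x ∈ z △ z′ → x ≡ e
      ⊆e {x} x∈ with x∈p△q⁻ z z′ x∈
      ... | inj₁ (x∈z , x∉z′) = z⇒z′ x∈z x∉z′
      ... | inj₂ (x∉z , x∈z′) = ∉P⇒≡e (Z⊆E mz′ x∈z′) λ x∈P →
        x∉z (K⊆z (∉△∧∈ˡ⇒∈ʳ (λ x∈P△K → ∉△-both x∈P x∈z′ (C⊆w (subst (x ∈_) (sym C≡) x∈P△K))) x∈P))

  bad⇒exceptional : ∀ {C₁ C₂} → BadPair Z C₁ C₂ →
    (∀ {x y} → x ∈ E → y ∈ E → x ≢ y → ∃[ z ] Member Z z × ((x ∈ z × y ∉ z) ⊎ (x ∉ z × y ∈ z))) →
    ∃ (Exceptional E Z)
  bad⇒exceptional {C₁} {C₂} bad sep = e , record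
    { e∈E = e∈E
    ; rest = subst (Member Z) P≡ P∈Z
    ; antichain = λ mz mz′ z≢⊥ z′≢ → bad⇒antichain bad e∈E P≡ mz mz′ z≢⊥ (z′≢ ∘ λ eq → trans eq P≡)
    ; through = C₁ , proj₁ min₁ , e∈C₁
    ; avoiding =
        let y , y∈P = ≢⊥⇒Nonempty (distinct ∘ △≡⊥⇒≡)
            K , mK , K⊆P , _ = min-through Z P∈Z y∈P
        in K , proj₁ mK , Nonempty⇒≢⊥ (proj₁ (proj₂ mK)) ,
           (λ K≡ → ¬min (subst (Min Z) (trans K≡ (sym P≡)) mK)) , e∉P ∘ K⊆P
    ; separating = sep
    }
    where
    open BadPair bad
    P = C₁ △ C₂
    P∈Z = △-member Z (proj₁ min₁) (proj₁ min₂)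
    e = proj₁ meet
    e∈C₁ = proj₁ (x∈p∩q⁻ C₁ C₂ (proj₂ meet))
    e∈C₂ = proj₂ (x∈p∩q⁻ C₁ C₂ (proj₂ meet))
    e∈E = Z⊆E (proj₁ min₁) e∈C₁
    e∉P : e ∉ P
    e∉P = ∉△-both e∈C₁ e∈C₂
    -- A member telling two points outside `P` apart contains a circuit that does so too, which
    -- `no-split` forbids.
    unique : ∀ {t} → t ∈ E → t ∉ P → t ≡ e
    unique {t} t∈E t∉P = decidable-stable (t ≟ᶠ e) λ t≢e → splits (sep t∈E e∈E t≢e)
      where
      splits : ¬ (∃[ z ] Member Z z × ((t ∈ z × e ∉ z) ⊎ (t ∉ z × e ∈ z)))
      splits (z , mz , inj₁ (t∈z , e∉z)) =
        let C , mC , C⊆z , t∈C = min-through Z mz t∈z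
        in no-split bad mC t∈C (e∉z ∘ C⊆z) t∈E e∈E t∉P e∉P
      splits (z , mz , inj₂ (t∉z , e∈z)) =
        let C , mC , C⊆z , e∈C = min-through Z mz e∈z
        in no-split bad mC e∈C (t∉z ∘ C⊆z) e∈E t∈E e∉P t∉P
    P≡ : P ≡ E - e
    P≡ = ⊆-antisym
      (λ {x} x∈P → x∈p∧x≢y⇒x∈p-y (△-⊆ (Z⊆E (proj₁ min₁)) (Z⊆E (proj₁ min₂)) x∈P) λ { refl → e∉P x∈P })
      (λ {x} x∈ → decidable-stable (x ∈? P) λ x∉P →
        x∈p─q⇒x∉q E ⁅ e ⁆ x∈ (subst (_∈ ⁅ e ⁆) (sym (unique (p─q⊆p E _ x∈) x∉P)) (x∈⁅x⁆ e)))

-- Exceptional spaces fail difference-closure only on covering pairs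

module _ {E : Subset n} {Z : Space n} {e : Fin n} (Z⊆E : ∀ {z} → Member Z z → z ⊆ E)
         (exc : Exceptional E Z e) where

  open Exceptional exc

  private
    h = E - e

    e∉h : e ∉ h
    e∉h e∈h = x∈p─q⇒x∉q E ⁅ e ⁆ e∈h (x∈⁅x⁆ e)

    ⊆h : ∀ {z} → Member Z z → e ∉ z → z ⊆ h
    ⊆h mz e∉z x∈z = x∈p∧x≢y⇒x∈p-y (Z⊆E mz x∈z) λ { refl → e∉z x∈z }

    avoids⇒≢h : ∀ {z} → e ∈ z → z ≢ h
    avoids⇒≢h e∈z z≡h = e∉h (subst (e ∈_) z≡h e∈z)

  exceptional⇒min : ∀ {z} → Member Z z → z ≢ ⊥ → z ≢ h → Min Z z
  exceptional⇒min mz z≢⊥ z≢h = mz , ≢⊥⇒Nonempty z≢⊥ , λ mD neD D⊆z x∈z →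
    subst (_ ∈_) (sym (antichain mD mz (Nonempty⇒≢⊥ neD) z≢h (D⊆z ∘ p─q⊆p _ _))) x∈z

  rest-¬min : ¬ Min Z h
  rest-¬min mh =
    let y , my , y≢⊥ , y≢h , e∉y = avoiding
    in y≢h (min-⊆⇒≡ {Z = Z} mh my (≢⊥⇒Nonempty y≢⊥) (⊆h my e∉y))

  -- For a member `C` through `e`, both `C` and `h △ C` contain `e`, so they are circuits that meet;
  -- their difference is `h`.
  exceptional⇒¬differenceClosed : ¬ DifferenceClosed Z
  exceptional⇒¬differenceClosed dc = rest-¬min (subst (Min Z) (△-cancelʳ h C)
    (dc (exceptional⇒min (△-member Z rest mC) (Nonempty⇒≢⊥ (e , e∈h△C)) (avoids⇒≢h e∈h△C))
        (exceptional⇒min mC (Nonempty⇒≢⊥ (e , e∈C)) (avoids⇒≢h e∈C))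
        (λ eq → h≢⊥ (trans (sym (△-cancelʳ h C)) (trans (cong (_△ C) eq) (△-same C))))
        (e , x∈p∩q⁺ (e∈h△C , e∈C))))
    where
    C = proj₁ through
    mC = proj₁ (proj₂ through)
    e∈C = proj₂ (proj₂ through)
    e∈h△C : e ∈ h △ C
    e∈h△C = ∈△ʳ e∉h e∈C
    h≢⊥ : h ≢ ⊥
    h≢⊥ = let y , my , y≢⊥ , _ , e∉y = avoiding
              x , x∈y = ≢⊥⇒Nonempty y≢⊥
          in Nonempty⇒≢⊥ (x , ⊆h my e∉y x∈y)

  -- If the difference were `h`, then `e` would be the only element outside it; but a common point
  -- and a point missed by both are two such elements.
  exceptional⇒away : DifferenceClosed-away E Z
  exceptional⇒away {C} {D} {x} mC mD C≢D (c , c∈) x∈E x∉C x∉D =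
    exceptional⇒min (△-member Z (proj₁ mC) (proj₁ mD)) (C≢D ∘ △≡⊥⇒≡) λ C△D≡h →
      let c∈C , c∈D = x∈p∩q⁻ C D c∈
          ∉h⇒≡e : ∀ {y} → y ∈ E → y ∉ C △ D → y ≡ e
          ∉h⇒≡e {y} y∈E y∉ = decidable-stable (y ≟ᶠ e) λ y≢e →
            y∉ (subst (y ∈_) (sym C△D≡h) (x∈p∧x≢y⇒x∈p-y y∈E y≢e))
          c≡e = ∉h⇒≡e (Z⊆E (proj₁ mC) c∈C) (∉△-both c∈C c∈D)
          x≡e = ∉h⇒≡e x∈E (∉△-neither x∉C x∉D)
      in x∉C (subst (_∈ C) (trans c≡e (sym x≡e)) c∈C)

-- Series minors

avoid : Fin n → Space n → Space n
avoid x Z = record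
  { Member   = λ z → Member Z z × x ∉ z
  ; member?  = λ z → member? Z z ×-dec ¬? (x ∈? z)
  ; ⊥-member = ⊥-member Z , ∉⊥
  ; △-member = λ (mp , x∉p) (mq , x∉q) → △-member Z mp mq , ∉△-neither x∉p x∉q
  }

─-distribʳ-△ : (p q r : Subset n) → (p △ q) ─ r ≡ (p ─ r) △ (q ─ r)
─-distribʳ-△ []      []      []            = refl
─-distribʳ-△ (_ ∷ p) (_ ∷ q) (inside ∷ r)  = cong (outside ∷_) (─-distribʳ-△ p q r)
─-distribʳ-△ (_ ∷ p) (_ ∷ q) (outside ∷ r) = cong (_ ∷_) (─-distribʳ-△ p q r)

drop : Fin n → Space n → Space n
drop x Z = record
  { Member   = λ w → ∃[ z ] Member Z z × w ≡ z - x
  ; member?  = λ w → anySubset? λ z → member? Z z ×-dec (w ≟ˢ (z - x))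
  ; ⊥-member = ⊥ , ⊥-member Z , ⊆-antisym ⊥⊆ (p─q⊆p _ _)
  ; △-member = λ { (z , mz , refl) (w , mw , refl) →
      z △ w , △-member Z mz mw , sym (─-distribʳ-△ z w ⁅ x ⁆) }
  }

∉p-x : {p : Subset n} {x : Fin n} → x ∉ p - x
∉p-x {p = p} {x} x∈ = x∈p─q⇒x∉q p ⁅ x ⁆ x∈ (x∈⁅x⁆ x)

module _ {M : Matroid n} {Z : Space n} (cs : CycleSpace M Z) where

  open CycleSpace cs

  differenceClosed⇒circuitDifference : DifferenceClosed Z → CircuitDifference M
  differenceClosed⇒circuitDifference dc cC cD C≢D ne =
    min⇒circuit cs (dc (circuit⇒min cs cC) (circuit⇒min cs cD) C≢D ne)

  circuitDifference⇒differenceClosed : CircuitDifference M → DifferenceClosed Z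
  circuitDifference⇒differenceClosed cd mC mD C≢D ne =
    circuit⇒min cs (cd (min⇒circuit cs mC) (min⇒circuit cs mD) C≢D ne)

  deletion-cycleSpace : ∀ x → CycleSpace (M ∖ ⁅ x ⁆) (avoid x Z)
  deletion-cycleSpace x = record
    { ⊆ground = λ (mz , x∉z) i∈z → x∈p∧x≢y⇒x∈p-y (⊆ground mz i∈z) λ { refl → x∉z i∈z }
    ; indep⇒  = λ (iI , _) (mz , _) → indep⇒ iI mz
    ; ⇒indep  = λ I⊆ h → ⇒indep (p─q⊆p _ _ ∘ I⊆) (λ mz z⊆I → h (mz , ∉p-x ∘ I⊆ ∘ z⊆I) z⊆I) , I⊆
    }

  -- Contraction is deletion in the dual, whose row space is `Z`, and deleting a column just forgets
  -- one coordinate of every row.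
  contraction-cycleSpace : ∀ x → CycleSpace (M / ⁅ x ⁆) (drop x Z)
  contraction-cycleSpace x = rowSpace⇒dual-cycleSpace record
    { ⊆ground = λ { (z , mz , refl) i∈ → x∈p∧x≢y⇒x∈p-y (⊆ground mz (p─q⊆p z _ i∈)) λ { refl → ∉p-x i∈ } }
    ; indep⇒  = λ (iI , I⊆) i∈I →
        let z , mz , i∈z , z∩I = RowSpace.indep⇒ rs iI i∈I
        in z - x , (z , mz , refl) , x∈p∧x≢y⇒x∈p-y i∈z (λ { refl → ∉p-x (I⊆ i∈I) }) ,
           λ j∈I j∈ → z∩I j∈I (p─q⊆p z _ j∈)
    ; free⇒   = λ I⊆ free → RowSpace.free⇒ rs (p─q⊆p _ _ ∘ I⊆) (λ i∈I →
        let free-i = free i∈I in lift-row I⊆ i∈I free-i) , I⊆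
    }
    where
    rs = cycleSpace⇒dual-rowSpace cs
    lift-row : ∀ {I i} → I ⊆ ground M - x → i ∈ I →
               (∃[ w ] Member (drop x Z) w × i ∈ w × (∀ {j} → j ∈ I → j ∈ w → j ≡ i)) →
               ∃[ z ] Member Z z × i ∈ z × (∀ {j} → j ∈ I → j ∈ z → j ≡ i)
    lift-row I⊆ i∈I (_ , (z , mz , refl) , i∈ , z∩I) = z , mz , p─q⊆p z _ i∈ , λ j∈I j∈z →
      z∩I j∈I (x∈p∧x≢y⇒x∈p-y j∈z λ { refl → ∉p-x (I⊆ j∈I) })

  -- A member with `x` but without `y` would extend the coindependent set `⁅ y ⁆` by `x`, making the
  -- cocircuit coindependent.
  series-pair : ∀ {x y} → x ≢ y → Cocircuit M (⁅ x ⁆ ∪ ⁅ y ⁆) → ∀ {z} → Member Z z → x ∈ z → y ∈ z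
  series-pair {x} {y} x≢y (⊆E , dep , min) {z} mz x∈z = decidable-stable (y ∈? z) λ y∉z →
    dep (subst (CoIndep M) (∪-comm ⁅ y ⁆ ⁅ x ⁆)
      (RowSpace.free⇒ rs (⊆E ∘ subst (_ ∈_) (∪-comm ⁅ y ⁆ ⁅ x ⁆))
        (free-extend Z (RowSpace.indep⇒ rs coindep-y) mz x∈z
          λ j∈ j∈z → y∉z (subst (_∈ z) (x∈⁅y⁆⇒x≡y y j∈) j∈z))))
    where
    rs = cycleSpace⇒dual-rowSpace cs
    coindep-y : CoIndep M ⁅ y ⁆
    coindep-y = min (q⊆p∪q ⁅ x ⁆ ⁅ y ⁆ , x , p⊆p∪q ⁅ y ⁆ (x∈⁅x⁆ x) , x≢y ∘ x∈⁅y⁆⇒x≡y y)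

module _ {Z : Space n} {x y : Fin n} (x≢y : x ≢ y)
         (x⇒y : ∀ {z} → Member Z z → x ∈ z → y ∈ z) (y⇒x : ∀ {z} → Member Z z → y ∈ z → x ∈ z) where

  private
    -- After `x` is dropped, `y` still records whether it was present, so inclusions between members
    -- are not created.
    ⊆-drop : ∀ {z w} → Member Z z → Member Z w → z - x ⊆ w → z ⊆ w
    ⊆-drop mz mw sub {i} i∈z with i ≟ᶠ x
    ... | no i≢x   = sub (x∈p∧x≢y⇒x∈p-y i∈z i≢x)
    ... | yes refl = y⇒x mw (sub (x∈p∧x≢y⇒x∈p-y (x⇒y mz i∈z) (x≢y ∘ sym)))

    -⊆- : ∀ {z w : Subset n} → z ⊆ w → z - x ⊆ w - x
    -⊆- z⊆w i∈ = x∈p∧x≢y⇒x∈p-y (z⊆w (p─q⊆p _ _ i∈)) λ { refl → ∉p-x i∈ }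

    drop-nonempty : ∀ {z} → Member Z z → Nonempty z → Nonempty (z - x)
    drop-nonempty mz (u , u∈z) with u ≟ᶠ x
    ... | no u≢x   = u , x∈p∧x≢y⇒x∈p-y u∈z u≢x
    ... | yes refl = y , x∈p∧x≢y⇒x∈p-y (x⇒y mz u∈z) (x≢y ∘ sym)

    min-drop⁺ : ∀ {z} → Min Z z → Min (drop x Z) (z - x)
    min-drop⁺ {z} (mz , ne , min) = (z , mz , refl) , drop-nonempty mz ne ,
      λ { (w , mw , refl) (i , i∈) sub → -⊆- (min mw (i , p─q⊆p w _ i∈) (⊆-drop mw mz (p─q⊆p z _ ∘ sub))) }

    min-drop⁻ : ∀ {z} → Member Z z → Min (drop x Z) (z - x) → Min Z z
    min-drop⁻ {z} mz (_ , (i , i∈) , min) = mz , (i , p─q⊆p z _ i∈) , λ {D} mD neD D⊆z →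
      ⊆-drop mz mD (p─q⊆p D _ ∘ min (D , mD , refl) (drop-nonempty mD neD) (-⊆- D⊆z))

  drop-differenceClosed⁺ : DifferenceClosed Z → DifferenceClosed (drop x Z)
  drop-differenceClosed⁺ dc mC@((z , mz , refl) , _) mD@((w , mw , refl) , _) C≢D (i , i∈) =
    let i∈C , i∈D = x∈p∩q⁻ _ _ i∈
    in subst (Min (drop x Z)) (─-distribʳ-△ z w ⁅ x ⁆)
      (min-drop⁺ (dc (min-drop⁻ mz mC) (min-drop⁻ mw mD) (C≢D ∘ cong (_- x))
        (i , x∈p∩q⁺ (p─q⊆p z _ i∈C , p─q⊆p w _ i∈D))))

  drop-differenceClosed⁻ : DifferenceClosed (drop x Z) → DifferenceClosed Z
  drop-differenceClosed⁻ dc {z} {w} mC mD C≢D (i , i∈) =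
    min-drop⁻ (△-member Z mz mw) (subst (Min (drop x Z)) (sym (─-distribʳ-△ z w ⁅ x ⁆))
      (dc (min-drop⁺ mC) (min-drop⁺ mD) z-x≢w-x meet))
    where
    mz = proj₁ mC
    mw = proj₁ mD
    z-x≢w-x : z - x ≢ w - x
    z-x≢w-x eq = C≢D (⊆-antisym (⊆-drop mz mw (p─q⊆p w _ ∘ subst (_ ∈_) eq))
                                 (⊆-drop mw mz (p─q⊆p z _ ∘ subst (_ ∈_) (sym eq))))
    meet : Nonempty ((z - x) ∩ (w - x))
    meet with i ≟ᶠ x
    ... | no i≢x = let i∈z , i∈w = x∈p∩q⁻ z w i∈
                   in i , x∈p∩q⁺ (x∈p∧x≢y⇒x∈p-y i∈z i≢x , x∈p∧x≢y⇒x∈p-y i∈w i≢x)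
    ... | yes refl = let i∈z , i∈w = x∈p∩q⁻ z w i∈
                     in y , x∈p∩q⁺ (x∈p∧x≢y⇒x∈p-y (x⇒y mz i∈z) (x≢y ∘ sym)
                                   , x∈p∧x≢y⇒x∈p-y (x⇒y mw i∈w) (x≢y ∘ sym))

avoid-min⁺ : {Z : Space n} {x : Fin n} {C : Subset n} → Min Z C → x ∉ C → Min (avoid x Z) C
avoid-min⁺ (mC , ne , min) x∉C = (mC , x∉C) , ne , λ (mD , _) → min mD

avoid-min⁻ : {Z : Space n} {x : Fin n} {C : Subset n} → Min (avoid x Z) C → Min Z C
avoid-min⁻ ((mC , x∉C) , ne , min) = mC , ne , λ mD neD D⊆C → min (mD , x∉C ∘ D⊆C) neD D⊆C

away⇒avoid-differenceClosed : {E : Subset n} {Z : Space n} {x : Fin n} → x ∈ E → DifferenceClosed-away E Z →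
                              DifferenceClosed (avoid x Z)
away⇒avoid-differenceClosed {Z = Z} {x} x∈E away mC@((_ , x∉C) , _) mD@((_ , x∉D) , _) C≢D ne =
  avoid-min⁺ {Z = Z} (away (avoid-min⁻ {Z = Z} {x} mC) (avoid-min⁻ {Z = Z} {x} mD) C≢D ne x∈E x∉C x∉D)
    (∉△-neither x∉C x∉D)

differenceClosed⇒away : {E : Subset n} {Z : Space n} → DifferenceClosed Z → DifferenceClosed-away E Z
differenceClosed⇒away dc mC mD C≢D ne _ _ _ = dc mC mD C≢D ne

step-closed : {M N : Matroid n} {Z : Space n} → CycleSpace M Z → DifferenceClosed Z → SeriesStep M N →
              Σ[ Z′ ∈ Space n ] CycleSpace N Z′ × DifferenceClosed Z′
step-closed {Z = Z} cs dc (deletion {x} x∈E) =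
  avoid x Z , deletion-cycleSpace cs x , away⇒avoid-differenceClosed {Z = Z} x∈E (differenceClosed⇒away {Z = Z} dc)
step-closed {M = M} {Z = Z} cs dc (seriesContraction {x} {y} x≢y co) =
  drop x Z , contraction-cycleSpace cs x ,
  drop-differenceClosed⁺ {Z = Z} x≢y (series-pair cs x≢y co)
    (series-pair cs (x≢y ∘ sym) (subst (Cocircuit M) (∪-comm ⁅ x ⁆ ⁅ y ⁆) co)) dc

seriesMinor-closed : {M N : Matroid n} {Z : Space n} → CycleSpace M Z → DifferenceClosed Z → SeriesMinor M N →
                     CircuitDifference N
seriesMinor-closed cs dc ε = differenceClosed⇒circuitDifference cs dc
seriesMinor-closed {Z = Z} cs dc (s ◅ ss) =
  let Z′ , cs′ , dc′ = step-closed {Z = Z} cs dc s in seriesMinor-closed {Z = Z′} cs′ dc′ ss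

-x≢ : {p : Subset n} {x : Fin n} → x ∈ p → p - x ≢ p
-x≢ {x = x} x∈p eq = ∉p-x (subst (x ∈_) (sym eq) x∈p)

module _ {M : Matroid n} {Z : Space n} (cs : CycleSpace M Z) where

  open CycleSpace cs

  -- Only the first step matters, because the space is difference-closed afterwards and remains so.
  -- That step is a deletion, since a series pair would lie in the same members.
  exceptional⇒excluded : ∀ {e} → Exceptional (ground M) Z e → ExcludedSeriesMinor CircuitDifference M
  exceptional⇒excluded exc =
    exceptional⇒¬differenceClosed ⊆ground exc ∘ circuitDifference⇒differenceClosed cs , minors
    where
    open Exceptional exc
    minors : ∀ N → ProperSeriesMinor M N → CircuitDifference N
    minors N (ε , neq) = contradiction refl neq
    minors N (deletion {x} x∈E ◅ ss , _) =
      seriesMinor-closed (deletion-cycleSpace cs x)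
        (away⇒avoid-differenceClosed {Z = Z} x∈E (exceptional⇒away ⊆ground exc)) ss
    minors N (seriesContraction {x} {y} x≢y co ◅ ss , _) =
      let z , mz , sep = separating (proj₁ co (p⊆p∪q ⁅ y ⁆ (x∈⁅x⁆ x))) (proj₁ co (q⊆p∪q ⁅ x ⁆ ⁅ y ⁆ (x∈⁅x⁆ y))) x≢y
      in contradiction sep [ (λ (x∈z , y∉z) → y∉z (series-pair cs x≢y co mz x∈z))
                           , (λ (x∉z , y∈z) → x∉z (series-pair cs (x≢y ∘ sym)
                               (subst (Cocircuit M) (∪-comm ⁅ x ⁆ ⁅ y ⁆) co) mz y∈z)) ]′

  -- In the dual, whose row space is `Z`, the columns at `x` and `y` are equal, and the given member
  -- through `x` shows that they are not zero.
  parallel⇒series-pair : ∀ {x y} → x ∈ ground M → y ∈ ground M → x ≢ y → (∃[ z ] Member Z z × x ∈ z) →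
    (∀ {z} → Member Z z → x ∈ z → y ∈ z) → (∀ {z} → Member Z z → y ∈ z → x ∈ z) →
    Cocircuit M (⁅ x ⁆ ∪ ⁅ y ⁆)
  parallel⇒series-pair {x} {y} x∈E y∈E x≢y (z₀ , mz₀ , x∈z₀) x⇒y y⇒x = pair⊆E , dep , proper
    where
    rs = cycleSpace⇒dual-rowSpace cs
    x∈pair = p⊆p∪q {p = ⁅ x ⁆} ⁅ y ⁆ (x∈⁅x⁆ x)
    y∈pair = q⊆p∪q ⁅ x ⁆ ⁅ y ⁆ (x∈⁅x⁆ y)
    pair⊆E : ⁅ x ⁆ ∪ ⁅ y ⁆ ⊆ ground M
    pair⊆E = ∪-lub (x∈p⇒⁅x⁆⊆p x∈E) (x∈p⇒⁅x⁆⊆p y∈E)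
    dep : ¬ CoIndep M (⁅ x ⁆ ∪ ⁅ y ⁆)
    dep i = let z , mz , x∈z , z∩ = RowSpace.indep⇒ rs i x∈pair
            in x≢y (sym (z∩ y∈pair (x⇒y mz x∈z)))
    cases : ∀ {i} → i ∈ ⁅ x ⁆ ∪ ⁅ y ⁆ → i ≡ x ⊎ i ≡ y
    cases i∈ = [ inj₁ ∘ x∈⁅y⁆⇒x≡y x , inj₂ ∘ x∈⁅y⁆⇒x≡y y ]′ (x∈p∪q⁻ ⁅ x ⁆ ⁅ y ⁆ i∈)
    i∈z₀ : ∀ {i} → i ≡ x ⊎ i ≡ y → i ∈ z₀
    i∈z₀ (inj₁ refl) = x∈z₀
    i∈z₀ (inj₂ refl) = x⇒y mz₀ x∈z₀
    proper : ∀ {D} → D ⊂ ⁅ x ⁆ ∪ ⁅ y ⁆ → CoIndep M D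
    proper {D} (D⊆ , u , u∈ , u∉D) = RowSpace.free⇒ rs (pair⊆E ∘ D⊆) λ i∈D →
      z₀ , mz₀ , i∈z₀ (cases (D⊆ i∈D)) , λ j∈D _ → equal i∈D j∈D (cases (D⊆ i∈D)) (cases (D⊆ j∈D)) (cases u∈)
      where
      equal : ∀ {i j} → i ∈ D → j ∈ D → i ≡ x ⊎ i ≡ y → j ≡ x ⊎ j ≡ y → u ≡ x ⊎ u ≡ y → j ≡ i
      equal i∈D j∈D (inj₁ refl) (inj₁ refl) _           = refl
      equal i∈D j∈D (inj₂ refl) (inj₂ refl) _           = refl
      equal i∈D j∈D (inj₁ refl) (inj₂ refl) (inj₁ refl) = contradiction i∈D u∉D
      equal i∈D j∈D (inj₁ refl) (inj₂ refl) (inj₂ refl) = contradiction j∈D u∉D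
      equal i∈D j∈D (inj₂ refl) (inj₁ refl) (inj₁ refl) = contradiction j∈D u∉D
      equal i∈D j∈D (inj₂ refl) (inj₁ refl) (inj₂ refl) = contradiction i∈D u∉D

  excluded⇒exceptional : ExcludedSeriesMinor CircuitDifference M → ∃ (Exceptional (ground M) Z)
  excluded⇒exceptional (¬cd , minors) = bad⇒exceptional ⊆ground away bad separating
    where
    away : DifferenceClosed-away (ground M) Z
    away {C} {D} {x} mC mD C≢D ne x∈E x∉C x∉D = avoid-min⁻ {Z = Z} {x = x}
      (circuitDifference⇒differenceClosed (deletion-cycleSpace cs x)
        (minors _ (deletion x∈E ◅ ε , -x≢ x∈E))
        (avoid-min⁺ {Z = Z} mC x∉C) (avoid-min⁺ {Z = Z} mD x∉D) C≢D ne)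
    ¬dc : ¬ DifferenceClosed Z
    ¬dc dc = ¬cd (differenceClosed⇒circuitDifference cs dc)
    bads = bad-exists ¬dc
    bad = proj₂ (proj₂ bads)
    -- A bad pair covers the ground set, so there are no coloops and an unseparated pair is a series
    -- pair.
    covered : ∀ {x} → x ∈ ground M → ∃[ z ] Member Z z × x ∈ z
    covered {x} x∈E with x ∈? proj₁ bads
    ... | yes x∈C₁ = _ , proj₁ (BadPair.min₁ bad) , x∈C₁
    ... | no x∉C₁  = _ , proj₁ (BadPair.min₂ bad) , bad-cover ⊆ground away bad x∈E x∉C₁
    separating : ∀ {x y} → x ∈ ground M → y ∈ ground M → x ≢ y →
                 ∃[ z ] Member Z z × ((x ∈ z × y ∉ z) ⊎ (x ∉ z × y ∈ z))
    separating {x} {y} x∈E y∈E x≢y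
      with anySubset? (λ z → member? Z z ×-dec
             ((x ∈? z ×-dec ¬? (y ∈? z)) ⊎-dec (¬? (x ∈? z) ×-dec y ∈? z)))
    ... | yes sep = sep
    -- Contracting one element of a series pair loses no information, so the difference-closure of
    -- the minor would lift back to `Z`.
    ... | no ¬sep = ⊥-elim (¬dc
      (drop-differenceClosed⁻ {Z = Z} x≢y x⇒y y⇒x
        (circuitDifference⇒differenceClosed (contraction-cycleSpace cs x)
          (minors _ (seriesContraction x≢y (parallel⇒series-pair x∈E y∈E x≢y (covered x∈E) x⇒y y⇒x) ◅ ε
                    , -x≢ x∈E)))))
      where
      x⇒y : ∀ {z} → Member Z z → x ∈ z → y ∈ z
      x⇒y {z} mz x∈z = decidable-stable (y ∈? z) λ y∉z → ¬sep (z , mz , inj₁ (x∈z , y∉z))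
      y⇒x : ∀ {z} → Member Z z → y ∈ z → x ∈ z
      y⇒x {z} mz y∈z = decidable-stable (x ∈? z) λ x∉z → ¬sep (z , mz , inj₂ (x∉z , y∈z))

-- Hyperplanes as complements of minimal rows

module _ {M : Matroid n} {W : Space n} (rs : RowSpace M W) where

  open RowSpace rs

  -- A basis `B` of `H` is one short of the rank, so only one nonzero row vanishes on it, and its
  -- support is everything outside `H`.
  hyperplane⇒min : ∀ {H} → Hyperplane M H → Min W (ground M ─ H)
  hyperplane⇒min {H} ((H⊆E , closed) , corank) = subst (Member W) w≡E─H mw ,
    (x , subst (x ∈_) w≡E─H x∈w) ,
    λ mD neD D⊆ → covers mD neD λ j∈B j∈D → x∈p─q⇒x∉q (ground M) H (D⊆ j∈D) (MaxIn.⊆X mB j∈B)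
    where
    open ℕ.≤-Reasoning
    B = proj₁ (maxIn-exists M H⊆E)
    mB = proj₂ (maxIn-exists M H⊆E)
    iB = MaxIn.indep mB

    extension = extend-within M iB (proj₂ (basis-exists M))
    B⁺ = proj₁ extension
    iB⁺ = proj₁ (proj₁ (proj₂ extension))
    B⊆B⁺ : B ⊆ B⁺
    B⊆B⁺ = proj₁ (proj₂ (proj₂ extension))

    rk≡ : rk M ≡ suc ∣ B ∣
    rk≡ = trans (sym corank) (cong suc (rank≡∣maxIn∣ M mB))

    ∣B⁺∣≡ : ∣ B⁺ ∣ ≡ suc ∣ B ∣
    ∣B⁺∣≡ = trans (sym (rank≡∣maxIn∣ M (basis⇒maxIn M (proj₁ (proj₂ extension))))) rk≡

    new = ∣p∣<∣q∣⇒∃ B B⁺ (ℕ.≤-reflexive (sym ∣B⁺∣≡))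
    x = proj₁ new
    x∉B = proj₂ (proj₂ new)
    row = indep⇒ iB⁺ (proj₁ (proj₂ new))
    w = proj₁ row
    mw = proj₁ (proj₂ row)
    x∈w = proj₁ (proj₂ (proj₂ row))
    w∩B⁺ = proj₂ (proj₂ (proj₂ row))

    independent-over-B : ∀ {k} → k ∈ ground M ─ H → Indep M (B ∪ ⁅ k ⁆)
    independent-over-B {k} k∈ = decidable-stable (indep? M (B ∪ ⁅ k ⁆)) λ ¬i →
      x∈p─q⇒x∉q (ground M) H k∈ (closed (p─q⊆p _ _ k∈)
        (trans (rank≡∣maxIn∣ M record
          { indep = iB
          ; ⊆X = p⊆p∪q ⁅ k ⁆ ∘ MaxIn.⊆X mB
          ; maximal = λ j∈ i → [ (λ j∈H → MaxIn.maximal mB j∈H i) , (λ { refl → contradiction i ¬i }) ]′ (∈∪⁅⁆⁻ j∈)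
          }) (sym (rank≡∣maxIn∣ M mB))))

    -- An element `k` outside `H` missed by `D`, followed by an element `j` of `D`, would extend `B`
    -- by two and exceed the rank.
    covers : ∀ {D} → Member W D → Nonempty D → (∀ {j} → j ∈ B → j ∉ D) → ground M ─ H ⊆ D
    covers {D} mD (j , j∈D) B∩D {k} k∈ = decidable-stable (k ∈? D) λ k∉D →
      let B∪k∩D : ∀ {i} → i ∈ B ∪ ⁅ k ⁆ → i ∉ D
          B∪k∩D i∈ i∈D = [ (λ i∈B → B∩D i∈B i∈D) , (λ { refl → k∉D i∈D }) ]′ (∈∪⁅⁆⁻ i∈)
          iB∪k = independent-over-B k∈
          iB∪k∪j : Indep M ((B ∪ ⁅ k ⁆) ∪ ⁅ j ⁆)
          iB∪k∪j = free⇒ (∪-lub (indep⊆ground M iB∪k) (x∈p⇒⁅x⁆⊆p (⊆ground mD j∈D)))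
                     (free-extend W (indep⇒ iB∪k) mD j∈D B∪k∩D)
      in ℕ.<-irrefl refl (begin-strict
           suc ∣ B ∣                    ≡⟨ ∣p∪⁅x⁆∣≡1+∣p∣ B (x∈p─q⇒x∉q (ground M) H k∈ ∘ MaxIn.⊆X mB) ⟨
           ∣ B ∪ ⁅ k ⁆ ∣                <⟨ ℕ.≤-reflexive (sym (∣p∪⁅x⁆∣≡1+∣p∣ (B ∪ ⁅ k ⁆) (λ j∈ → B∪k∩D j∈ j∈D))) ⟩
           ∣ (B ∪ ⁅ k ⁆) ∪ ⁅ j ⁆ ∣      ≤⟨ indep≤rank M iB∪k∪j (indep⊆ground M iB∪k∪j) ⟩
           rk M                         ≡⟨ rk≡ ⟩
           suc ∣ B ∣                    ∎)

    B∩w : ∀ {j} → j ∈ B → j ∉ w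
    B∩w j∈B j∈w = x∉B (subst (_∈ B) (w∩B⁺ (B⊆B⁺ j∈B) j∈w) j∈B)

    w≡E─H : w ≡ ground M ─ H
    w≡E─H = ⊆-antisym
      (λ j∈w → x∈p∧x∉q⇒x∈p─q (⊆ground mw j∈w) λ j∈H → vanish rs H⊆E mB mw B∩w j∈H j∈w)
      (covers mw (x , x∈w) B∩w)

  -- A basis `B` of the complement together with one `d ∈ D` is a basis of `M`: otherwise some
  -- nonzero row would vanish on `B ∪ ⁅ d ⁆`, hence lie in `D` without `d`, against minimality.
  min⇒hyperplane : ∀ {D} → Min W D → Hyperplane M (ground M ─ D)
  min⇒hyperplane {D} (mD , (d , d∈D) , min) = (H⊆E , closed) , (begin-equality
      suc (rank M H)   ≡⟨ cong suc (rank≡∣maxIn∣ M mB) ⟩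
      suc ∣ B ∣        ≡⟨ ∣p∪⁅x⁆∣≡1+∣p∣ B (λ d∈B → B∩D d∈B d∈D) ⟨
      ∣ B ∪ ⁅ d ⁆ ∣    ≡⟨ rank≡∣maxIn∣ M mB∪d ⟨
      rk M             ∎)
    where
    open ℕ.≤-Reasoning
    H = ground M ─ D
    H⊆E : H ⊆ ground M
    H⊆E = p─q⊆p _ _
    B = proj₁ (maxIn-exists M H⊆E)
    mB = proj₂ (maxIn-exists M H⊆E)
    iB = MaxIn.indep mB

    B∩D : ∀ {j} → j ∈ B → j ∉ D
    B∩D j∈B = x∈p─q⇒x∉q (ground M) D (MaxIn.⊆X mB j∈B)

    independent-over-B : ∀ {k} → k ∈ D → Indep M (B ∪ ⁅ k ⁆)
    independent-over-B k∈D = free⇒ (∪-lub (indep⊆ground M iB) (x∈p⇒⁅x⁆⊆p (⊆ground mD k∈D)))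
      (free-extend W (indep⇒ iB) mD k∈D B∩D)

    mB∪d : MaxIn M (ground M) (B ∪ ⁅ d ⁆)
    mB∪d = record
      { indep = independent-over-B d∈D
      ; ⊆X = indep⊆ground M (independent-over-B d∈D)
      ; maximal = λ {x} x∈E i → decidable-stable (x ∈? B ∪ ⁅ d ⁆) λ x∉ →
          let w , mw , x∈w , w∩ = indep⇒ i (x∈p∪⁅x⁆ (B ∪ ⁅ d ⁆))
              B∪d∩w : ∀ {j} → j ∈ B ∪ ⁅ d ⁆ → j ∉ w
              B∪d∩w j∈ j∈w = x∉ (subst (_∈ B ∪ ⁅ d ⁆) (w∩ (p⊆p∪q ⁅ x ⁆ j∈) j∈w) j∈)
              w⊆D : w ⊆ D
              w⊆D {j} j∈w = decidable-stable (j ∈? D) λ j∉D →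
                vanish rs H⊆E mB mw (B∪d∩w ∘ p⊆p∪q ⁅ d ⁆) (x∈p∧x∉q⇒x∈p─q (⊆ground mw j∈w) j∉D) j∈w
          in B∪d∩w (x∈p∪⁅x⁆ B) (min mw (x , x∈w) w⊆D d∈D)
      }

    closed : ∀ {e} → e ∈ ground M → rank M (H ∪ ⁅ e ⁆) ≡ rank M H → e ∈ H
    closed {e} e∈E eq = x∈p∧x∉q⇒x∈p─q e∈E λ e∈D → ℕ.<-irrefl refl (begin-strict
      ∣ B ∣               <⟨ ℕ.≤-reflexive (sym (∣p∪⁅x⁆∣≡1+∣p∣ B (λ e∈B → B∩D e∈B e∈D))) ⟩
      ∣ B ∪ ⁅ e ⁆ ∣       ≤⟨ indep≤rank M (independent-over-B e∈D)
                              (∪-lub (p⊆p∪q ⁅ e ⁆ ∘ MaxIn.⊆X mB) (q⊆p∪q H ⁅ e ⁆)) ⟩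
      rank M (H ∪ ⁅ e ⁆)  ≡⟨ eq ⟩
      rank M H            ≡⟨ rank≡∣maxIn∣ M mB ⟩
      ∣ B ∣               ∎)

-- Linear functionals over GF(2)

ev : Subset k → (Fin k → Bool) → Bool
ev y b = sum (λ i → lookup y i ∧ b i)

ev-cong : (y : Subset k) {b c : Fin k → Bool} → (∀ i → b i ≡ c i) → ev y b ≡ ev y c
ev-cong y eq = sum-cong-≗ λ i → cong (lookup y i ∧_) (eq i)

ev-△ : (y z : Subset k) (b : Fin k → Bool) → ev (y △ z) b ≡ ev y b xor ev z b
ev-△ y z b = trans
  (sum-cong-≗ λ i → trans (cong (_∧ b i) (lookup-zipWith _xor_ i y z)) (∧-distribʳ-xor (b i) (lookup y i) (lookup z i)))
  (∑-distrib-+ (λ i → lookup y i ∧ b i) (λ i → lookup z i ∧ b i))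

ev-xor : (y : Subset k) (b c : Fin k → Bool) → ev y (λ i → b i xor c i) ≡ ev y b xor ev y c
ev-xor y b c = trans (sum-cong-≗ λ i → ∧-distribˡ-xor (lookup y i) (b i) (c i))
  (∑-distrib-+ (λ i → lookup y i ∧ b i) (λ i → lookup y i ∧ c i))

ev-zeroʳ : (y : Subset k) → ev y (λ _ → false) ≡ false
ev-zeroʳ {k} y = trans (sum-cong-≗ λ i → ∧-zeroʳ (lookup y i)) (sum-replicate-zero k)

ev-⊥ : (b : Fin k → Bool) → ev ⊥ b ≡ false
ev-⊥ {k} b = trans (sum-cong-≗ λ i → cong (_∧ b i) (lookup-replicate i false)) (sum-replicate-zero k)

ev-scale : (y : Subset k) (b : Fin k → Bool) (s : Bool) → ev y (λ i → b i ∧ s) ≡ ev y b ∧ s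
ev-scale y b true  = trans (ev-cong y λ i → ∧-identityʳ (b i)) (sym (∧-identityʳ _))
ev-scale y b false = trans (trans (ev-cong y λ i → ∧-zeroʳ (b i)) (ev-zeroʳ y)) (sym (∧-zeroʳ _))

ev-⁅⁆ : (i : Fin k) (b : Fin k → Bool) → ev ⁅ i ⁆ b ≡ b i
ev-⁅⁆ zero    b = trans (cong (b zero xor_) (ev-⊥ (b ∘ suc))) (trans (xor-comm (b zero) false) (xor-identityˡ _))
ev-⁅⁆ (suc i) b = ev-⁅⁆ i (b ∘ suc)

col : Matrix k n → Fin n → Fin k → Bool
col A j i = A i j

mul : Matrix k n → Subset n → Fin k → Bool
mul A c i = sum (λ j → A i j ∧ lookup c j)

mul≡ev : (A : Matrix k n) (c : Subset n) (i : Fin k) → mul A c i ≡ ev c (A i)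
mul≡ev A c i = sum-cong-≗ λ j → ∧-comm (A i j) (lookup c j)

∧-sum : ∀ {m} (s : Bool) (f : Fin m → Bool) → s ∧ sum f ≡ sum (λ j → s ∧ f j)
∧-sum true  f = refl
∧-sum {m} false f = sym (sum-replicate-zero m)

ev-mul : (A : Matrix k n) (y : Subset k) (c : Subset n) → ev y (mul A c) ≡ ev c (λ j → ev y (col A j))
ev-mul {k} {n} A y c = begin
  sum (λ i → lookup y i ∧ sum (λ j → A i j ∧ lookup c j))
    ≡⟨ sum-cong-≗ (λ i → ∧-sum (lookup y i) (λ j → A i j ∧ lookup c j)) ⟩
  sum (λ i → sum (λ j → lookup y i ∧ (A i j ∧ lookup c j)))
    ≡⟨ ∑-comm (λ i j → lookup y i ∧ (A i j ∧ lookup c j)) ⟩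
  sum (λ j → sum (λ i → lookup y i ∧ (A i j ∧ lookup c j)))
    ≡⟨ sum-cong-≗ (λ j → trans
         (sum-cong-≗ λ i → trans (sym (∧-assoc (lookup y i) (A i j) (lookup c j))) (∧-comm _ (lookup c j)))
         (sym (∧-sum (lookup c j) (λ i → lookup y i ∧ A i j)))) ⟩
  ev c (λ j → ev y (col A j)) ∎
  where open ≡-Reasoning

Solution : Matrix k n → Subset n → (Fin k → Bool) → Set
Solution A S b = ∃[ c ] c ⊆ S × (∀ i → mul A c i ≡ b i)

Separator : Matrix k n → Subset n → (Fin k → Bool) → Set
Separator A S b = ∃[ y ] (∀ {j} → j ∈ S → ev y (col A j) ≡ false) × ev y b ≡ true

-- The Fredholm alternative over GF(2), by induction on the columns. If a separator `y` for the
-- later columns is one on the first column, the first column is moved to the right-hand side.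
solve-or-separate : (A : Matrix k n) (S : Subset n) (b : Fin k → Bool) → Solution A S b ⊎ Separator A S b
solve-or-separate {n = zero} A [] b with any? (λ i → b i ≟ᵇ true)
... | yes (i , bi) = inj₂ (⁅ i ⁆ , (λ ()) , trans (ev-⁅⁆ i b) bi)
... | no ¬h        = inj₁ ([] , (λ ()) , λ i → sym (¬-not λ bi → ¬h (i , bi)))
solve-or-separate {n = suc n} A (outside ∷ S) b with solve-or-separate (λ i → A i ∘ suc) S b
... | inj₁ (c , c⊆S , eq) = inj₁ (outside ∷ c , out⊆ c⊆S , λ i →
        trans (cong (_xor mul (λ i → A i ∘ suc) c i) (∧-zeroʳ (A i zero))) (eq i))
... | inj₂ (y , y⊥S , yb) = inj₂ (y , (λ { (there j∈S) → y⊥S j∈S }) , yb)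
solve-or-separate {n = suc n} A (inside ∷ S) b with solve-or-separate (λ i → A i ∘ suc) S b
... | inj₁ (c , c⊆S , eq) = inj₁ (outside ∷ c , out⊆ c⊆S , λ i →
        trans (cong (_xor mul (λ i → A i ∘ suc) c i) (∧-zeroʳ (A i zero))) (eq i))
... | inj₂ (y , y⊥S , yb) with ev y (col A zero) in ya
...   | false = inj₂ (y , (λ { here → ya ; (there j∈S) → y⊥S j∈S }) , yb)
...   | true with solve-or-separate (λ i → A i ∘ suc) S (λ i → A i zero xor b i)
...     | inj₁ (c , c⊆S , eq) = inj₁ (inside ∷ c , s⊆s c⊆S , λ i →
            trans (cong₂ _xor_ (∧-identityʳ (A i zero)) (eq i))
              (trans (sym (xor-assoc (A i zero) (A i zero) (b i)))
                (cong (_xor b i) (xor-same (A i zero)))))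
...     | inj₂ (z , z⊥S , zab) with ev z (col A zero) in za
...       | false = inj₂ (z , (λ { here → za ; (there j∈S) → z⊥S j∈S }) ,
              trans (sym (trans (ev-xor z (col A zero) b) (cong (_xor ev z b) za))) zab)
-- Here `z` is one on the first column and zero on `b`, while `y` is one on both.
...       | true  = inj₂ (y △ z
              , (λ { here → trans (ev-△ y z (col A zero)) (cong₂ _xor_ ya za)
                   ; (there {i = j} j∈S) → trans (ev-△ y z _) (cong₂ _xor_ (y⊥S j∈S) (z⊥S j∈S)) })
              , trans (ev-△ y z b) (cong₂ _xor_ yb zb))
  where
  zb : ev z b ≡ false
  zb = ¬-not λ zb≡true → not-¬ zab
    (trans (ev-xor z (col A zero) b) (cong₂ _xor_ za zb≡true))

Dual : Matrix k n → Subset n → Set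
Dual A I = ∀ {i} → i ∈ I → ∃[ y ] ev y (col A i) ≡ true × (∀ {j} → j ∈ I → ev y (col A j) ≡ true → j ≡ i)

-- Either a functional separates column `i` from the rest of `I`, or column `i` is a combination of
-- the rest, which is a dependency.
linIndep⇒dual : (A : Matrix k n) {I : Subset n} → LinIndep A I → Dual A I
linIndep⇒dual A {I} li {i} i∈I with solve-or-separate A (I - i) (col A i)
... | inj₂ (y , y⊥ , yi) = y , yi , λ {j} j∈I yj → decidable-stable (j ≟ᶠ i) λ j≢i →
        not-¬ (y⊥ (x∈p∧x≢y⇒x∈p-y j∈I j≢i)) yj
... | inj₁ (c , c⊆ , eq) = contradiction
        (li {c △ ⁅ i ⁆} (△-⊆ (p─q⊆p I _ ∘ c⊆) (x∈p⇒⁅x⁆⊆p i∈I)) null)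
        (Nonempty⇒≢⊥ (i , ∈△ʳ (λ i∈c → x∈p─q⇒x∉q I ⁅ i ⁆ (c⊆ i∈c) (x∈⁅x⁆ i)) (x∈⁅x⁆ i)))
  where
  null : Null A (c △ ⁅ i ⁆)
  null r = begin
    mul A (c △ ⁅ i ⁆) r               ≡⟨ mul≡ev A (c △ ⁅ i ⁆) r ⟩
    ev (c △ ⁅ i ⁆) (A r)              ≡⟨ ev-△ c ⁅ i ⁆ (A r) ⟩
    ev c (A r) xor ev ⁅ i ⁆ (A r)     ≡⟨ cong₂ _xor_ (trans (sym (mul≡ev A c r)) (eq r)) (ev-⁅⁆ i (A r)) ⟩
    A r i xor A r i                   ≡⟨ xor-same (A r i) ⟩
    false                             ∎
    where open ≡-Reasoning

-- Applied to a dependency through `i`, the functional dual to `i` kills every term but that of `i`,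
-- giving one instead of zero.
dual⇒linIndep : (A : Matrix k n) {I : Subset n} → Dual A I → LinIndep A I
dual⇒linIndep A {I} dual {c} c⊆I c0 = Empty-unique λ (i , i∈c) →
  let y , yi , yI = dual (c⊆I i∈c)
      agree : ∀ j → lookup c j ∧ ev y (col A j) ≡ lookup ⁅ i ⁆ j ∧ ev y (col A j)
      agree j = case j {y = y} i∈c yI
  in not-¬ (trans (ev-cong y c0) (ev-zeroʳ y))
       (trans (ev-mul A y c) (trans (sum-cong-≗ agree) (trans (ev-⁅⁆ i _) yi)))
  where
  case : ∀ j {i y} → i ∈ c → (∀ {j} → j ∈ I → ev y (col A j) ≡ true → j ≡ i) →
         lookup c j ∧ ev y (col A j) ≡ lookup ⁅ i ⁆ j ∧ ev y (col A j)
  case j {i} {y} i∈c yI with ev y (col A j) in yj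
  ... | false = trans (∧-zeroʳ _) (sym (∧-zeroʳ _))
  ... | true with lookup c j in cj | lookup ⁅ i ⁆ j in ij
  ...   | true  | true  = refl
  ...   | false | false = refl
  ...   | true  | false with refl ← yI (c⊆I (lookup⇒[]= j c cj)) yj =
            contradiction (trans (sym ij) ([]=⇒lookup (x∈⁅x⁆ i))) λ ()
  ...   | false | true  with refl ← x∈⁅y⁆⇒x≡y i (lookup⇒[]= j ⁅ i ⁆ ij) =
            contradiction (trans (sym cj) ([]=⇒lookup i∈c)) λ ()

∧-xor≢true : ∀ a b {s} → s ≡ true → (a ∧ s) xor b ≢ true → b ≡ a
∧-xor≢true false false refl _  = refl
∧-xor≢true true  true  refl _  = refl
∧-xor≢true false true  refl ne = contradiction refl ne
∧-xor≢true true  false refl ne = contradiction refl ne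

-- Gaussian elimination of the first row, with pivot p.
dual⇒∣I∣≤k : (A : Matrix k n) {I : Subset n} → Dual A I → ∣ I ∣ ≤ k
dual⇒∣I∣≤k {zero} {n} A {I} dual = ℕ.≤-reflexive
  (trans (cong ∣_∣ (Empty-unique λ (i , i∈I) → empty (dual i∈I))) (∣⊥∣≡0 n))
  where
  empty : ∀ {i} → ¬ (∃[ y ] ev y (col A i) ≡ true × (∀ {j} → j ∈ I → ev y (col A j) ≡ true → j ≡ i))
  empty ([] , () , _)
dual⇒∣I∣≤k {suc k} A {I} dual with any? (λ p → (p ∈? I) ×-dec (A zero p ≟ᵇ true))
... | no ¬h = ℕ.m≤n⇒m≤1+n (dual⇒∣I∣≤k (A ∘ suc) dual′)
  where
  tail-ev : ∀ {j} y₀ (y : Subset k) → j ∈ I → ev (y₀ ∷ y) (col A j) ≡ ev y (col (A ∘ suc) j)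
  tail-ev {j} y₀ y j∈I = cong (_xor ev y (col (A ∘ suc) j))
    (trans (cong (y₀ ∧_) (¬-not λ aj → ¬h (j , j∈I , aj))) (∧-zeroʳ y₀))
  dual′ : Dual (A ∘ suc) I
  dual′ i∈I with dual i∈I
  ... | y₀ ∷ y , yi , yI = y , trans (sym (tail-ev y₀ y i∈I)) yi , λ j∈I yj → yI j∈I (trans (tail-ev y₀ y j∈I) yj)
... | yes (p , p∈I , ap) = ℕ.≤-trans (∣p∣≤1+∣p-x∣ I p) (s≤s (dual⇒∣I∣≤k A′ dual′))
  where
  A′ : Matrix k _
  A′ i j = A (suc i) j xor (A (suc i) p ∧ A zero j)
  dual′ : Dual A′ (I - p)
  dual′ {i} i∈ with dual (p─q⊆p I _ i∈)
  ... | y₀ ∷ y , yi , yI = y , trans (same i) yi , λ {j} j∈ yj → yI (p─q⊆p I _ j∈) (trans (sym (same j)) yj)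
    where
    open ≡-Reasoning
    -- The functional dual to `i` is zero at `p ≢ i`; as the pivot entry is one, this determines its
    -- first coordinate.
    y₀≡ : ev y (col (A ∘ suc) p) ≡ y₀
    y₀≡ = ∧-xor≢true y₀ _ ap λ yp → ∉p-x (subst (_∈ I - p) (sym (yI p∈I yp)) i∈)
    same : ∀ j → ev y (col A′ j) ≡ ev (y₀ ∷ y) (col A j)
    same j = begin
      ev y (col A′ j)
        ≡⟨ ev-xor y (col (A ∘ suc) j) (λ i → A (suc i) p ∧ A zero j) ⟩
      ev y (col (A ∘ suc) j) xor ev y (λ i → A (suc i) p ∧ A zero j)
        ≡⟨ cong (ev y (col (A ∘ suc) j) xor_)
             (trans (ev-scale y (col (A ∘ suc) p) (A zero j)) (cong (_∧ A zero j) y₀≡)) ⟩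
      ev y (col (A ∘ suc) j) xor (y₀ ∧ A zero j)
        ≡⟨ xor-comm (ev y (col (A ∘ suc) j)) (y₀ ∧ A zero j) ⟩
      ev (y₀ ∷ y) (col A j) ∎

module _ (A : Matrix k n) (E : Subset n) where

  supp : Subset k → Subset n
  supp y = tabulate λ x → lookup E x ∧ ev y (col A x)

  lookup-supp : ∀ y x → lookup (supp y) x ≡ lookup E x ∧ ev y (col A x)
  lookup-supp y x = lookup∘tabulate _ x

  ∈supp⁺ : ∀ y {x} → x ∈ E → ev y (col A x) ≡ true → x ∈ supp y
  ∈supp⁺ y {x} x∈E yx = lookup⇒[]= x (supp y) (trans (lookup-supp y x) (cong₂ _∧_ ([]=⇒lookup x∈E) yx))

  ∈supp⁻ : ∀ y {x} → x ∈ supp y → x ∈ E × ev y (col A x) ≡ true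
  ∈supp⁻ y {x} x∈ with lookup E x in ex | ev y (col A x) in yx | trans (sym (lookup-supp y x)) ([]=⇒lookup x∈)
  ... | true | true | _ = lookup⇒[]= x E ex , refl

  supp-△ : ∀ y z → supp y △ supp z ≡ supp (y △ z)
  supp-△ y z = ⊆-antisym
    (λ {x} x∈ → [ (λ (x∈y , x∉z) → let x∈E , yx = ∈supp⁻ y x∈y in
                     ∈supp⁺ (y △ z) x∈E (trans (ev-△ y z (col A x))
                       (cong₂ _xor_ yx (¬-not λ zx → x∉z (∈supp⁺ z x∈E zx)))))
                , (λ (x∉y , x∈z) → let x∈E , zx = ∈supp⁻ z x∈z in
                     ∈supp⁺ (y △ z) x∈E (trans (ev-△ y z (col A x))
                       (cong₂ _xor_ (¬-not λ yx → x∉y (∈supp⁺ y x∈E yx)) zx))) ]′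
                (x∈p△q⁻ (supp y) (supp z) x∈))
    (λ {x} x∈ → let x∈E , yzx = ∈supp⁻ (y △ z) x∈ in
      back x∈E (trans (sym (ev-△ y z (col A x))) yzx))
    where
    back : ∀ {x} → x ∈ E → ev y (col A x) xor ev z (col A x) ≡ true → x ∈ supp y △ supp z
    back {x} x∈E eq with ev y (col A x) in yx | ev z (col A x) in zx
    ... | true  | false = ∈△ˡ (∈supp⁺ y x∈E yx) λ x∈z → not-¬ (proj₂ (∈supp⁻ z x∈z)) zx
    ... | false | true  = ∈△ʳ (λ x∈y → not-¬ (proj₂ (∈supp⁻ y x∈y)) yx) (∈supp⁺ z x∈E zx)

  supp-⊥ : supp ⊥ ≡ ⊥
  supp-⊥ = Empty-unique λ (x , x∈) → not-¬ (proj₂ (∈supp⁻ ⊥ x∈)) (ev-⊥ (col A x))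

  rows : Space n
  rows = record
    { Member   = λ w → ∃[ y ] w ≡ supp y
    ; member?  = λ w → anySubset? λ y → w ≟ˢ supp y
    ; ⊥-member = ⊥ , sym supp-⊥
    ; △-member = λ { (y , refl) (z , refl) → y △ z , supp-△ y z }
    }

  free⇒dual : ∀ {I} → I ⊆ E → Free rows I → Dual A I
  free⇒dual I⊆E free i∈I with free i∈I
  ... | _ , (y , refl) , i∈ , only = y , proj₂ (∈supp⁻ y i∈) , λ j∈I yj → only j∈I (∈supp⁺ y (I⊆E j∈I) yj)

  dual⇒free : ∀ {I} → I ⊆ E → Dual A I → Free rows I
  dual⇒free I⊆E dual i∈I =
    let y , yi , only = dual i∈I
    in supp y , (y , refl) , ∈supp⁺ y (I⊆E i∈I) yi , λ j∈I j∈ → only j∈I (proj₂ (∈supp⁻ y j∈))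

module _ {M : Matroid n} (A : Matrix k n)
         (represents : ∀ {I} → I ⊆ ground M → Indep M I ⇔ LinIndep A I) where

  represented⇒rowSpace : RowSpace M (rows A (ground M))
  represented⇒rowSpace = record
    { ⊆ground = λ { (y , refl) x∈ → proj₁ (∈supp⁻ A (ground M) y x∈) }
    ; indep⇒  = λ {I} iI → dual⇒free A (ground M) (indep⊆ground M iI)
        (linIndep⇒dual A (Equivalence.to (represents (indep⊆ground M iI)) iI))
    ; free⇒   = λ I⊆ free → Equivalence.from (represents I⊆) (dual⇒linIndep A (free⇒dual A (ground M) I⊆ free))
    }

  nullSpace : Space n
  nullSpace = record
    { Member   = λ z → z ⊆ ground M × Null A z
    ; member?  = λ z → (z ⊆? ground M) ×-dec all? (λ i → _ ≟ᵇ false)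
    ; ⊥-member = ⊥⊆ , null-⊥ A
    ; △-member = λ {p} {q} (p⊆ , p0) (q⊆ , q0) → △-⊆ p⊆ q⊆ , null-△ A {p} {q} p0 q0
    }

  represented⇒cycleSpace : CycleSpace M nullSpace
  represented⇒cycleSpace = record
    { ⊆ground = proj₁
    ; indep⇒  = λ iI (_ , z0) z⊆I → Equivalence.to (represents (indep⊆ground M iI)) iI z⊆I z0
    ; ⇒indep  = λ I⊆ h → Equivalence.from (represents I⊆) λ c⊆I c0 → h (I⊆ ∘ c⊆I , c0) c⊆I
    }

-- Projective and affine geometries

Represents : Matrix k n → Matroid n → Set
Represents A M = ∀ {I} → I ⊆ ground M → Indep M I ⇔ LinIndep A I

represents-M[] : (A : Matrix k n) → Represents A M[ A ]
represents-M[] A _ = mk⇔ id id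

represents-∖ : {A : Matrix k n} {M : Matroid n} → Represents A M → ∀ X → Represents A (M ∖ X)
represents-∖ {A = A} rep X {I} I⊆ = mk⇔
  (λ (iI , _) → Equivalence.to (rep (p─q⊆p _ X ∘ I⊆)) iI)
  (λ (li : LinIndep A I) → Equivalence.from (rep (p─q⊆p _ X ∘ I⊆)) (λ {c} → li {c}) , λ {x} → I⊆ {x})

represents-PG : ∀ r → Represents (allVectors r) (PG r)
represents-PG r = represents-∖ {M = M[ allVectors r ]} (represents-M[] (allVectors r)) ⁅ zeroVector r ⁆

vector : ∀ {r} → (Fin r → Bool) → Fin (2 ^ r)
vector b = funToFin (Inverse.from 2↔Bool ∘ b)

col-vector : ∀ {r} (b : Fin r → Bool) i → col (allVectors r) (vector b) i ≡ b i
col-vector b i = trans (cong (Inverse.to 2↔Bool) (finToFun-funToFin (Inverse.from 2↔Bool ∘ b) i))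
  (Inverse.strictlyInverseˡ 2↔Bool (b i))

funToFin-cong : ∀ {r m} {f g : Fin r → Fin m} → (∀ i → f i ≡ g i) → funToFin f ≡ funToFin g
funToFin-cong {zero}  eq = refl
funToFin-cong {suc r} eq = cong₂ combine (eq zero) (funToFin-cong (eq ∘ suc))

col-injective : ∀ {r} {j j′ : Fin (2 ^ r)} →
                (∀ i → col (allVectors r) j i ≡ col (allVectors r) j′ i) → j ≡ j′
col-injective {r} {j} {j′} eq = begin
  j                             ≡⟨ funToFin-finToFin {r} j ⟨
  funToFin {r} (finToFun j)     ≡⟨ funToFin-cong (λ i → trans (sym (Inverse.strictlyInverseʳ 2↔Bool _))
                                     (trans (cong (Inverse.from 2↔Bool) (eq i)) (Inverse.strictlyInverseʳ 2↔Bool _))) ⟩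
  funToFin {r} (finToFun j′)    ≡⟨ funToFin-finToFin {r} j′ ⟩
  j′                            ∎
  where open ≡-Reasoning

col-zeroVector : ∀ r i → col (allVectors r) (zeroVector r) i ≡ false
col-zeroVector r i = cong (Inverse.to 2↔Bool) (finToFun-funToFin {r} (λ _ → zero) i)

module _ {m : ℕ} (f : Fin n → Fin m) where

  preimage? : ∀ I j → Dec (∃[ x ] x ∈ I × f x ≡ j)
  preimage? I j = any? λ x → (x ∈? I) ×-dec (f x ≟ᶠ j)

  image : Subset n → Subset m
  image I = tabulate λ j → does (preimage? I j)

  ∈image⁺ : ∀ {I x} → x ∈ I → f x ∈ image I
  ∈image⁺ {I} {x} x∈I = lookup⇒[]= (f x) (image I)
    (trans (lookup∘tabulate _ (f x)) (dec-true (preimage? I (f x)) (x , x∈I , refl)))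

  ∈image⁻ : ∀ {I j} → j ∈ image I → ∃[ x ] x ∈ I × f x ≡ j
  ∈image⁻ {I} {j} j∈ = decidable-stable (preimage? I j) λ ¬h →
    not-¬ (dec-false (preimage? I j) ¬h) (trans (sym (lookup∘tabulate _ j)) ([]=⇒lookup j∈))

  ∣I∣≤∣image∣ : ∀ {I} → (∀ {x y} → x ∈ I → y ∈ I → f x ≡ f y → x ≡ y) → ∣ I ∣ ≤ ∣ image I ∣
  ∣I∣≤∣image∣ {I} = go ∣ I ∣ ℕ.≤-refl
    where
    open ℕ.≤-Reasoning
    go : ∀ d {I} → ∣ I ∣ ≤ d → (∀ {x y} → x ∈ I → y ∈ I → f x ≡ f y → x ≡ y) → ∣ I ∣ ≤ ∣ image I ∣
    go zero    ≤0 _ = ℕ.≤-trans ≤0 z≤n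
    go (suc d) {I} ≤d inj with nonempty? I
    ... | no ¬ne rewrite Empty-unique ¬ne | ∣⊥∣≡0 n = z≤n
    ... | yes (x , x∈I) = begin
      ∣ I ∣                     ≤⟨ ∣p∣≤1+∣p-x∣ I x ⟩
      suc ∣ I - x ∣             ≤⟨ s≤s (go d (s≤s⁻¹ (ℕ.≤-trans (x∈p⇒∣p-x∣<∣p∣ x∈I) ≤d))
                                     λ a∈ b∈ → inj (p─q⊆p I _ a∈) (p─q⊆p I _ b∈)) ⟩
      suc ∣ image (I - x) ∣     ≤⟨ s≤s (p⊆q⇒∣p∣≤∣q∣ image⊆) ⟩
      suc ∣ image I - f x ∣     ≤⟨ x∈p⇒∣p-x∣<∣p∣ (∈image⁺ x∈I) ⟩
      ∣ image I ∣               ∎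
      where
      image⊆ : image (I - x) ⊆ image I - f x
      image⊆ j∈ with ∈image⁻ j∈
      ... | y , y∈ , refl = x∈p∧x≢y⇒x∈p-y (∈image⁺ (p─q⊆p I _ y∈))
              λ eq → ∉p-x (subst (_∈ I - x) (inj (p─q⊆p I _ y∈) x∈I eq) y∈)

  dual-image⁺ : (A : Matrix k m) {I : Subset n} {J : Subset m} → (∀ {x} → x ∈ I → f x ∈ J) →
                (∀ {j} → j ∈ J → ∃[ x ] x ∈ I × f x ≡ j) → Dual (λ i → A i ∘ f) I → Dual A J
  dual-image⁺ A {I} {J} I→J J→I dual j∈J with J→I j∈J
  ... | x , x∈I , refl with dual x∈I
  ...   | y , yx , only = y , yx , λ {j′} j′∈J yj′ → unique (J→I j′∈J) yj′
    where
    unique : ∀ {j′} → (∃[ x′ ] x′ ∈ I × f x′ ≡ j′) → ev y (col A j′) ≡ true → j′ ≡ f x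
    unique (x′ , x′∈I , refl) yj′ = cong f (only x′∈I yj′)

  dual-image⁻ : (A : Matrix k m) {I : Subset n} {J : Subset m} → (∀ {x} → x ∈ I → f x ∈ J) →
                (∀ {x y} → x ∈ I → y ∈ I → f x ≡ f y → x ≡ y) → Dual A J → Dual (λ i → A i ∘ f) I
  dual-image⁻ A I→J inj dual x∈I =
    let y , yx , only = dual (I→J x∈I)
    in y , yx , λ x′∈I yx′ → inj x′∈I x∈I (only (I→J x′∈I) yx′)

-- On an affine set the constant one is a functional, so the complement of a support is again a
-- support.
supp-complement : (A : Matrix k n) (E : Subset n) {η : Subset k} → (∀ {x} → x ∈ E → ev η (col A x) ≡ true) →
                  ∀ y → supp A E (y △ η) ≡ E ─ supp A E y
supp-complement A E {η} η-true y = trans (sym (supp-△ A E y η)) (trans (△-comm _ _)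
  (trans (cong (_△ supp A E y) η≡E) (⊆⇒△≡─ (proj₁ ∘ ∈supp⁻ A E y))))
  where
  η≡E : supp A E η ≡ E
  η≡E = ⊆-antisym (proj₁ ∘ ∈supp⁻ A E η) (λ x∈E → ∈supp⁺ A E η x∈E (η-true x∈E))

supp-cong : (A : Matrix k n) (E : Subset n) (y z : Subset k) →
            (∀ {x} → x ∈ E → ev y (col A x) ≡ ev z (col A x)) → supp A E y ≡ supp A E z
supp-cong A E y z eq = ⊆-antisym
  (λ x∈ → let x∈E , yx = ∈supp⁻ A E y x∈ in ∈supp⁺ A E z x∈E (trans (sym (eq x∈E)) yx))
  (λ x∈ → let x∈E , zx = ∈supp⁻ A E z x∈ in ∈supp⁺ A E y x∈E (trans (eq x∈E) zx))

xor≡false⇒≡ : ∀ a b → a xor b ≡ false → a ≡ b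
xor≡false⇒≡ false false _ = refl
xor≡false⇒≡ true  true  _ = refl

module Geometry (r : ℕ) (H : Subset (2 ^ r)) (e′ : Fin (2 ^ r)) (X : Subset (2 ^ r)) where

  V = allVectors r
  K = AG r H ∖ X
  N = AG+ r H e′ ∖ X

  rsPG : RowSpace (PG r) (rows V (ground (PG r)))
  rsPG = represented⇒rowSpace V (represents-PG r)

  represents-K : Represents V K
  represents-K = represents-∖ {M = AG r H} (represents-∖ {M = PG r} (represents-PG r) H) X

  represents-N : Represents V N
  represents-N = represents-∖ {M = AG+ r H e′} (represents-∖ {M = PG r} (represents-PG r) (H - e′)) X

  rsK : RowSpace K (rows V (ground K))
  rsK = represented⇒rowSpace V represents-K

  rsN : RowSpace N (rows V (ground N))
  rsN = represented⇒rowSpace V represents-N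

  ∈K⁺ : ∀ {j} → j ∈ ground (PG r) → j ∉ H → j ∉ X → j ∈ ground K
  ∈K⁺ j∈ j∉H j∉X = x∈p∧x∉q⇒x∈p─q (x∈p∧x∉q⇒x∈p─q j∈ j∉H) j∉X

  ∈N⁺ : ∀ {j} → j ∈ ground (PG r) → j ∉ H - e′ → j ∉ X → j ∈ ground N
  ∈N⁺ j∈ j∉H j∉X = x∈p∧x∉q⇒x∈p─q (x∈p∧x∉q⇒x∈p─q j∈ j∉H) j∉X

  ∈K⁻ : ∀ {j} → j ∈ ground K → j ∈ ground (PG r) × j ∉ H × j ∉ X
  ∈K⁻ j∈ = let j∈AG = p─q⊆p (ground (AG r H)) X j∈
           in p─q⊆p (ground (PG r)) H j∈AG , x∈p─q⇒x∉q (ground (PG r)) H j∈AG , x∈p─q⇒x∉q _ X j∈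

  ∈N⁻ : ∀ {j} → j ∈ ground N → j ∈ ground (PG r) × j ∉ H - e′ × j ∉ X
  ∈N⁻ j∈ = let j∈AG+ = p─q⊆p (ground (AG+ r H e′)) X j∈
           in p─q⊆p (ground (PG r)) (H - e′) j∈AG+ , x∈p─q⇒x∉q (ground (PG r)) (H - e′) j∈AG+ , x∈p─q⇒x∉q _ X j∈

  K⊆N : ground K ⊆ ground N
  K⊆N j∈ = let j∈PG , j∉H , j∉X = ∈K⁻ j∈ in ∈N⁺ j∈PG (j∉H ∘ p─q⊆p H _) j∉X

  N⇒K : ∀ {j} → j ∈ ground N → j ≢ e′ → j ∈ ground K
  N⇒K j∈ j≢e′ = let j∈PG , j∉H-e , j∉X = ∈N⁻ j∈
                in ∈K⁺ j∈PG (λ j∈H → j∉H-e (x∈p∧x≢y⇒x∈p-y j∈H j≢e′)) j∉X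

  indepK⇒dual : ∀ {I} → Indep K I → Dual V I
  indepK⇒dual iI = free⇒dual V (ground K) (indep⊆ground K iI) (RowSpace.indep⇒ rsK iI)

  dual⇒indepK : ∀ {I} → I ⊆ ground K → Dual V I → Indep K I
  dual⇒indepK I⊆ dual = RowSpace.free⇒ rsK I⊆ (dual⇒free V (ground K) I⊆ dual)

  indepN⇒dual : ∀ {I} → Indep N I → Dual V I
  indepN⇒dual iI = free⇒dual V (ground N) (indep⊆ground N iI) (RowSpace.indep⇒ rsN iI)

  dual⇒indepN : ∀ {I} → I ⊆ ground N → Dual V I → Indep N I
  dual⇒indepN I⊆ dual = RowSpace.free⇒ rsN I⊆ (dual⇒free V (ground N) I⊆ dual)

  -- A functional that is zero on a basis of `K` but not at `j` would yield `suc r` independent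
  -- columns of length `r`.
  spanning : rk K ≡ r → ∀ y → (∀ {j} → j ∈ ground K → ev y (col V j) ≡ false) → ∀ j → ev y (col V j) ≡ false
  spanning rk≡r y vanishes j = ¬-not λ yj →
    let B , mB = maxIn-exists K ⊆-refl
        open MaxIn mB
        ∣B∣≡r = trans (sym (rank≡∣maxIn∣ K mB)) rk≡r
        B∩w : ∀ {i} → i ∈ B → i ∉ supp V ⊤ y
        B∩w i∈B i∈w = not-¬ (vanishes (⊆X i∈B)) (proj₂ (∈supp⁻ V ⊤ y i∈w))
        j∈w = ∈supp⁺ V ⊤ y ∈⊤ yj
        dual = free⇒dual V ⊤ ⊆⊤ (free-extend (rows V ⊤)
                 (dual⇒free V ⊤ ⊆⊤ (indepK⇒dual indep)) (y , refl) j∈w B∩w)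
    in ℕ.<-irrefl refl (ℕ.≤-trans (ℕ.≤-reflexive (sym (trans
         (∣p∪⁅x⁆∣≡1+∣p∣ B λ j∈B → B∩w j∈B j∈w) (cong suc ∣B∣≡r)))) (dual⇒∣I∣≤k V dual))

  nonzero⇒row : ∀ {j} → j ∈ ground (PG r) → ∃[ y ] ev y (col V j) ≡ true
  nonzero⇒row {j} j∈ with any? (λ i → V i j ≟ᵇ true)
  ... | yes (i , eq) = ⁅ i ⁆ , trans (ev-⁅⁆ i (col V j)) eq
  ... | no ¬h = contradiction (x∈⁅x⁆ (zeroVector r)) (subst (_∉ ⁅ zeroVector r ⁆)
    (col-injective λ i → trans (¬-not λ eq → ¬h (i , eq)) (sym (col-zeroVector r i)))
    (x∈p─q⇒x∉q ⊤ ⁅ zeroVector r ⁆ j∈))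

  row⇒nonzero : ∀ {j} y → ev y (col V j) ≡ true → j ∈ ground (PG r)
  row⇒nonzero {j} y yj = x∈p∧x∉q⇒x∈p─q ∈⊤ λ j∈ → not-¬
    (trans (ev-cong y λ i → trans (cong (V i) (x∈⁅y⁆⇒x≡y (zeroVector r) j∈)) (col-zeroVector r i)) (ev-zeroʳ y)) yj

  distinct⇒row : ∀ {j j′} → j ≢ j′ → ∃[ y ] ev y (col V j) ≢ ev y (col V j′)
  distinct⇒row {j} {j′} j≢j′ with any? (λ i → ¬? (V i j ≟ᵇ V i j′))
  ... | yes (i , ne) = ⁅ i ⁆ , λ eq → ne (trans (sym (ev-⁅⁆ i (col V j))) (trans eq (ev-⁅⁆ i (col V j′))))
  ... | no ¬h = contradiction (col-injective λ i → decidable-stable (V i j ≟ᵇ V i j′) λ ne → ¬h (i , ne)) j≢j′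

∈-subset-≡ : {p : Subset n} {a b : ∃ (_∈ p)} → proj₁ a ≡ proj₁ b → a ≡ b
∈-subset-≡ {a = x , x∈p} {_ , x∈p′} refl = cong (x ,_) ([]=-irrelevant x∈p x∈p′)

-- From members of `𝕄` to exceptional spaces

module Configuration (r : ℕ) (H : Subset (2 ^ r)) (e′ : Fin (2 ^ r)) (X : Subset (2 ^ r))
  (E : Subset n) (f : Fin n → Fin (2 ^ r))
  (f∈N : ∀ {x} → x ∈ E → f x ∈ ground (AG+ r H e′ ∖ X))
  (f-injective : ∀ {x y} → x ∈ E → y ∈ E → f x ≡ f y → x ≡ y)
  (f-surjective : ∀ {j} → j ∈ ground (AG+ r H e′ ∖ X) → ∃[ x ] x ∈ E × f x ≡ j)
  (η : Subset r) (η-true : ∀ {j} → j ∈ ground (AG r H ∖ X) → ev η (col (allVectors r) j) ≡ true)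
  (η-e′ : ev η (col (allVectors r) e′) ≡ false) (e′∉K : e′ ∉ ground (AG r H ∖ X))
  (e : Fin n) (e∈E : e ∈ E) (fe : f e ≡ e′)
  where

  open Geometry r H e′ X

  G : Matrix r n
  G i = V i ∘ f

  Z : Space n
  Z = rows G E

  private
    E₀ = ground K

    e′∈N : e′ ∈ ground N
    e′∈N = subst (_∈ ground N) fe (f∈N e∈E)

    f∈K : ∀ {x} → x ∈ E → x ≢ e → f x ∈ E₀
    f∈K x∈E x≢e = N⇒K (f∈N x∈E) λ eq → x≢e (f-injective x∈E e∈E (trans eq (sym fe)))

    rest≡ : E - e ≡ supp G E η
    rest≡ = ⊆-antisym
      (λ {x} x∈ → let x∈E = p─q⊆p E _ x∈ in
        ∈supp⁺ G E η x∈E (η-true (f∈K x∈E λ { refl → ∉p-x x∈ })))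
      (λ {x} x∈ → let x∈E , ηx = ∈supp⁻ G E η x∈ in
        x∈p∧x≢y⇒x∈p-y x∈E λ { refl → not-¬ (trans (cong (λ j → ev η (col V j)) fe) η-e′) ηx })

  module _ (vanishing : ∀ y → (∀ {j} → j ∈ ground K → ev y (col V j) ≡ false) → ∀ j → ev y (col V j) ≡ false)
           (complementary : HyperplaneComplementary K) (3≤rk : 3 ≤ rk N) where

    private
      vanishing-difference : ∀ y z → (∀ {j} → j ∈ E₀ → ev y (col V j) ≡ ev z (col V j)) → supp G E y ≡ supp G E z
      vanishing-difference y z eq = supp-cong G E y z λ {x} _ → xor≡false⇒≡ _ _
        (trans (sym (ev-△ y z (col V (f x)))) (vanishing (y △ z) (λ {j} j∈ → trans (ev-△ y z (col V j))
          (trans (cong (_xor ev z (col V j)) (eq j∈)) (xor-same (ev z (col V j))))) (f x)))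

      supp-nonempty : ∀ {y x} → x ∈ supp G E y → Nonempty (supp V E₀ y)
      supp-nonempty {y} {x} x∈ = decidable-stable (nonempty? (supp V E₀ y)) λ empty → not-¬
        (vanishing y (λ {j} j∈ → ¬-not λ yj → empty (j , ∈supp⁺ V E₀ y j∈ yj)) (f x)) (proj₂ (∈supp⁻ G E y x∈))

      -- A minimal row `D` of `K` below `y` has a complement that is again minimal, because
      -- hyperplanes are complementary. That complement contains the nonempty complement of `z`, so
      -- the two are equal; hence `z` equals `D` on `K`, and so does `y`, which lies between them.
      -- Agreement on `K` extends to `e` because `K` spans.
      antichain : ∀ {y z} → supp G E y ≢ ⊥ → supp G E z ≢ E - e → supp G E y - e ⊆ supp G E z → supp G E y ≡ supp G E z
      antichain {y} {z} y≢⊥ z≢h y⊆z = vanishing-difference y z λ {j} j∈ → agree j∈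
        where
        y⇒z : ∀ {j} → j ∈ E₀ → ev y (col V j) ≡ true → ev z (col V j) ≡ true
        y⇒z j∈ yj with f-surjective (K⊆N j∈)
        ... | x , x∈E , refl = proj₂ (∈supp⁻ G E z (y⊆z (x∈p∧x≢y⇒x∈p-y (∈supp⁺ G E y x∈E yj)
                λ { refl → e′∉K (subst (_∈ E₀) fe j∈) })))
        below = min-through (rows V E₀) (y , refl) (proj₂ (supp-nonempty {y} (proj₂ (≢⊥⇒Nonempty y≢⊥))))
        D = proj₁ below
        mD = proj₁ (proj₂ below)
        D⊆y : D ⊆ supp V E₀ y
        D⊆y = proj₁ (proj₂ (proj₂ below))
        D⊆K : D ⊆ E₀
        D⊆K = proj₁ ∘ ∈supp⁻ V E₀ y ∘ D⊆y
        min-K─D : Min (rows V E₀) (E₀ ─ D)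
        min-K─D = subst (Min (rows V E₀)) (cong (E₀ ─_) (─-involutive D⊆K))
          (hyperplane⇒min rsK (complementary (min⇒hyperplane rsK mD)))
        complement≡ : supp V E₀ (z △ η) ≡ E₀ ─ supp V E₀ z
        complement≡ = supp-complement V E₀ η-true z
        ne : Nonempty (supp V E₀ (z △ η))
        ne = decidable-stable (nonempty? (supp V E₀ (z △ η))) λ empty →
          z≢h (trans (vanishing-difference z η λ {j} j∈ → xor≡false⇒≡ _ _ (trans (sym (ev-△ z η (col V j)))
            (¬-not λ zηj → empty (j , ∈supp⁺ V E₀ (z △ η) j∈ zηj)))) (sym rest≡))
        K─D⊆ : E₀ ─ D ⊆ supp V E₀ (z △ η)
        K─D⊆ = proj₂ (proj₂ min-K─D) (z △ η , refl) ne λ {j} j∈ →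
          let j∈K─z = subst (j ∈_) complement≡ j∈
              j∈K = p─q⊆p E₀ _ j∈K─z
          in x∈p∧x∉q⇒x∈p─q j∈K λ j∈D → x∈p─q⇒x∉q E₀ (supp V E₀ z) j∈K─z
               (∈supp⁺ V E₀ z j∈K (y⇒z j∈K (proj₂ (∈supp⁻ V E₀ y (D⊆y j∈D)))))
        z⇒y : ∀ {j} → j ∈ E₀ → ev z (col V j) ≡ true → ev y (col V j) ≡ true
        z⇒y {j} j∈ zj = proj₂ (∈supp⁻ V E₀ y (D⊆y (decidable-stable (j ∈? D) λ j∉D →
          x∈p─q⇒x∉q E₀ (supp V E₀ z) (subst (j ∈_) complement≡ (K─D⊆ (x∈p∧x∉q⇒x∈p─q j∈ j∉D)))
            (∈supp⁺ V E₀ z j∈ zj))))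
        agree : ∀ {j} → j ∈ E₀ → ev y (col V j) ≡ ev z (col V j)
        agree {j} j∈ with ev y (col V j) in yj | ev z (col V j) in zj
        ... | true  | true  = refl
        ... | false | false = refl
        ... | true  | false = trans (sym (y⇒z j∈ yj)) zj
        ... | false | true  = trans (sym yj) (z⇒y j∈ zj)

      through : ∃[ y ] ev y (col V e′) ≡ true
      through = nonzero⇒row (proj₁ (∈N⁻ e′∈N))

      -- The singleton is written as an extension of `⊥`, the form that `free-extend` produces.
      T : Subset (2 ^ r)
      T = ⊥ ∪ ⁅ e′ ⁆

      T⇒e′ : ∀ {j} → j ∈ T → j ≡ e′
      T⇒e′ j∈ = [ (λ j∈⊥ → contradiction j∈⊥ ∉⊥) , id ]′ (∈∪⁅⁆⁻ {p = ⊥} j∈)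

      ∣T∣≡1 : ∣ T ∣ ≡ 1
      ∣T∣≡1 = trans (∣p∪⁅x⁆∣≡1+∣p∣ {x = e′} ⊥ ∉⊥) (cong suc (∣⊥∣≡0 (2 ^ r)))

      indep-T : Indep N T
      indep-T = RowSpace.free⇒ rsN (λ j∈ → subst (_∈ ground N) (sym (T⇒e′ j∈)) e′∈N)
        (free-extend W {B = ⊥} (λ i∈ → contradiction i∈ ∉⊥) (proj₁ through , refl)
          (∈supp⁺ V (ground N) (proj₁ through) e′∈N (proj₂ through)) (λ j∈ → contradiction j∈ ∉⊥))
        where W = rows V (ground N)

      Avoiding : Set
      Avoiding = ∃[ z ] Member Z z × z ≢ ⊥ × z ≢ E - e × e ∉ z

      -- Rank three provides `p` and `q` independent of `e′`. The functional dual to `q` is zero at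
      -- `e′`, and being zero at `p` it is not the affine functional.
      avoiding-row : ∀ {p q} → p ∈ ground N → p ∉ T → q ∈ ground N → q ∉ T ∪ ⁅ p ⁆ →
                     Dual V ((T ∪ ⁅ p ⁆) ∪ ⁅ q ⁆) → Avoiding
      avoiding-row {p} {q} p∈N p∉T q∈N q∉T′ dual with f-surjective p∈N | f-surjective q∈N
      ... | a , a∈E , refl | b , b∈E , refl = conclude (dual (x∈p∪⁅x⁆ (T ∪ ⁅ p ⁆)))
        where
        conclude : (∃[ y ] ev y (col V q) ≡ true ×
                     (∀ {j} → j ∈ (T ∪ ⁅ p ⁆) ∪ ⁅ q ⁆ → ev y (col V j) ≡ true → j ≡ q)) → Avoiding
        conclude (y , yq , only) = supp G E y , (y , refl)
          , Nonempty⇒≢⊥ (b , ∈supp⁺ G E y b∈E yq)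
          , (λ eq → not-¬ (vanishes (x∈p∪⁅x⁆ T)) (proj₂ (∈supp⁻ G E y (subst (a ∈_) (sym eq)
              (x∈p∧x≢y⇒x∈p-y a∈E λ { refl → p∉T (subst (_∈ T) (sym fe) (x∈p∪⁅x⁆ ⊥)) })))))
          , λ e∈ → not-¬ (vanishes (p⊆p∪q ⁅ p ⁆ (x∈p∪⁅x⁆ ⊥)))
              (trans (cong (λ j → ev y (col V j)) (sym fe)) (proj₂ (∈supp⁻ G E y e∈)))
          where
          vanishes : ∀ {j} → j ∈ T ∪ ⁅ p ⁆ → ev y (col V j) ≡ false
          vanishes j∈ = ¬-not λ yj → q∉T′ (subst (_∈ T ∪ ⁅ p ⁆) (only (p⊆p∪q ⁅ q ⁆ j∈) yj) j∈)

      avoiding : Avoiding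
      avoiding = second (extend-below-rank N indep-T
          (subst (_< rk N) (sym ∣T∣≡1) (ℕ.≤-trans (ℕ.n≤1+n 2) 3≤rk)))
        where
        third : ∀ {p} → p ∈ ground N → p ∉ T →
                (∃[ q ] q ∈ ground N × q ∉ T ∪ ⁅ p ⁆ × Indep N ((T ∪ ⁅ p ⁆) ∪ ⁅ q ⁆)) → Avoiding
        third p∈N p∉T (q , q∈N , q∉ , i) = avoiding-row p∈N p∉T q∈N q∉ (indepN⇒dual i)
        second : (∃[ p ] p ∈ ground N × p ∉ T × Indep N (T ∪ ⁅ p ⁆)) → Avoiding
        second (p , p∈N , p∉T , i) = third p∈N p∉T (extend-below-rank N i
          (subst (_< rk N) (sym (trans (∣p∪⁅x⁆∣≡1+∣p∣ T p∉T) (cong suc ∣T∣≡1))) 3≤rk))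

      separating : ∀ {x y} → x ∈ E → y ∈ E → x ≢ y → ∃[ z ] Member Z z × ((x ∈ z × y ∉ z) ⊎ (x ∉ z × y ∈ z))
      separating {a} {b} a∈E b∈E a≢b with distinct⇒row (a≢b ∘ f-injective a∈E b∈E)
      ... | y , ne with ev y (col V (f a)) in ya | ev y (col V (f b)) in yb
      ...   | true  | false = supp G E y , (y , refl) , inj₁
                (∈supp⁺ G E y a∈E ya , λ b∈ → not-¬ yb (proj₂ (∈supp⁻ G E y b∈)))
      ...   | false | true  = supp G E y , (y , refl) , inj₂
                ((λ a∈ → not-¬ ya (proj₂ (∈supp⁻ G E y a∈))) , ∈supp⁺ G E y b∈E yb)
      ...   | true  | true  = contradiction refl ne
      ...   | false | false = contradiction refl ne

    exceptional : Exceptional E Z e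
    exceptional = record
      { e∈E        = e∈E
      ; rest       = η , rest≡
      ; antichain  = λ { (y , refl) (z , refl) → antichain {y} {z} }
      ; through    = let y , ye = through in supp G E y , (y , refl) ,
                       ∈supp⁺ G E y e∈E (trans (cong (λ j → ev y (col V j)) fe) ye)
      ; avoiding   = avoiding
      ; separating = separating
      }

module FromGeometry (M : Matroid n) (r : ℕ) (H : Subset (2 ^ r)) (e′ : Fin (2 ^ r)) (X : Subset (2 ^ r))
  (hyperplane : Hyperplane (PG r) H) (e′∈H : e′ ∈ H) (X⊆AG : X ⊆ ground (AG r H))
  (complementary : HyperplaneComplementary (AG r H ∖ X)) (rk-K : rk (AG r H ∖ X) ≡ r)
  (3≤rk : 3 ≤ rk (AG+ r H e′ ∖ X)) (iso : M * ≅ AG+ r H e′ ∖ X) where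

  open Geometry r H e′ X

  private
    E = ground M
    φ = proj₁ iso

    to : ∃ (_∈ E) → ∃ (_∈ ground N)
    to = Inverse.to φ

    f : Fin n → Fin (2 ^ r)
    f x with x ∈? E
    ... | yes x∈E = proj₁ (to (x , x∈E))
    -- A default outside `E`, where `supp` cuts off every row.
    ... | no _    = zeroVector r

    f≡to : ∀ {x} (x∈E : x ∈ E) → f x ≡ proj₁ (to (x , x∈E))
    f≡to {x} x∈E with x ∈? E
    ... | yes x∈E′ = cong (λ p → proj₁ (to (x , p))) ([]=-irrelevant x∈E′ x∈E)
    ... | no x∉E   = contradiction x∈E x∉E

    f∈N : ∀ {x} → x ∈ E → f x ∈ ground N
    f∈N x∈E = subst (_∈ ground N) (sym (f≡to x∈E)) (proj₂ (to (_ , x∈E)))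

    f-injective : ∀ {x y} → x ∈ E → y ∈ E → f x ≡ f y → x ≡ y
    f-injective {x} {y} x∈E y∈E eq = cong proj₁ (begin
      (x , x∈E)                            ≡⟨ Inverse.strictlyInverseʳ φ (x , x∈E) ⟨
      Inverse.from φ (to (x , x∈E))        ≡⟨ cong (Inverse.from φ) (∈-subset-≡
                                                (trans (sym (f≡to x∈E)) (trans eq (f≡to y∈E)))) ⟩
      Inverse.from φ (to (y , y∈E))        ≡⟨ Inverse.strictlyInverseʳ φ (y , y∈E) ⟩
      (y , y∈E)                            ∎)
      where open ≡-Reasoning

    f-surjective : ∀ {j} → j ∈ ground N → ∃[ x ] x ∈ E × f x ≡ j
    f-surjective {j} j∈N = let x , x∈E = Inverse.from φ (j , j∈N) in
      x , x∈E , trans (f≡to x∈E) (cong proj₁ (Inverse.strictlyInverseˡ φ (j , j∈N)))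

    G : Matrix r n
    G i = V i ∘ f

    Z : Space n
    Z = rows G E

  dual-rowSpace : RowSpace (M *) Z
  dual-rowSpace = record
    { ⊆ground = λ { (y , refl) x∈ → proj₁ (∈supp⁻ G E y x∈) }
    ; indep⇒  = λ {I} iI →
        let I⊆E = indep⊆ground (M *) iI
        in dual⇒free G E I⊆E (dual-image⁻ f V (∈image⁺ f) (λ x∈I y∈I → f-injective (I⊆E x∈I) (I⊆E y∈I))
             (indepN⇒dual (Equivalence.to (iso-indep I⊆E) iI)))
    ; free⇒   = λ {I} I⊆E free → Equivalence.from (iso-indep I⊆E)
        (dual⇒indepN (image⊆N I⊆E) (dual-image⁺ f V (∈image⁺ f) (∈image⁻ f) (free⇒dual G E I⊆E free)))
    }
    where
    image⊆N : ∀ {I} → I ⊆ E → image f I ⊆ ground N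
    image⊆N I⊆E j∈ with ∈image⁻ f j∈
    ... | x , x∈I , refl = f∈N (I⊆E x∈I)
    iso-indep : ∀ {I} → I ⊆ E → CoIndep M I ⇔ Indep N (image f I)
    iso-indep {I} I⊆E = proj₂ iso I⊆E (image⊆N I⊆E) λ (x , x∈E) → mk⇔
      (λ x∈I → subst (_∈ image f I) (f≡to x∈E) (∈image⁺ f x∈I))
      (λ j∈ → let x′ , x′∈I , eq = ∈image⁻ f j∈
              in subst (_∈ I) (f-injective (I⊆E x′∈I) x∈E (trans eq (sym (f≡to x∈E)))) x′∈I)

  -- The double dual has the independent sets of `M`, so its cycle space also serves `M`.
  cycleSpace : CycleSpace M Z
  cycleSpace = record
    { ⊆ground = CycleSpace.⊆ground dual-dual
    ; indep⇒  = λ iI → CycleSpace.indep⇒ dual-dual (indep⇒dual-dual M iI)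
    ; ⇒indep  = λ I⊆ h → dual-dual⇒indep M (CycleSpace.⇒indep dual-dual I⊆ h)
    }
    where dual-dual = rowSpace⇒dual-cycleSpace dual-rowSpace

  private
    E₀ = ground K

    min-H : Min (rows V (ground (PG r))) (ground (PG r) ─ H)
    min-H = hyperplane⇒min rsPG hyperplane

    -- The complement of the hyperplane `H` is a minimal row, and `η` is a functional with this
    -- support: one on the affine points and zero on `H`.
    η = proj₁ (proj₁ min-H)

    η≡ : ground (PG r) ─ H ≡ supp V (ground (PG r)) η
    η≡ = proj₂ (proj₁ min-H)

    η-true : ∀ {j} → j ∈ E₀ → ev η (col V j) ≡ true
    η-true {j} j∈ = let j∈PG , j∉H , _ = ∈K⁻ j∈
      in proj₂ (∈supp⁻ V (ground (PG r)) η (subst (j ∈_) η≡ (x∈p∧x∉q⇒x∈p─q j∈PG j∉H)))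

    e′∈PG : e′ ∈ ground (PG r)
    e′∈PG = proj₁ (proj₁ hyperplane) e′∈H

    η-e′ : ev η (col V e′) ≡ false
    η-e′ = ¬-not λ ηe → x∈p─q⇒x∉q (ground (PG r)) H
      (subst (e′ ∈_) (sym η≡) (∈supp⁺ V (ground (PG r)) η e′∈PG ηe)) e′∈H

    e′∉K : e′ ∉ E₀
    e′∉K e′∈ = proj₁ (proj₂ (∈K⁻ e′∈)) e′∈H

    e′∈N : e′ ∈ ground N
    e′∈N = ∈N⁺ e′∈PG ∉p-x λ e′∈X → x∈p─q⇒x∉q (ground (PG r)) H (X⊆AG e′∈X) e′∈H

    e = proj₁ (f-surjective e′∈N)
    e∈E = proj₁ (proj₂ (f-surjective e′∈N))

    fe : f e ≡ e′
    fe = proj₂ (proj₂ (f-surjective e′∈N))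

  private
    module Conf = Configuration r H e′ X E f f∈N f-injective f-surjective η η-true η-e′ e′∉K e e∈E fe

  excluded : ExcludedSeriesMinor CircuitDifference M
  excluded = exceptional⇒excluded cycleSpace (Conf.exceptional (spanning rk-K) complementary 3≤rk)

-- Coordinates with respect to a basis

enum : (p : Subset n) → Fin ∣ p ∣ → Fin n
enum (outside ∷ p) i       = suc (enum p i)
enum (inside ∷ p)  zero    = zero
enum (inside ∷ p)  (suc i) = suc (enum p i)

enum∈ : (p : Subset n) (i : Fin ∣ p ∣) → enum p i ∈ p
enum∈ (outside ∷ p) i       = there (enum∈ p i)
enum∈ (inside ∷ p)  zero    = here
enum∈ (inside ∷ p)  (suc i) = there (enum∈ p i)

enum-injective : (p : Subset n) {i j : Fin ∣ p ∣} → enum p i ≡ enum p j → i ≡ j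
enum-injective (outside ∷ p)                 eq = enum-injective p (suc-injective eq)
enum-injective (inside ∷ p) {zero}  {zero}  eq = refl
enum-injective (inside ∷ p) {suc i} {suc j} eq = cong suc (enum-injective p (suc-injective eq))

enum-surjective : (p : Subset n) {x : Fin n} → x ∈ p → ∃[ i ] enum p i ≡ x
enum-surjective (inside ∷ p)  here       = zero , refl
enum-surjective (inside ∷ p)  (there x∈) = let i , eq = enum-surjective p x∈ in suc i , cong suc eq
enum-surjective (outside ∷ p) (there x∈) = let i , eq = enum-surjective p x∈ in i , cong suc eq

linear-combination : (Z : Space n) (zs : Fin k → Subset n) → (∀ i → Member Z (zs i)) → (y : Subset k) →
                     ∃[ z ] Member Z z × (∀ x → lookup z x ≡ ev y (λ i → lookup (zs i) x))
linear-combination Z zs mzs []          = ⊥ , ⊥-member Z , λ x → lookup-replicate x false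
linear-combination Z zs mzs (false ∷ y) = linear-combination Z (zs ∘ suc) (mzs ∘ suc) y
linear-combination Z zs mzs (true ∷ y)  =
  let z , mz , eq = linear-combination Z (zs ∘ suc) (mzs ∘ suc) y
  in zs zero △ z , △-member Z (mzs zero) mz , λ x →
       trans (lookup-zipWith _xor_ x (zs zero) z) (cong (lookup (zs zero) x xor_) (eq x))

record Coordinates (Z : Space n) (r : ℕ) : Set where
  field
    matrix  : Matrix r n
    member⁺ : ∀ y → ∃[ z ] Member Z z × (∀ x → lookup z x ≡ ev y (col matrix x))
    member⁻ : ∀ {z} → Member Z z → ∃[ y ] (∀ x → lookup z x ≡ ev y (col matrix x))

module _ {M : Matroid n} {Z : Space n} (cs : CycleSpace M Z) {B : Subset n} (bB : Basis M B) where

  private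
    B* = ground M ─ B

    rs = cycleSpace⇒dual-rowSpace cs

    fundamental : ∀ {b} → b ∈ B* → ∃[ z ] Member Z z × b ∈ z × (∀ {j} → j ∈ B* → j ∈ z → j ≡ b)
    fundamental = RowSpace.indep⇒ rs (B , bB , ⊆-refl)

    zs : Fin ∣ B* ∣ → Subset n
    zs i = proj₁ (fundamental (enum∈ B* i))

    zs∈Z : ∀ i → Member Z (zs i)
    zs∈Z i = proj₁ (proj₂ (fundamental (enum∈ B* i)))

    unit : ∀ i i′ → lookup (zs i′) (enum B* i) ≡ lookup ⁅ i ⁆ i′
    unit i i′ = ⇔→≡ {z = true} (mk⇔
      (λ eq → []=⇒lookup (subst (_∈ ⁅ i ⁆)
        (enum-injective B* (proj₂ (proj₂ (proj₂ (fundamental (enum∈ B* i′)))) (enum∈ B* i)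
          (lookup⇒[]= (enum B* i) (zs i′) eq))) (x∈⁅x⁆ i)))
      (λ eq → []=⇒lookup (subst (λ j → enum B* i ∈ zs j) (sym (x∈⁅y⁆⇒x≡y i (lookup⇒[]= i′ ⁅ i ⁆ eq)))
        (proj₁ (proj₂ (proj₂ (fundamental (enum∈ B* i))))))))

  -- The fundamental cycles over `B` form a basis of `Z`: two members that agree on `B*` differ by a
  -- member inside the independent set `B`, which is empty.
  coordinates : Coordinates Z ∣ B* ∣
  coordinates = record
    { matrix  = λ i x → lookup (zs i) x
    ; member⁺ = linear-combination Z zs zs∈Z
    ; member⁻ = λ {z} mz → tabulate (λ i → lookup z (enum B* i)) , expand mz
    }
    where
    open ≡-Reasoning
    expand : ∀ {z} → Member Z z → ∀ x →
             lookup z x ≡ ev (tabulate (λ i → lookup z (enum B* i))) (λ i → lookup (zs i) x)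
    expand {z} mz = via (linear-combination Z zs zs∈Z y)
      where
      y = tabulate (λ i → lookup z (enum B* i))
      ev-basis : ∀ i → ev y (λ i′ → lookup (zs i′) (enum B* i)) ≡ lookup z (enum B* i)
      ev-basis i = begin
        ev y (λ i′ → lookup (zs i′) (enum B* i))  ≡⟨ ev-cong y (unit i) ⟩
        ev y (lookup ⁅ i ⁆)                       ≡⟨ sum-cong-≗ (λ j → ∧-comm (lookup y j) (lookup ⁅ i ⁆ j)) ⟩
        ev ⁅ i ⁆ (lookup y)                       ≡⟨ ev-⁅⁆ i (lookup y) ⟩
        lookup y i                                ≡⟨ lookup∘tabulate _ i ⟩
        lookup z (enum B* i)                      ∎
      via : (∃[ w ] Member Z w × (∀ x → lookup w x ≡ ev y (λ i → lookup (zs i) x))) →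
            ∀ x → lookup z x ≡ ev y (λ i → lookup (zs i) x)
      via (w , mw , w≡) x = trans (cong (λ p → lookup p x) (△≡⊥⇒≡
          (CycleSpace.indep⇒ cs (proj₁ bB) (△-member Z mz mw) z△w⊆B))) (w≡ x)
        where
        agree : ∀ {x} → (∃[ i ] enum B* i ≡ x) → x ∉ z △ w
        agree (i , refl) x∈ = not-¬ (begin
          lookup (z △ w) (enum B* i)                            ≡⟨ lookup-zipWith _xor_ (enum B* i) z w ⟩
          lookup z (enum B* i) xor lookup w (enum B* i)         ≡⟨ cong (lookup z (enum B* i) xor_)
                                                                     (trans (w≡ (enum B* i)) (ev-basis i)) ⟩
          lookup z (enum B* i) xor lookup z (enum B* i)         ≡⟨ xor-same (lookup z (enum B* i)) ⟩
          false                                                 ∎) ([]=⇒lookup x∈)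
        z△w⊆B : z △ w ⊆ B
        z△w⊆B {x} x∈ = decidable-stable (x ∈? B) λ x∉B → agree (enum-surjective B*
          (x∈p∧x∉q⇒x∈p─q (△-⊆ (CycleSpace.⊆ground cs mz) (CycleSpace.⊆ground cs mw) x∈) x∉B)) x∈

-- From exceptional spaces to members of `𝕄`

module ToGeometry {M : Matroid n} {Z : Space n} (cs : CycleSpace M Z) {e : Fin n} (exc : Exceptional (ground M) Z e)
  (r : ℕ) (f : Fin n → Fin (2 ^ r))
  (row∈Z : ∀ y → Member Z (supp (λ i → allVectors r i ∘ f) (ground M) y))
  (rowOf : ∀ {z} → Member Z z → ∃[ y ] z ≡ supp (λ i → allVectors r i ∘ f) (ground M) y)
  (η : Subset r) (rest≡ : ground M - e ≡ supp (λ i → allVectors r i ∘ f) (ground M) η)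
  (T : Subset n) (coindep-T : CoIndep M T) (e∉T : e ∉ T) (∣T∣≡r : ∣ T ∣ ≡ r) where

  open Exceptional exc

  private
    E = ground M
    P = ground (PG r)
    A = supp (allVectors r) P η

  -- `H` consists of the nonzero vectors in the kernel of the affine functional `η`. Removing every
  -- affine point that is not a column makes `f` onto the ground set of `N`.
  H X : Subset (2 ^ r)
  H = P ─ A
  X = ground (AG r H) ─ image f E

  e′ : Fin (2 ^ r)
  e′ = f e

  open Geometry r H e′ X

  private
    G : Matrix r n
    G i = V i ∘ f

    E₀ = ground K

    rs = cycleSpace⇒dual-rowSpace cs

    coindep⇒dual : ∀ {I} → CoIndep M I → Dual G I
    coindep⇒dual {I} iI = free⇒dual G E (indep⊆ground (M *) iI) λ i∈I → as-row (RowSpace.indep⇒ rs iI i∈I)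
      where
      as-row : ∀ {i} → (∃[ z ] Member Z z × i ∈ z × (∀ {j} → j ∈ I → j ∈ z → j ≡ i)) →
               ∃[ z ] Member (rows G E) z × i ∈ z × (∀ {j} → j ∈ I → j ∈ z → j ≡ i)
      as-row (z , mz , i∈z , only) = z , rowOf mz , i∈z , only

    dual⇒coindep : ∀ {I} → I ⊆ E → Dual G I → CoIndep M I
    dual⇒coindep {I} I⊆E dual = RowSpace.free⇒ rs I⊆E λ i∈I → as-member (dual⇒free G E I⊆E dual i∈I)
      where
      as-member : ∀ {i} → (∃[ z ] Member (rows G E) z × i ∈ z × (∀ {j} → j ∈ I → j ∈ z → j ≡ i)) →
                  ∃[ z ] Member Z z × i ∈ z × (∀ {j} → j ∈ I → j ∈ z → j ≡ i)
      as-member (_ , (y , refl) , i∈z , only) = _ , row∈Z y , i∈z , only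

    η-f : ∀ {x} → x ∈ E → x ≢ e → ev η (col V (f x)) ≡ true
    η-f {x} x∈E x≢e = proj₂ (∈supp⁻ G E η (subst (x ∈_) rest≡ (x∈p∧x≢y⇒x∈p-y x∈E x≢e)))

    η-e′ : ev η (col V e′) ≡ false
    η-e′ = ¬-not λ ηe → ∉p-x (subst (e ∈_) (sym rest≡) (∈supp⁺ G E η e∈E ηe))

    f∈P : ∀ {x} → x ∈ E → f x ∈ P
    f∈P {x} x∈E with x ≟ᶠ e
    ... | no x≢e   = row⇒nonzero η (η-f x∈E x≢e)
    -- As `η` is zero at `e′`, a member through `e` has to show that this column is not the zero
    -- vector.
    ... | yes refl = via (rowOf (proj₁ (proj₂ through))) (proj₂ (proj₂ through))
      where
      via : ∀ {z} → (∃[ y ] z ≡ supp G E y) → e ∈ z → e′ ∈ P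
      via (y , refl) e∈z = row⇒nonzero y (proj₂ (∈supp⁻ G E y e∈z))

    f-injective : ∀ {x y} → x ∈ E → y ∈ E → f x ≡ f y → x ≡ y
    f-injective {a} {b} a∈E b∈E eq = decidable-stable (a ≟ᶠ b) λ a≢b → distinguish (separating a∈E b∈E a≢b)
      where
      same : ∀ y → ev y (col V (f a)) ≡ ev y (col V (f b))
      same y = cong (λ j → ev y (col V j)) eq
      distinguish : ¬ (∃[ z ] Member Z z × ((a ∈ z × b ∉ z) ⊎ (a ∉ z × b ∈ z)))
      distinguish (z , mz , sep) with rowOf mz
      distinguish (_ , _ , inj₁ (a∈z , b∉z)) | y , refl =
        b∉z (∈supp⁺ G E y b∈E (trans (sym (same y)) (proj₂ (∈supp⁻ G E y a∈z))))
      distinguish (_ , _ , inj₂ (a∉z , b∈z)) | y , refl =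
        a∉z (∈supp⁺ G E y a∈E (trans (same y) (proj₂ (∈supp⁻ G E y b∈z))))

    H⇒η : ∀ {j} → j ∈ H → ev η (col V j) ≡ false
    H⇒η j∈H = ¬-not λ ηj → x∈p─q⇒x∉q P A j∈H (∈supp⁺ V P η (p─q⊆p P A j∈H) ηj)

  e′∈H : e′ ∈ H
  e′∈H = x∈p∧x∉q⇒x∈p─q (f∈P e∈E) λ e′∈A → not-¬ η-e′ (proj₂ (∈supp⁻ V P η e′∈A))

  private
    f∈N : ∀ {x} → x ∈ E → f x ∈ ground N
    f∈N {x} x∈E = ∈N⁺ (f∈P x∈E) ∉H (λ fx∈X → x∈p─q⇒x∉q (ground (AG r H)) (image f E) fx∈X (∈image⁺ f x∈E))
      where
      ∉H : f x ∉ H - e′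
      ∉H fx∈ with x ≟ᶠ e
      ... | yes refl = ∉p-x fx∈
      ... | no x≢e   = not-¬ (H⇒η (p─q⊆p H _ fx∈)) (η-f x∈E x≢e)

    f-surjective : ∀ {j} → j ∈ ground N → ∃[ x ] x ∈ E × f x ≡ j
    f-surjective {j} j∈N with j ≟ᶠ e′
    ... | yes refl = e , e∈E , refl
    ... | no j≢e′  = ∈image⁻ f (decidable-stable (j ∈? image f E) λ j∉ →
            let j∈P , j∉H , j∉X = ∈K⁻ (N⇒K j∈N j≢e′)
            in j∉X (x∈p∧x∉q⇒x∈p─q (x∈p∧x∉q⇒x∈p─q j∈P j∉H) j∉))

    e′∉K : e′ ∉ E₀
    e′∉K e′∈ = proj₁ (proj₂ (∈K⁻ e′∈)) e′∈H

    f∈K : ∀ {x} → x ∈ E → x ≢ e → f x ∈ E₀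
    f∈K x∈E x≢e = N⇒K (f∈N x∈E) λ eq → x≢e (f-injective x∈E e∈E eq)

    K⇒f : ∀ {j} → j ∈ E₀ → ∃[ x ] x ∈ E × x ≢ e × f x ≡ j
    K⇒f j∈ with f-surjective (K⊆N j∈)
    ... | x , x∈E , refl = x , x∈E , (λ { refl → e′∉K j∈ }) , refl

    η-true : ∀ {j} → j ∈ E₀ → ev η (col V j) ≡ true
    η-true j∈ with K⇒f j∈
    ... | x , x∈E , x≢e , refl = η-f x∈E x≢e

    some-rest : Nonempty (E - e)
    some-rest with avoiding
    ... | z , mz , z≢⊥ , _ , e∉z with ≢⊥⇒Nonempty z≢⊥
    ...   | x , x∈z = x , x∈p∧x≢y⇒x∈p-y (CycleSpace.⊆ground cs mz x∈z) λ { refl → e∉z x∈z }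

    -- If j ∈ A is not in the support of y and w is, then the vector j + w is in the
    -- support of y but not in A.
    covers-A : ∀ y → Nonempty (supp V P y) → supp V P y ⊆ A → A ⊆ supp V P y
    covers-A y (w , w∈) y⊆A {j} j∈A = decidable-stable (j ∈? supp V P y) λ j∉ →
      let j∈P , ηj = ∈supp⁻ V P η j∈A
          w∈P , yw = ∈supp⁻ V P y w∈
          _ , ηw = ∈supp⁻ V P η (y⊆A w∈)
          v = vector {r} (λ i → col V j i xor col V w i)
          at-v : ∀ u → ev u (col V v) ≡ ev u (col V j) xor ev u (col V w)
          at-v u = trans (ev-cong u (col-vector {r} _)) (ev-xor u (col V j) (col V w))
          yv : ev y (col V v) ≡ true
          yv = trans (at-v y) (cong₂ _xor_ (¬-not λ yj → j∉ (∈supp⁺ V P y j∈P yj)) yw)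
      in not-¬ (trans (at-v η) (cong₂ _xor_ ηj ηw))
           (proj₂ (∈supp⁻ V P η (y⊆A (∈supp⁺ V P y (row⇒nonzero y yv) yv))))

  hyperplane-H : Hyperplane (PG r) H
  hyperplane-H = min⇒hyperplane rsPG ((η , refl) , nonempty , minimal)
    where
    nonempty : Nonempty A
    nonempty with some-rest
    ... | x , x∈ = f x , ∈supp⁺ V P η (f∈P (p─q⊆p E _ x∈)) (η-f (p─q⊆p E _ x∈) λ { refl → ∉p-x x∈ })
    minimal : ∀ {D} → Member (rows V P) D → Nonempty D → D ⊆ A → A ⊆ D
    minimal (y , refl) = covers-A y

  X⊆AG : X ⊆ ground (AG r H)
  X⊆AG = p─q⊆p _ _

  private
    image⊆N : ∀ {I} → I ⊆ E → image f I ⊆ ground N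
    image⊆N I⊆E j∈ with ∈image⁻ f j∈
    ... | x , x∈I , refl = f∈N (I⊆E x∈I)

    dual-image : ∀ {I} → CoIndep M I → Dual V (image f I)
    dual-image iI = dual-image⁺ f V (∈image⁺ f) (∈image⁻ f) (coindep⇒dual iI)

    ∣I∣≤∣fI∣ : ∀ {I} → CoIndep M I → ∣ I ∣ ≤ ∣ image f I ∣
    ∣I∣≤∣fI∣ iI = ∣I∣≤∣image∣ f λ x∈I y∈I →
      f-injective (indep⊆ground (M *) iI x∈I) (indep⊆ground (M *) iI y∈I)

  -- Columns of length `r` bound the rank above; the image of `T` attains the bound and is affine
  -- because `T` avoids `e`.
  rk-K : rk K ≡ r
  rk-K = ℕ.≤-antisym (rank≤ K λ iI _ → dual⇒∣I∣≤k V (indepK⇒dual iI))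
    (ℕ.≤-trans (ℕ.≤-reflexive (sym ∣T∣≡r)) (ℕ.≤-trans (∣I∣≤∣fI∣ coindep-T)
      (indep≤rank K (dual⇒indepK fT⊆K (dual-image coindep-T)) fT⊆K)))
    where
    fT⊆K : image f T ⊆ E₀
    fT⊆K j∈ with ∈image⁻ f j∈
    ... | x , x∈T , refl = f∈K (indep⊆ground (M *) coindep-T x∈T) λ { refl → e∉T x∈T }

  -- A member through `e`, then `z`, then `(E - e) △ z` are triangular on `e`, `p`, `q`: each
  -- contains its own element and misses the earlier ones.
  3≤rk : 3 ≤ rk N
  3≤rk with avoiding
  ... | z , mz , z≢⊥ , z≢h , e∉z with ≢⊥⇒Nonempty z≢⊥ | ≢⊥⇒Nonempty (z≢h ∘ sym ∘ △≡⊥⇒≡)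
  ...   | p , p∈z | q , q∈h△z = ℕ.≤-trans (ℕ.≤-reflexive (sym ∣S∣≡3)) (ℕ.≤-trans (∣I∣≤∣fI∣ coindep-S)
            (indep≤rank N (dual⇒indepN (image⊆N S⊆E) (dual-image coindep-S)) (image⊆N S⊆E)))
    where
    S₁ = ⊥ ∪ ⁅ e ⁆
    S₂ = S₁ ∪ ⁅ p ⁆
    S = S₂ ∪ ⁅ q ⁆
    S₁⇒e : ∀ {j} → j ∈ S₁ → j ≡ e
    S₁⇒e j∈ = [ (λ j∈⊥ → contradiction j∈⊥ ∉⊥) , id ]′ (∈∪⁅⁆⁻ {p = ⊥} j∈)
    S₁∩z : ∀ {j} → j ∈ S₁ → j ∉ z
    S₁∩z j∈ j∈z = e∉z (subst (_∈ z) (S₁⇒e j∈) j∈z)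
    p∈h : p ∈ E - e
    p∈h = x∈p∧x≢y⇒x∈p-y (CycleSpace.⊆ground cs mz p∈z) λ { refl → e∉z p∈z }
    S₂∩h△z : ∀ {j} → j ∈ S₂ → j ∉ (E - e) △ z
    S₂∩h△z j∈ with ∈∪⁅⁆⁻ {p = S₁} j∈
    ... | inj₂ refl = ∉△-both p∈h p∈z
    ... | inj₁ j∈S₁ rewrite S₁⇒e j∈S₁ = ∉△-neither ∉p-x e∉z
    free-S : Free Z S
    free-S = free-extend Z (free-extend Z (free-extend Z {B = ⊥} (λ i∈ → contradiction i∈ ∉⊥)
      (proj₁ (proj₂ through)) (proj₂ (proj₂ through)) (λ j∈ → contradiction j∈ ∉⊥))
      mz p∈z S₁∩z) (△-member Z rest mz) q∈h△z S₂∩h△z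
    S⊆E : S ⊆ E
    S⊆E = ∪-lub (∪-lub (∪-lub ⊥⊆ (x∈p⇒⁅x⁆⊆p e∈E)) (x∈p⇒⁅x⁆⊆p (CycleSpace.⊆ground cs mz p∈z)))
            (x∈p⇒⁅x⁆⊆p (CycleSpace.⊆ground cs (△-member Z rest mz) q∈h△z))
    coindep-S : CoIndep M S
    coindep-S = RowSpace.free⇒ rs S⊆E free-S
    ∣S∣≡3 : ∣ S ∣ ≡ 3
    ∣S∣≡3 = trans (∣p∪⁅x⁆∣≡1+∣p∣ S₂ λ q∈ → S₂∩h△z q∈ q∈h△z) (cong suc
      (trans (∣p∪⁅x⁆∣≡1+∣p∣ S₁ λ p∈ → S₁∩z p∈ p∈z) (cong suc
        (trans (∣p∪⁅x⁆∣≡1+∣p∣ {x = e} ⊥ ∉⊥) (cong suc (∣⊥∣≡0 n))))))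

  iso : M * ≅ N
  iso = mk↔ₛ′ to from
      (λ (j , j∈) → ∈-subset-≡ (proj₂ (proj₂ (f-surjective j∈))))
      (λ (x , x∈) → ∈-subset-≡ (f-injective (proj₂ (from (to (x , x∈)))) x∈ (proj₂ (proj₂ (f-surjective (f∈N x∈))))))
    , indep
    where
    to : ∃ (_∈ E) → ∃ (_∈ ground N)
    to (x , x∈E) = f x , f∈N x∈E
    from : ∃ (_∈ ground N) → ∃ (_∈ E)
    from (j , j∈N) = proj₁ (f-surjective j∈N) , proj₁ (proj₂ (f-surjective j∈N))
    indep : ∀ {I J} → I ⊆ E → J ⊆ ground N → (∀ (x : ∃ (_∈ E)) → proj₁ x ∈ I ⇔ f (proj₁ x) ∈ J) →
            CoIndep M I ⇔ Indep N J
    indep {I} {J′} I⊆E J⊆N h = mk⇔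
      (λ iI → dual⇒indepN J⊆N (dual-image⁺ f V I→J J→I (coindep⇒dual iI)))
      (λ iJ → dual⇒coindep I⊆E (dual-image⁻ f V I→J (λ x∈I y∈I → f-injective (I⊆E x∈I) (I⊆E y∈I)) (indepN⇒dual iJ)))
      where
      I→J : ∀ {x} → x ∈ I → f x ∈ J′
      I→J {x} x∈I = Equivalence.to (h (x , I⊆E x∈I)) x∈I
      J→I : ∀ {j} → j ∈ J′ → ∃[ x ] x ∈ I × f x ≡ j
      J→I j∈J with f-surjective (J⊆N j∈J)
      ... | x , x∈E , refl = x , Equivalence.from (h (x , x∈E)) j∈J , refl

  -- The set `H′` is the support of `y △ η`, and the claim amounts to its minimality. A row inside
  -- it comes from a member that lies, apart from `e`, in `zᶜ`, so the antichain condition applies.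
  complementary : HyperplaneComplementary K
  complementary {H′} hyp = helper (hyperplane⇒min rsK hyp)
    where
    H′⊆K : H′ ⊆ E₀
    H′⊆K = proj₁ (proj₁ hyp)
    helper : Min (rows V E₀) (E₀ ─ H′) → Hyperplane K (E₀ ─ H′)
    helper ((y , D≡) , (d , d∈D) , minimal) = min⇒hyperplane rsK ((y △ η , H′≡) , nonempty , minimal′)
      where
      H′≡ : H′ ≡ supp V E₀ (y △ η)
      H′≡ = trans (sym (─-involutive H′⊆K)) (trans (cong (E₀ ─_) D≡) (sym (supp-complement V E₀ η-true y)))
      zᶜ = supp G E (y △ η)

      ∈H′⁺ : ∀ {x} → x ∈ E → x ≢ e → x ∈ zᶜ → f x ∈ H′
      ∈H′⁺ {x} x∈E x≢e x∈ = subst (f x ∈_) (sym H′≡)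
        (∈supp⁺ V E₀ (y △ η) (f∈K x∈E x≢e) (proj₂ (∈supp⁻ G E (y △ η) x∈)))

      ∈H′⁻ : ∀ {x} → x ∈ E → f x ∈ H′ → x ∈ zᶜ
      ∈H′⁻ {x} x∈E fx∈ = ∈supp⁺ G E (y △ η) x∈E (proj₂ (∈supp⁻ V E₀ (y △ η) (subst (f x ∈_) H′≡ fx∈)))

      -- With `H′` empty, all of `K` would be a minimal row, and the member given by `avoiding`
      -- would have to be `E - e`.
      nonempty : Nonempty H′
      nonempty = decidable-stable (nonempty? H′) λ empty → absurd empty avoiding
        where
        absurd : Empty H′ → ¬ (∃[ z ] Member Z z × z ≢ ⊥ × z ≢ E - e × e ∉ z)
        absurd empty (z , mz , z≢⊥ , z≢h , e∉z) with rowOf mz | ≢⊥⇒Nonempty z≢⊥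
        ... | y₀ , refl | x , x∈z = z≢h (⊆-antisym
          (λ w∈z → x∈p∧x≢y⇒x∈p-y (CycleSpace.⊆ground cs mz w∈z) λ { refl → e∉z w∈z })
          (λ {w} w∈ → let w∈E = p─q⊆p E _ w∈
                          fw∈K = f∈K w∈E λ { refl → ∉p-x w∈ }
                      in ∈supp⁺ G E y₀ w∈E (proj₂ (∈supp⁻ V E₀ y₀
                           (minimal (y₀ , refl) (f x , fx∈) (λ j∈ → x∈p∧x∉q⇒x∈p─q (proj₁ (∈supp⁻ V E₀ y₀ j∈)) λ j∈H → empty (_ , j∈H))
                             (x∈p∧x∉q⇒x∈p─q fw∈K λ j∈H → empty (_ , j∈H)))))))
          where
          fx∈ : f x ∈ supp V E₀ y₀
          fx∈ = ∈supp⁺ V E₀ y₀ (f∈K (CycleSpace.⊆ground cs mz x∈z) λ { refl → e∉z x∈z })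
                  (proj₂ (∈supp⁻ G E y₀ x∈z))

      zᶜ≢h : zᶜ ≢ E - e
      zᶜ≢h eq with K⇒f (p─q⊆p E₀ H′ d∈D)
      ... | x , x∈E , x≢e , refl =
        x∈p─q⇒x∉q E₀ H′ d∈D (∈H′⁺ x∈E x≢e (subst (x ∈_) (sym eq) (x∈p∧x≢y⇒x∈p-y x∈E x≢e)))

      minimal′ : ∀ {D} → Member (rows V E₀) D → Nonempty D → D ⊆ H′ → H′ ⊆ D
      minimal′ (y₂ , refl) (d₂ , d₂∈) D⊆H′ {j} j∈H′ with K⇒f (H′⊆K j∈H′) | K⇒f (proj₁ (∈supp⁻ V E₀ y₂ d₂∈))
      ... | x , x∈E , x≢e , refl | x₂ , x₂∈E , _ , refl =
        ∈supp⁺ V E₀ y₂ (f∈K x∈E x≢e) (proj₂ (∈supp⁻ G E y₂ (subst (x ∈_) (sym z₂≡zᶜ) (∈H′⁻ x∈E j∈H′))))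
        where
        z₂≡zᶜ : supp G E y₂ ≡ zᶜ
        z₂≡zᶜ = antichain (row∈Z y₂) (row∈Z (y △ η))
          (Nonempty⇒≢⊥ (x₂ , ∈supp⁺ G E y₂ x₂∈E (proj₂ (∈supp⁻ V E₀ y₂ d₂∈)))) zᶜ≢h
          λ {w} w∈ → let w∈E , y₂w = ∈supp⁻ G E y₂ (p─q⊆p _ _ w∈)
                     in ∈H′⁻ w∈E (D⊆H′ (∈supp⁺ V E₀ y₂ (f∈K w∈E λ { refl → ∉p-x w∈ }) y₂w))

  in-𝕄 : 𝕄 (M *)
  in-𝕄 = r , H , e′ , X , hyperplane-H , e′∈H , X⊆AG , complementary , rk-K , 3≤rk , iso

module _ {M : Matroid n} {Z : Space n} (cs : CycleSpace M Z) {e : Fin n} (exc : Exceptional (ground M) Z e) where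

  open Exceptional exc

  private
    E = ground M

    -- A member inside `⁅ e ⁆` is empty once `e` is removed, so the antichain condition compares it
    -- with `⊥`.
    non-loop : Indep M ⁅ e ⁆
    non-loop = CycleSpace.⇒indep cs (x∈p⇒⁅x⁆⊆p e∈E) λ {z} mz z⊆e → decidable-stable (z ≟ˢ ⊥) λ z≢⊥ →
      z≢⊥ (antichain mz (⊥-member Z) z≢⊥ ⊥≢rest λ x∈ →
        contradiction (z⊆e (p─q⊆p z _ x∈)) (x∈p─q⇒x∉q z ⁅ e ⁆ x∈))
      where
      ⊥≢rest : ⊥ ≢ E - e
      ⊥≢rest eq with avoiding
      ... | z , mz , z≢⊥ , _ , e∉z with ≢⊥⇒Nonempty z≢⊥
      ...   | x , x∈z = ∉⊥ (subst (x ∈_) (sym eq)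
                (x∈p∧x≢y⇒x∈p-y (CycleSpace.⊆ground cs mz x∈z) λ { refl → e∉z x∈z }))

    with-coordinates : ∀ {r} → Coordinates Z r → (T : Subset n) → CoIndep M T → e ∉ T → ∣ T ∣ ≡ r → 𝕄 (M *)
    with-coordinates {r} co T iT e∉T ∣T∣≡r = conclude (rowOf rest)
      where
      open Coordinates co
      f : Fin n → Fin (2 ^ r)
      f x = vector (col matrix x)
      G : Matrix r n
      G i = allVectors r i ∘ f
      ev-G : ∀ y x → ev y (col G x) ≡ ev y (col matrix x)
      ev-G y x = ev-cong y (col-vector (col matrix x))
      supp≡ : ∀ {z y} → Member Z z → (∀ x → lookup z x ≡ ev y (col matrix x)) → z ≡ supp G E y
      supp≡ {z} {y} mz eq = ⊆-antisym
        (λ {x} x∈z → ∈supp⁺ G E y (CycleSpace.⊆ground cs mz x∈z)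
          (trans (ev-G y x) (trans (sym (eq x)) ([]=⇒lookup x∈z))))
        (λ {x} x∈ → lookup⇒[]= x z (trans (eq x) (trans (sym (ev-G y x)) (proj₂ (∈supp⁻ G E y x∈)))))
      row∈Z : ∀ y → Member Z (supp G E y)
      row∈Z y with member⁺ y
      ... | z , mz , eq = subst (Member Z) (supp≡ {y = y} mz eq) mz
      rowOf : ∀ {z} → Member Z z → ∃[ y ] z ≡ supp G E y
      rowOf mz with member⁻ mz
      ... | y , eq = y , supp≡ {y = y} mz eq
      conclude : (∃[ η ] E - e ≡ supp G E η) → 𝕄 (M *)
      conclude (η , rest≡) = ToGeometry.in-𝕄 cs exc r f row∈Z rowOf η rest≡ T iT e∉T ∣T∣≡r

  exceptional⇒𝕄 : 𝕄 (M *)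
  -- The complement of a basis of `M` through `e` is a basis of the dual that avoids `e`; it fixes
  -- `r` and shows that the affine part has full rank.
  exceptional⇒𝕄 with extend-within M non-loop (proj₂ (basis-exists M))
  ... | B , bB , e⊆B , _ = with-coordinates (coordinates cs bB) (E ─ B) (B , bB , ⊆-refl)
          (λ e∈ → x∈p─q⇒x∉q E B e∈ (e⊆B (x∈⁅x⁆ e))) refl

theorem4p4 : ∀ {n : ℕ} (M : Matroid n) → Binary M →
    ExcludedSeriesMinor CircuitDifference M ⇔ 𝕄 (M *)
theorem4p4 {n} M (k , A , represents) = mk⇔ forward backward
  where
  cs = represented⇒cycleSpace A (λ {I} → represents {I})

  forward : ExcludedSeriesMinor CircuitDifference M → 𝕄 (M *)
  forward ex = exceptional⇒𝕄 cs (proj₂ (excluded⇒exceptional cs ex))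

  backward : 𝕄 (M *) → ExcludedSeriesMinor CircuitDifference M
  backward (r , H , e , X , hyp , e∈H , X⊆ , comp , rk≡ , 3≤ , iso) =
    FromGeometry.excluded M r H e X hyp e∈H X⊆ comp rk≡ 3≤ iso
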